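{- Let $n$ be a positive integer with $n\equiv 3\pmod{4}$. Then, modulo $\Phi_n(q)^2\Phi_{n^2}(q)^2$, \[ \sum_{k=0}^{(n^2-1)/2}\frac{(1+q^{4k+1})(q^2;q^4)_k^3}{(1+q)(q^4;q^4)_k^3}q^k \equiv \frac{[n^2]_{q^2}(q^3;q^4)_{(n^2-1)/2}}{(q^5;q^4)_{(n^2-1)/2}}\, q^{(1-n^2)/2}, \] and \[ \sum_{k=0}^{n^2-1}\frac{(1+q^{4k+1})(q^2;q^4)_k^3}{(1+q)(q^4;q^4)_k^3}q^k \equiv \frac{[n^2]_{q^2}(q^3;q^4)_{(n^2-1)/2}}{(q^5;q^4)_{(n^2-1)/2}}\, q^{(1-n^2)/2}. \]
   Context: The $q$-shifted factorial is $(a;q)_0=1$ and $(a;q)_k=(1-a)(1-aq)\cdots(1-aq^{k-1})$ for $k\geqslant 1$. The $q$-integer is $[N]_q=1+q+\cdots+q^{N-1}$, so $[N]_{q^2}=1+q^2+\cdots+q^{2(N-1)}$. $\Phi_N(q)$ denotes the $N$-th cyclotomic polynomial. For rational functions $A(q),B(q)$, $A(q)\equiv B(q)\pmod{P(q)}$ means that $A(q)-B(q)=P(q)\,U(q)/V(q)$ with polynomials $U,V$ and $V(q)$ relatively prime to $P(q)$. -}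

module Defs where

open import Data.Nat as ℕ using (ℕ; zero; suc; _∸_; _≤?_)
open import Data.Nat.Divisibility using (_∣?_)
import Data.List
open import Data.Integer as ℤ using (ℤ; +_; 0ℤ; 1ℤ)
open import Data.List using (List; []; _∷_; _++_; replicate; length; reverse; foldr; map; upTo; filter)
open import Data.Product using (Σ; ∃; _×_; _,_)
open import Relation.Binary.PropositionalEquality using (_≡_; _≢_)
open import Relation.Nullary using (yes; no)

-- Polynomials in q with integer coefficients: coefficient lists,
-- lowest degree first (trailing zeros allowed).

Poly : Set
Poly = List ℤ

coeff : Poly → ℕ → ℤ
coeff []       _       = 0ℤ
coeff (a ∷ _)  zero    = a
coeff (_ ∷ p)  (suc i) = coeff p i

infix 4 _≈ₚ_
_≈ₚ_ : Poly → Poly → Set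
p ≈ₚ r = ∀ i → coeff p i ≡ coeff r i

infixl 6 _+ₚ_ _-ₚ_
infixl 7 _*ₚ_

_+ₚ_ : Poly → Poly → Poly
[]      +ₚ r       = r
(a ∷ p) +ₚ []      = a ∷ p
(a ∷ p) +ₚ (b ∷ r) = (a ℤ.+ b) ∷ (p +ₚ r)

-ₚ_ : Poly → Poly
-ₚ p = map ℤ.-_ p

_-ₚ_ : Poly → Poly → Poly
p -ₚ r = p +ₚ (-ₚ r)

scale : ℤ → Poly → Poly
scale c p = map (c ℤ.*_) p

_*ₚ_ : Poly → Poly → Poly
[]      *ₚ r = []
(a ∷ p) *ₚ r = scale a r +ₚ (0ℤ ∷ (p *ₚ r))

const : ℤ → Poly
const c = c ∷ []

oneₚ : Poly
oneₚ = const 1ℤ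

monomial : ℤ → ℕ → Poly
monomial c k = replicate k 0ℤ ++ (c ∷ [])

X^ : ℕ → Poly
X^ k = monomial 1ℤ k

infixr 8 _^ₚ_
_^ₚ_ : Poly → ℕ → Poly
p ^ₚ zero  = oneₚ
p ^ₚ suc k = p *ₚ (p ^ₚ k)

prodₚ : List Poly → Poly
prodₚ = foldr _*ₚ_ oneₚ

sumₚ : List Poly → Poly
sumₚ = foldr _+ₚ_ []

private
  dropZeros : List ℤ → List ℤ
  dropZeros []        = []
  dropZeros (+ 0 ∷ p) = dropZeros p
  dropZeros (a ∷ p)   = a ∷ p

  lastOr0 : List ℤ → ℤ
  lastOr0 []           = 0ℤ
  lastOr0 (a ∷ [])     = a
  lastOr0 (_ ∷ b ∷ p)  = lastOr0 (b ∷ p)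

normalize : Poly → Poly
normalize p = reverse (dropZeros (reverse p))

divMonicF : ℕ → Poly → Poly → Poly
divMonicF zero    p d = []
divMonicF (suc f) p d with length (normalize p) ℕ.<? length (normalize d)
... | yes _ = []
... | no  _ =
  let pn = normalize p
      dn = normalize d
      t  = monomial (lastOr0 pn) (length pn ∸ length dn)
  in t +ₚ divMonicF f (pn -ₚ t *ₚ dn) d

divMonic : Poly → Poly → Poly
divMonic p d = divMonicF (suc (length p)) p d

-- Cyclotomic polynomials, via  q^N - 1 = ∏_{d ∣ N} Φ_d(q):
--   Φ_N = (q^N - 1) / ∏_{d ∣ N, 1 ≤ d < N} Φ_d   (fuel = N suffices).

cycF : ℕ → ℕ → Poly
cycF zero    N = oneₚ
cycF (suc f) N =
  divMonic (X^ N -ₚ oneₚ)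
           (prodₚ (map (cycF f) (filter (λ d → d ∣? N) (Data.List.drop 1 (upTo N)))))

Φ : ℕ → Poly
Φ N = cycF (suc N) N

poch : ℕ → ℕ → ℕ → Poly
poch s t k = prodₚ (map (λ j → oneₚ -ₚ X^ (s ℕ.+ t ℕ.* j)) (upTo k))

qint2 : ℕ → Poly
qint2 N = sumₚ (map (λ j → X^ (2 ℕ.* j)) (upTo N))

record Frac : Set where
  constructor _÷_
  field
    num : Poly
    den : Poly
open Frac public

infixl 6 _+f_
_+f_ : Frac → Frac → Frac
(a ÷ b) +f (c ÷ d) = (a *ₚ d +ₚ c *ₚ b) ÷ (b *ₚ d)

sumF : List Frac → Frac
sumF = foldr _+f_ ([] ÷ oneₚ)

-- V relatively prime to P (in ℚ[q]): a V + b P = c for some integer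
-- polynomials a, b and a nonzero integer constant c.
CoprimeP : Poly → Poly → Set
CoprimeP V P = Σ Poly λ a → Σ Poly λ b → Σ ℤ λ c →
  (c ≢ 0ℤ) × (a *ₚ V +ₚ b *ₚ P ≈ₚ const c)

-- A ≡ B (mod P):  A - B = P U / V with V coprime to P.
-- With A = a/b, B = c/d this reads (a d - c b) V = P U b d.
CongMod : Poly → Frac → Frac → Set
CongMod P (a ÷ b) (c ÷ d) = Σ Poly λ U → Σ Poly λ V →
  CoprimeP V P × ((a *ₚ d -ₚ c *ₚ b) *ₚ V ≈ₚ P *ₚ U *ₚ (b *ₚ d))

term : ℕ → Frac
term k = ((oneₚ +ₚ X^ (4 ℕ.* k ℕ.+ 1)) *ₚ poch 2 4 k ^ₚ 3 *ₚ X^ k)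
       ÷ ((oneₚ +ₚ X^ 1) *ₚ poch 4 4 k ^ₚ 3)

sumTerms : ℕ → Frac
sumTerms m = sumF (map term (upTo m))

rhs : ℕ → Frac
rhs n = let N = n ℕ.* n
            M = (N ∸ 1) ℕ./ 2
        in (qint2 N *ₚ poch 3 4 M) ÷ (poch 5 4 M *ₚ X^ M)

modulus : ℕ → Poly
modulus n = Φ n ^ₚ 2 *ₚ Φ (n ℕ.* n) ^ₚ 2

{-# OPTIONS --safe #-}
-- Let Q = q⁴, m = (n − 1)/2 and N = n². The terminating very-well-poised ₆φ₅ summation gives, for s and c free,
--   ∑_{k ≤ m} (1 + s Q^k) (s², c, Q^{-m}; Q)_k / (Q, s²Q/c, s²Q^{m+1}; Q)_k (s Q^{m+1}/c)^k
--     = (1 + s) (s²Q, sQ/c; Q)_m / (s²Q/c, sQ; Q)_m.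
-- Modulo (1 − q^n)² a product (1 − z y₁)(1 − z y₂)(1 − z y₃) with yᵢ powers of q^n depends on y₁ y₂ y₃ only. Hence,
-- for s = q^{1+4ln} and c = q^{2+4ln+2n}, the terms of this sum agree modulo Φ_n² with the terms k = l n + r,
-- 0 ≤ r ≤ m, of the sum in question, up to a common factor; the terms with m < r < n vanish modulo Φ_n³.
-- For n ≡ 3 (mod 4) the product side contains the factors 1 − q^{(2+8l)n} and 1 − q^{-n}, so every block of n terms
-- vanishes modulo Φ_n², as does the right-hand side of the theorem. With N in place of n and l = 0, the product side
-- is exactly the right-hand side of the theorem, which gives the congruences modulo Φ_N².
--
-- All of this takes place in the field of fractions of ℤ[q], with the subring of fractions whose denominators are
-- coprime to Φ_n. That Φ_n (given by long division) divides q^n − 1, and is coprime to q^k − 1 for n ∤ k, follows by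
-- strong induction from q^n − 1 being squarefree.
module Submission where

-- The summation is the case b = √a = s of the ₆φ₅ sum with a = s². There (1 - s²Q^(2k))/(1 - s²)
-- times (s; Q)_k/(sQ; Q)_k collapses to (1 + sQ^k)/(1 + s), the linear factor of the terms, and
-- exactly three numerator and three denominator factors are left to be matched with the cubes. The
-- other parameters are then forced. The linear factor of block l fixes s, termination after m steps
-- supplies Q^(-m) = q^(2-2n), and c is the one value for which the shifts of the three numerator
-- exponents from 2 + 4ln add up to zero. With this c the argument sQ^(m+1)/c is exactly q. The
-- obstacle is that factors 1 - q^j with n dividing j occur in numerators and denominators alike, so
-- each prefix of a product must be shown to be integral at Φ_n. As (1 - q^(an))/(1 - q^(bn)) is a/b
-- modulo Φ_n, nonzero integers have to count as units there. Where divisibility over ℤ itself is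
-- wanted, the integer left over by a Bézout identity is removed with the help of the constant
-- terms, which are invertible in ℤ.

open import Algebra.Bundles using (CommutativeRing)
open import Level using (0ℓ)

-- A ring solver with integer coefficients for any commutative ring.

module IntegerRingSolver {c ℓ} (R : CommutativeRing c ℓ) where

  open import Data.Nat as ℕ using (ℕ; zero; suc)
  open import Data.Integer as ℤ using (ℤ; +_; -[1+_]; _⊖_)
  import Data.Integer.Properties as ℤₚ
  open import Data.Maybe as Maybe using ()
  open import Relation.Nullary.Decidable using (dec⇒maybe)
  import Relation.Binary.PropositionalEquality as ≡
  open import Algebra.Solver.Ring.AlmostCommutativeRing using (fromCommutativeRing; _-Raw-AlmostCommutative⟶_)
  open import Algebra.Bundles using (RawRing)
  open CommutativeRing R
  open import Relation.Binary.Reasoning.Setoid setoid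
  open import Algebra.Properties.Ring ring
  open import Algebra.Properties.AbelianGroup +-abelianGroup using (⁻¹-∙-comm)
  open import Algebra.Properties.Semiring.Mult.TCOptimised semiring

  -- With the optimised multiple, 0 and 1 are sent to `0#` and `1#` by computation, so constants in
  -- solver equations agree with those of the goals by `refl`.
  ofℤ : ℤ → Carrier
  ofℤ (+ n) = n × 1#
  ofℤ -[1+ n ] = - (suc n × 1#)

  ofℤ-neg : ∀ i → ofℤ (ℤ.- i) ≈ - ofℤ i
  ofℤ-neg (+ zero) = sym -0#≈0#
  ofℤ-neg (+ suc n) = refl
  ofℤ-neg -[1+ n ] = sym (-‿involutive _)

  private
    cancel : ∀ x a b → a - b ≈ (x + a) - (x + b)
    cancel x a b = begin
      a - b                    ≈⟨ +-identityˡ _ ⟨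
      0# + (a - b)             ≈⟨ +-congʳ (-‿inverseʳ x) ⟨
      (x - x) + (a - b)        ≈⟨ +-assoc _ _ _ ⟩
      x + (- x + (a - b))      ≈⟨ +-congˡ (+-assoc _ _ _) ⟨
      x + ((- x + a) - b)      ≈⟨ +-congˡ (+-congʳ (+-comm _ _)) ⟩
      x + ((a - x) - b)        ≈⟨ +-congˡ (+-assoc _ _ _) ⟩
      x + (a + (- x - b))      ≈⟨ +-assoc _ _ _ ⟨
      (x + a) + (- x - b)      ≈⟨ +-congˡ (⁻¹-∙-comm _ _) ⟩
      (x + a) - (x + b)        ∎

  ofℤ-⊖ : ∀ m n → ofℤ (m ⊖ n) ≈ (m × 1#) - (n × 1#)
  ofℤ-⊖ zero    zero    = sym (-‿inverseʳ _)
  ofℤ-⊖ zero    (suc n) = sym (+-identityˡ _)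
  ofℤ-⊖ (suc m) zero    = sym (trans (+-congˡ -0#≈0#) (+-identityʳ _))
  ofℤ-⊖ (suc m) (suc n) = begin
    ofℤ (suc m ⊖ suc n)             ≡⟨ ≡.cong ofℤ (ℤₚ.[1+m]⊖[1+n]≡m⊖n m n) ⟩
    ofℤ (m ⊖ n)                     ≈⟨ ofℤ-⊖ m n ⟩
    (m × 1#) - (n × 1#)             ≈⟨ cancel 1# _ _ ⟩
    (1# + m × 1#) - (1# + n × 1#)   ≈⟨ +-cong (×-homo-+ 1# 1 m) (-‿cong (×-homo-+ 1# 1 n)) ⟨
    (suc m × 1#) - (suc n × 1#)     ∎

  ofℤ-+ : ∀ i j → ofℤ (i ℤ.+ j) ≈ ofℤ i + ofℤ j
  ofℤ-+ (+ m)    (+ n)    = ×-homo-+ 1# m n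
  ofℤ-+ (+ m)    -[1+ n ] = ofℤ-⊖ m (suc n)
  ofℤ-+ -[1+ m ] (+ n)    = trans (ofℤ-⊖ n (suc m)) (+-comm _ _)
  ofℤ-+ -[1+ m ] -[1+ n ] = begin
    - (suc (suc (m ℕ.+ n)) × 1#)          ≡⟨ ≡.cong (λ k → - (suc k × 1#)) (≡.sym (ℕₚ.+-suc m n)) ⟩
    - ((suc m ℕ.+ suc n) × 1#)            ≈⟨ -‿cong (×-homo-+ 1# (suc m) (suc n)) ⟩
    - ((suc m × 1#) + (suc n × 1#))       ≈⟨ ⁻¹-∙-comm _ _ ⟨
    - (suc m × 1#) - (suc n × 1#)         ∎
    where import Data.Nat.Properties as ℕₚ

  ofℤ-*⁺ : ∀ m j → ofℤ (+ m ℤ.* j) ≈ (m × 1#) * ofℤ j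
  ofℤ-*⁺ zero    j = trans (reflexive (≡.cong ofℤ (ℤₚ.*-zeroˡ j))) (sym (zeroˡ _))
  ofℤ-*⁺ (suc m) j = begin
    ofℤ (+ suc m ℤ.* j)            ≡⟨ ≡.cong ofℤ (ℤₚ.suc-* (+ m) j) ⟩
    ofℤ (j ℤ.+ + m ℤ.* j)          ≈⟨ ofℤ-+ j (+ m ℤ.* j) ⟩
    ofℤ j + ofℤ (+ m ℤ.* j)        ≈⟨ +-cong (sym (*-identityˡ _)) (ofℤ-*⁺ m j) ⟩
    1# * ofℤ j + (m × 1#) * ofℤ j  ≈⟨ distribʳ _ _ _ ⟨
    (1# + m × 1#) * ofℤ j          ≈⟨ *-congʳ (×-homo-+ 1# 1 m) ⟨
    (suc m × 1#) * ofℤ j           ∎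

  ofℤ-* : ∀ i j → ofℤ (i ℤ.* j) ≈ ofℤ i * ofℤ j
  ofℤ-* (+ m) j = ofℤ-*⁺ m j
  ofℤ-* -[1+ m ] j = begin
    ofℤ (-[1+ m ] ℤ.* j)          ≡⟨ ≡.cong ofℤ (ℤₚ.neg-distribˡ-* (+ suc m) j) ⟨
    ofℤ (ℤ.- (+ suc m ℤ.* j))     ≈⟨ ofℤ-neg (+ suc m ℤ.* j) ⟩
    - ofℤ (+ suc m ℤ.* j)         ≈⟨ -‿cong (ofℤ-*⁺ (suc m) j) ⟩
    - ((suc m × 1#) * ofℤ j)      ≈⟨ -‿distribˡ-* _ _ ⟩
    - (suc m × 1#) * ofℤ j        ∎

  private
    ℤ-rawRing : RawRing _ _
    ℤ-rawRing = CommutativeRing.rawRing ℤₚ.+-*-commutativeRing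

    morphism : ℤ-rawRing -Raw-AlmostCommutative⟶ fromCommutativeRing R
    morphism = record
      { ⟦_⟧ = ofℤ ; +-homo = ofℤ-+ ; *-homo = ofℤ-* ; -‿homo = ofℤ-neg
      ; 0-homo = refl ; 1-homo = refl }

  open import Algebra.Solver.Ring ℤ-rawRing (fromCommutativeRing R) morphism
    (λ i j → Maybe.map (λ i≡j → reflexive (≡.cong ofℤ i≡j)) (dec⇒maybe (i ℤ.≟ j)))
    using (solve; con; _:=_; _:+_; _:*_; _:-_; :-_) public

-- The commutative ring ℤ[q] of coefficient lists.

module PolynomialRing where
  open import Defs
  open import Level using (0ℓ)
  open import Algebra.Bundles using (CommutativeRing)
  open import Data.Nat as ℕ using (ℕ; zero; suc)
  import Data.Integer as ℤ hiding (+_)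
  open ℤ using (ℤ; 0ℤ; 1ℤ)
  import Data.Integer.Properties as ℤₚ
  open import Data.Integer.Tactic.RingSolver using (solve-∀)
  open import Data.List using ([]; _∷_)
  open import Data.Product using (_,_)
  open import Relation.Binary.Structures using (IsEquivalence)
  open import Relation.Binary.PropositionalEquality as ≡ using (_≡_; refl; cong; cong₂; module ≡-Reasoning)

  infix 4 _≋_
  -- A record around `≈ₚ`, which unfolds to a pointwise statement from which unification cannot
  -- recover the two polynomials.
  record _≋_ (p r : Poly) : Set where
    constructor mk≋
    field at : p ≈ₚ r
  open _≋_ public

  ≋-isEquivalence : IsEquivalence _≋_
  ≋-isEquivalence = record
    { refl = mk≋ λ i → refl
    ; sym = λ p → mk≋ λ i → ≡.sym (at p i)
    ; trans = λ p r → mk≋ λ i → ≡.trans (at p i) (at r i) }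

  open IsEquivalence ≋-isEquivalence using () renaming (refl to ≋-refl; sym to ≋-sym; trans to ≋-trans)

  coeff-+ : ∀ p r i → coeff (p +ₚ r) i ≡ coeff p i ℤ.+ coeff r i
  coeff-+ []      r       i       = ≡.sym (ℤₚ.+-identityˡ _)
  coeff-+ (a ∷ p) []      i       = ≡.sym (ℤₚ.+-identityʳ _)
  coeff-+ (a ∷ p) (b ∷ r) zero    = refl
  coeff-+ (a ∷ p) (b ∷ r) (suc i) = coeff-+ p r i

  coeff-neg : ∀ p i → coeff (-ₚ p) i ≡ ℤ.- coeff p i
  coeff-neg []      i       = refl
  coeff-neg (a ∷ p) zero    = refl
  coeff-neg (a ∷ p) (suc i) = coeff-neg p i

  coeff-scale : ∀ c p i → coeff (scale c p) i ≡ c ℤ.* coeff p i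
  coeff-scale c []      i       = ≡.sym (ℤₚ.*-zeroʳ c)
  coeff-scale c (a ∷ p) zero    = refl
  coeff-scale c (a ∷ p) (suc i) = coeff-scale c p i

  coeff-∷* : ∀ a p r i → coeff ((a ∷ p) *ₚ r) i ≡ a ℤ.* coeff r i ℤ.+ coeff (0ℤ ∷ p *ₚ r) i
  coeff-∷* a p r i = ≡.trans (coeff-+ (scale a r) _ i) (cong (ℤ._+ _) (coeff-scale a r i))

  coeff-*-zero : ∀ p r → coeff (p *ₚ r) 0 ≡ coeff p 0 ℤ.* coeff r 0
  coeff-*-zero []      r = refl
  coeff-*-zero (a ∷ p) r = ≡.trans (coeff-∷* a p r 0) (ℤₚ.+-identityʳ _)

  ∷-cong : ∀ {a b p r} → a ≡ b → p ≋ r → a ∷ p ≋ b ∷ r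
  ∷-cong a≡b p≋r = mk≋ λ { zero → a≡b ; (suc i) → at p≋r i }

  +ₚ-cong : ∀ {p p′ r r′} → p ≋ p′ → r ≋ r′ → p +ₚ r ≋ p′ +ₚ r′
  +ₚ-cong {p} {p′} {r} {r′} P R = mk≋ λ i →
    ≡.trans (coeff-+ p r i) (≡.trans (cong₂ ℤ._+_ (at P i) (at R i)) (≡.sym (coeff-+ p′ r′ i)))

  -ₚ-cong : ∀ {p p′} → p ≋ p′ → -ₚ p ≋ -ₚ p′
  -ₚ-cong {p} {p′} P = mk≋ λ i →
    ≡.trans (coeff-neg p i) (≡.trans (cong ℤ.-_ (at P i)) (≡.sym (coeff-neg p′ i)))

  +ₚ-assoc : ∀ p r s → (p +ₚ r) +ₚ s ≋ p +ₚ (r +ₚ s)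
  +ₚ-assoc p r s = mk≋ λ i → begin
    coeff ((p +ₚ r) +ₚ s) i                     ≡⟨ coeff-+ (p +ₚ r) s i ⟩
    coeff (p +ₚ r) i ℤ.+ coeff s i              ≡⟨ cong (ℤ._+ _) (coeff-+ p r i) ⟩
    coeff p i ℤ.+ coeff r i ℤ.+ coeff s i       ≡⟨ ℤₚ.+-assoc (coeff p i) (coeff r i) (coeff s i) ⟩
    coeff p i ℤ.+ (coeff r i ℤ.+ coeff s i)     ≡⟨ cong (λ z → coeff p i ℤ.+ z) (coeff-+ r s i) ⟨
    coeff p i ℤ.+ coeff (r +ₚ s) i              ≡⟨ coeff-+ p (r +ₚ s) i ⟨
    coeff (p +ₚ (r +ₚ s)) i                     ∎
    where open ≡-Reasoning

  +ₚ-comm : ∀ p r → p +ₚ r ≋ r +ₚ p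
  +ₚ-comm p r = mk≋ λ i → ≡.trans (coeff-+ p r i) (≡.trans (ℤₚ.+-comm (coeff p i) _) (≡.sym (coeff-+ r p i)))

  +ₚ-identityʳ : ∀ p → p +ₚ [] ≋ p
  +ₚ-identityʳ p = +ₚ-comm p []

  +ₚ-inverseʳ : ∀ p → p +ₚ -ₚ p ≋ []
  +ₚ-inverseʳ p = mk≋ λ i →
    ≡.trans (coeff-+ p (-ₚ p) i) (≡.trans (cong (λ z → coeff p i ℤ.+ z) (coeff-neg p i)) (ℤₚ.+-inverseʳ (coeff p i)))

  *ₚ-congˡ : ∀ p {r r′} → r ≋ r′ → p *ₚ r ≋ p *ₚ r′
  *ₚ-congˡ []      R = ≋-refl
  *ₚ-congˡ (a ∷ p) {r} {r′} R = mk≋ λ i →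
    ≡.trans (coeff-∷* a p r i) (≡.trans (cong₂ ℤ._+_ (cong (a ℤ.*_) (at R i))
      (at (∷-cong refl (*ₚ-congˡ p R)) i)) (≡.sym (coeff-∷* a p r′ i)))

  *ₚ-zeroʳ : ∀ p → p *ₚ [] ≋ []
  *ₚ-zeroʳ []      = ≋-refl
  *ₚ-zeroʳ (a ∷ p) = mk≋ λ { zero → refl ; (suc i) → at (*ₚ-zeroʳ p) i }

  -- The mirror image of the defining recursion, on the right factor. Commutativity follows from it
  -- by induction.
  *ₚ-∷ : ∀ p b r → p *ₚ (b ∷ r) ≋ scale b p +ₚ (0ℤ ∷ p *ₚ r)
  *ₚ-∷ []      b r = mk≋ λ { zero → refl ; (suc i) → refl }
  *ₚ-∷ (a ∷ p) b r = mk≋ λ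
    { zero → cong (ℤ._+ 0ℤ) (ℤₚ.*-comm a b)
    ; (suc i) → begin
        coeff (scale a r +ₚ p *ₚ (b ∷ r)) i
          ≡⟨ coeff-+ (scale a r) _ i ⟩
        coeff (scale a r) i ℤ.+ coeff (p *ₚ (b ∷ r)) i
          ≡⟨ cong (λ z → coeff (scale a r) i ℤ.+ z) (≡.trans (at (*ₚ-∷ p b r) i) (coeff-+ (scale b p) _ i)) ⟩
        coeff (scale a r) i ℤ.+ (coeff (scale b p) i ℤ.+ coeff (0ℤ ∷ p *ₚ r) i)
          ≡⟨ swap (coeff (scale a r) i) (coeff (scale b p) i) _ ⟩
        coeff (scale b p) i ℤ.+ (coeff (scale a r) i ℤ.+ coeff (0ℤ ∷ p *ₚ r) i)
          ≡⟨ cong (λ z → coeff (scale b p) i ℤ.+ z) (coeff-+ (scale a r) _ i) ⟨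
        coeff (scale b p) i ℤ.+ coeff ((a ∷ p) *ₚ r) i
          ≡⟨ coeff-+ (scale b p) _ i ⟨
        coeff (scale b p +ₚ (a ∷ p) *ₚ r) i ∎ }
    where
    open ≡-Reasoning
    swap : ∀ x y z → x ℤ.+ (y ℤ.+ z) ≡ y ℤ.+ (x ℤ.+ z)
    swap = solve-∀

  *ₚ-comm : ∀ p r → p *ₚ r ≋ r *ₚ p
  *ₚ-comm []      r = ≋-sym (*ₚ-zeroʳ r)
  *ₚ-comm (a ∷ p) r = ≋-trans (+ₚ-cong {scale a r} ≋-refl (∷-cong refl (*ₚ-comm p r))) (≋-sym (*ₚ-∷ r a p))

  *ₚ-cong : ∀ {p p′ r r′} → p ≋ p′ → r ≋ r′ → p *ₚ r ≋ p′ *ₚ r′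
  *ₚ-cong {p} {p′} {r} {r′} P R = ≋-trans (*ₚ-congˡ p R)
    (≋-trans (*ₚ-comm p r′) (≋-trans (*ₚ-congˡ r′ P) (*ₚ-comm r′ p′)))

  *ₚ-distribʳ : ∀ s p r → (p +ₚ r) *ₚ s ≋ p *ₚ s +ₚ r *ₚ s
  *ₚ-distribʳ s []      r       = ≋-refl
  *ₚ-distribʳ s (a ∷ p) []      = ≋-sym (+ₚ-identityʳ _)
  *ₚ-distribʳ s (a ∷ p) (b ∷ r) = mk≋ λ i → begin
    coeff ((a ℤ.+ b ∷ p +ₚ r) *ₚ s) i
      ≡⟨ coeff-∷* (a ℤ.+ b) (p +ₚ r) s i ⟩
    (a ℤ.+ b) ℤ.* coeff s i ℤ.+ coeff (0ℤ ∷ (p +ₚ r) *ₚ s) i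
      ≡⟨ cong (λ z → (a ℤ.+ b) ℤ.* coeff s i ℤ.+ z) (≡.trans (at (∷-cong refl (*ₚ-distribʳ s p r)) i) (coeff-+ (0ℤ ∷ p *ₚ s) (0ℤ ∷ r *ₚ s) i)) ⟩
    (a ℤ.+ b) ℤ.* coeff s i ℤ.+ (coeff (0ℤ ∷ p *ₚ s) i ℤ.+ coeff (0ℤ ∷ r *ₚ s) i)
      ≡⟨ regroup a b (coeff s i) _ _ ⟩
    a ℤ.* coeff s i ℤ.+ coeff (0ℤ ∷ p *ₚ s) i ℤ.+ (b ℤ.* coeff s i ℤ.+ coeff (0ℤ ∷ r *ₚ s) i)
      ≡⟨ cong₂ ℤ._+_ (coeff-∷* a p s i) (coeff-∷* b r s i) ⟨
    coeff ((a ∷ p) *ₚ s) i ℤ.+ coeff ((b ∷ r) *ₚ s) i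
      ≡⟨ coeff-+ ((a ∷ p) *ₚ s) _ i ⟨
    coeff ((a ∷ p) *ₚ s +ₚ (b ∷ r) *ₚ s) i ∎
    where
    open ≡-Reasoning
    regroup : ∀ a b s x y → (a ℤ.+ b) ℤ.* s ℤ.+ (x ℤ.+ y) ≡ a ℤ.* s ℤ.+ x ℤ.+ (b ℤ.* s ℤ.+ y)
    regroup = solve-∀

  scale-* : ∀ a p r → scale a p *ₚ r ≋ scale a (p *ₚ r)
  scale-* a []      r = ≋-refl
  scale-* a (b ∷ p) r = mk≋ λ i → begin
    coeff ((a ℤ.* b ∷ scale a p) *ₚ r) i
      ≡⟨ coeff-∷* (a ℤ.* b) (scale a p) r i ⟩
    a ℤ.* b ℤ.* coeff r i ℤ.+ coeff (0ℤ ∷ scale a p *ₚ r) i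
      ≡⟨ cong (λ z → a ℤ.* b ℤ.* coeff r i ℤ.+ z) (at (∷-cong (≡.sym (ℤₚ.*-zeroʳ a)) (scale-* a p r)) i) ⟩
    a ℤ.* b ℤ.* coeff r i ℤ.+ coeff (scale a (0ℤ ∷ p *ₚ r)) i
      ≡⟨ cong (λ z → a ℤ.* b ℤ.* coeff r i ℤ.+ z) (coeff-scale a (0ℤ ∷ p *ₚ r) i) ⟩
    a ℤ.* b ℤ.* coeff r i ℤ.+ a ℤ.* coeff (0ℤ ∷ p *ₚ r) i
      ≡⟨ regroup a b (coeff r i) _ ⟩
    a ℤ.* (b ℤ.* coeff r i ℤ.+ coeff (0ℤ ∷ p *ₚ r) i)
      ≡⟨ cong (a ℤ.*_) (coeff-∷* b p r i) ⟨
    a ℤ.* coeff ((b ∷ p) *ₚ r) i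
      ≡⟨ coeff-scale a ((b ∷ p) *ₚ r) i ⟨
    coeff (scale a ((b ∷ p) *ₚ r)) i ∎
    where
    open ≡-Reasoning
    regroup : ∀ a b s x → a ℤ.* b ℤ.* s ℤ.+ a ℤ.* x ≡ a ℤ.* (b ℤ.* s ℤ.+ x)
    regroup = solve-∀

  0∷-* : ∀ p r → (0ℤ ∷ p) *ₚ r ≋ 0ℤ ∷ p *ₚ r
  0∷-* p r = mk≋ λ i → ≡.trans (coeff-∷* 0ℤ p r i) (≡.trans (cong (ℤ._+ coeff (0ℤ ∷ p *ₚ r) i) (ℤₚ.*-zeroˡ (coeff r i))) (ℤₚ.+-identityˡ _))

  *ₚ-assoc : ∀ p r s → (p *ₚ r) *ₚ s ≋ p *ₚ (r *ₚ s)
  *ₚ-assoc []      r s = ≋-refl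
  *ₚ-assoc (a ∷ p) r s = ≋-trans (*ₚ-distribʳ s (scale a r) (0ℤ ∷ p *ₚ r))
    (+ₚ-cong (scale-* a r s) (≋-trans (0∷-* (p *ₚ r) s) (∷-cong refl (*ₚ-assoc p r s))))

  const-* : ∀ c p → const c *ₚ p ≋ scale c p
  const-* c p = mk≋ λ i → ≡.trans (coeff-∷* c [] p i) (≡.trans (cong (λ z → c ℤ.* coeff p i ℤ.+ z) (0∷[] i))
    (≡.trans (ℤₚ.+-identityʳ _) (≡.sym (coeff-scale c p i))))
    where
    0∷[] : ∀ i → coeff (0ℤ ∷ []) i ≡ 0ℤ
    0∷[] zero    = refl
    0∷[] (suc i) = refl

  *ₚ-identityˡ : ∀ p → oneₚ *ₚ p ≋ p
  *ₚ-identityˡ p = ≋-trans (const-* 1ℤ p) (mk≋ λ i → ≡.trans (coeff-scale 1ℤ p i) (ℤₚ.*-identityˡ _))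

  polyRing : CommutativeRing 0ℓ 0ℓ
  polyRing = record
    { Carrier = Poly ; _≈_ = _≋_ ; _+_ = _+ₚ_ ; _*_ = _*ₚ_ ; -_ = -ₚ_ ; 0# = [] ; 1# = oneₚ
    ; isCommutativeRing = record
      { isRing = record
        { +-isAbelianGroup = record
          { isGroup = record
            { isMonoid = record
              { isSemigroup = record
                { isMagma = record { isEquivalence = ≋-isEquivalence ; ∙-cong = +ₚ-cong }
                ; assoc = +ₚ-assoc }
              ; identity = (λ _ → ≋-refl) , +ₚ-identityʳ }
            ; inverse = (λ p → ≋-trans (+ₚ-comm (-ₚ p) p) (+ₚ-inverseʳ p)) , +ₚ-inverseʳ
            ; ⁻¹-cong = -ₚ-cong }
          ; comm = +ₚ-comm }
        ; *-cong = *ₚ-cong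
        ; *-assoc = *ₚ-assoc
        ; *-identity = *ₚ-identityˡ , λ p → ≋-trans (*ₚ-comm p oneₚ) (*ₚ-identityˡ p)
        ; distrib = (λ s p r → ≋-trans (*ₚ-comm s (p +ₚ r)) (≋-trans (*ₚ-distribʳ s p r)
                      (+ₚ-cong (*ₚ-comm p s) (*ₚ-comm r s)))) , *ₚ-distribʳ }
      ; *-comm = *ₚ-comm } }

-- Leading coefficients and the correctness of long division.

module MonicDivision where
  open import Defs
  open PolynomialRing
  open import Algebra.Bundles using (CommutativeRing)
  open import Data.Nat as ℕ using (ℕ; zero; suc; pred; _≤_; _<_; z≤n; s≤s; _∸_)
  import Data.Nat.Properties as ℕₚ
  import Data.Integer as ℤ hiding (+_)
  open ℤ using (ℤ; 0ℤ; 1ℤ)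
  open import Data.Integer using (+_; -[1+_])
  import Data.Integer.Properties as ℤₚ
  open import Data.List using (List; []; _∷_; length; reverse; _∷ʳ_)
  import Data.List.Properties as Listₚ
  open import Data.Product using (_×_; _,_; proj₁; proj₂)
  open import Data.Sum using (inj₁; inj₂)
  open import Relation.Nullary using (yes; no; contradiction)
  open import Relation.Binary.PropositionalEquality as ≡ using (_≡_; cong; cong₂; module ≡-Reasoning)
  open CommutativeRing polyRing hiding (zero; _≉_)
  open IntegerRingSolver polyRing using (solve; con; _:=_; _:+_; _:*_; _:-_; :-_)

  Deg< : Poly → ℕ → Set
  Deg< p k = ∀ i → k ≤ i → coeff p i ≡ 0ℤ

  -- `c` may be zero, so that `Lead-*` needs no case distinction; nonvanishing is asked for
  -- separately where it matters.
  Lead : Poly → ℕ → ℤ → Set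
  Lead p e c = coeff p e ≡ c × Deg< p (suc e)

  Deg<-resp : ∀ {p r k} → p ≋ r → Deg< p k → Deg< r k
  Deg<-resp p≋r D i k≤i = ≡.trans (≡.sym (at p≋r i)) (D i k≤i)

  Lead-resp : ∀ {p r e c} → p ≋ r → Lead p e c → Lead r e c
  Lead-resp {p} {r} p≋r (eq , D) = ≡.trans (≡.sym (at p≋r _)) eq , Deg<-resp {p} {r} p≋r D

  Lead-* : ∀ p r {e f c c′} → Lead p e c → Lead r f c′ → Lead (p *ₚ r) (e ℕ.+ f) (c ℤ.* c′)
  Lead-* [] r {c′ = c′} (≡.refl , _) _ = ≡.refl , λ _ _ → ≡.refl
  Lead-* (a ∷ p) r {zero} {f} (≡.refl , D) (eq , E) =
      ≡.trans (drop f) (cong (a ℤ.*_) eq)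
    , λ i f<i → ≡.trans (drop i) (≡.trans (cong (a ℤ.*_) (E i f<i)) (ℤₚ.*-zeroʳ a))
    where
    p≋[] : p ≋ []
    p≋[] = mk≋ λ i → D (suc i) (s≤s z≤n)
    drop : ∀ i → coeff ((a ∷ p) *ₚ r) i ≡ a ℤ.* coeff r i
    drop i = ≡.trans (coeff-∷* a p r i) (≡.trans (cong (λ z → a ℤ.* coeff r i ℤ.+ z) (tail i)) (ℤₚ.+-identityʳ _))
      where
      tail : ∀ i → coeff (0ℤ ∷ p *ₚ r) i ≡ 0ℤ
      tail zero    = ≡.refl
      tail (suc i) = at (*ₚ-cong {r = r} p≋[] refl) i
  Lead-* (a ∷ p) r {suc e} {f} {c} {c′} (eq , D) R@(eq′ , E)
    with eq″ , D″ ← Lead-* p r {e} {f} (eq , λ i le → D (suc i) (s≤s le)) R =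
      ≡.trans (shift (e ℕ.+ f) (s≤s (ℕₚ.m≤n+m f e))) eq″
    , λ { (suc i) (s≤s le) → ≡.trans (shift i (s≤s (ℕₚ.≤-trans (ℕₚ.m≤n+m f e) (ℕₚ.≤-trans (ℕₚ.n≤1+n _) le)))) (D″ i le) }
    where
    shift : ∀ i → suc f ≤ suc i → coeff ((a ∷ p) *ₚ r) (suc i) ≡ coeff (p *ₚ r) i
    shift i le = ≡.trans (coeff-∷* a p r (suc i)) (≡.trans (cong (λ z → a ℤ.* z ℤ.+ coeff (p *ₚ r) i) (E (suc i) le))
      (≡.trans (cong (ℤ._+ coeff (p *ₚ r) i) (ℤₚ.*-zeroʳ a)) (ℤₚ.+-identityˡ _)))

  Lead-monomial : ∀ c k → Lead (monomial c k) k c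
  Lead-monomial c zero    = ≡.refl , λ { (suc i) _ → ≡.refl }
  Lead-monomial c (suc k) with eq , D ← Lead-monomial c k = eq , λ { (suc i) (s≤s le) → D i le }

  -- This settles the stopping case of the division: a multiple of `d` of lower degree than `d` has
  -- quotient zero. From index e + 1 on, the head of `p` contributes nothing to the product, so the
  -- induction clears the tail of `p` first, and the coefficient at e then clears the head.
  Deg<-*-Lead⇒≋[] : ∀ p d {e} → Lead d e 1ℤ → Deg< (p *ₚ d) e → p ≋ []
  Deg<-*-Lead⇒≋[] [] d L D = refl
  Deg<-*-Lead⇒≋[] (a ∷ p) d {e} (eq , E) D = mk≋ λ { zero → a≡0 ; (suc i) → at p≋[] i }
    where
    open ≡-Reasoning
    p≋[] : p ≋ []
    p≋[] = Deg<-*-Lead⇒≋[] p d (eq , E) λ i e≤i → begin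
      coeff (p *ₚ d) i                                   ≡⟨ ℤₚ.+-identityˡ _ ⟨
      0ℤ ℤ.+ coeff (p *ₚ d) i                            ≡⟨ cong (ℤ._+ coeff (p *ₚ d) i) (≡.trans (cong (a ℤ.*_) (E (suc i) (s≤s e≤i))) (ℤₚ.*-zeroʳ a)) ⟨
      a ℤ.* coeff d (suc i) ℤ.+ coeff (p *ₚ d) i         ≡⟨ coeff-∷* a p d (suc i) ⟨
      coeff ((a ∷ p) *ₚ d) (suc i)                       ≡⟨ D (suc i) (ℕₚ.≤-trans e≤i (ℕₚ.n≤1+n i)) ⟩
      0ℤ                                                 ∎
    tail : ∀ i → coeff (0ℤ ∷ p *ₚ d) i ≡ 0ℤ
    tail zero    = ≡.refl
    tail (suc i) = at (*ₚ-cong {r = d} p≋[] refl) i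
    a≡0 : a ≡ 0ℤ
    a≡0 = begin
      a                                            ≡⟨ ≡.trans (ℤₚ.+-identityʳ _) (ℤₚ.*-identityʳ a) ⟨
      a ℤ.* 1ℤ ℤ.+ 0ℤ                              ≡⟨ cong₂ (λ x y → a ℤ.* x ℤ.+ y) eq (tail e) ⟨
      a ℤ.* coeff d e ℤ.+ coeff (0ℤ ∷ p *ₚ d) e    ≡⟨ coeff-∷* a p d e ⟨
      coeff ((a ∷ p) *ₚ d) e                       ≡⟨ D e ℕₚ.≤-refl ⟩
      0ℤ                                           ∎

  -- dropZeros and lastOr0 are private to Defs: below, they are reached through types left to unification.
  dropZeros′ : List ℤ → List ℤ
  dropZeros′ []        = []
  dropZeros′ (+ 0 ∷ p) = dropZeros′ p
  dropZeros′ (a ∷ p)   = a ∷ p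

  mutual
    normalize-reverse : ∀ w → normalize (reverse w) ≡ reverse (dropZeros′ w)
    normalize-reverse w rewrite Listₚ.reverse-involutive w = reverse-dropZeros w

    private
      reverse-dropZeros : ∀ w → _ ≡ reverse (dropZeros′ w)
      reverse-dropZeros []              = ≡.refl
      reverse-dropZeros (+ 0 ∷ w)       = reverse-dropZeros w
      reverse-dropZeros (+ suc _ ∷ w)   = ≡.refl
      reverse-dropZeros (-[1+ _ ] ∷ w)  = ≡.refl

  -- One step of `normalize` seen from the constant term: a zero is kept only in front of a nonempty
  -- list. Thus a function that strips the high end can be treated by induction from the low end.
  cons : ℤ → Poly → Poly
  cons (+ 0) [] = []
  cons a     r  = a ∷ r

  cons-∷ : ∀ a b r → cons a (b ∷ r) ≡ a ∷ b ∷ r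
  cons-∷ (+ 0)     b r = ≡.refl
  cons-∷ (+ suc _) b r = ≡.refl
  cons-∷ -[1+ _ ]  b r = ≡.refl

  cons-≋ : ∀ a r → cons a r ≋ a ∷ r
  cons-≋ (+ 0)     []      = mk≋ λ { zero → ≡.refl ; (suc i) → ≡.refl }
  cons-≋ (+ suc _) []      = refl
  cons-≋ -[1+ _ ]  []      = refl
  cons-≋ a         (b ∷ r) = reflexive (cons-∷ a b r)

  normalize-∷ : ∀ a p → normalize (a ∷ p) ≡ cons a (normalize p)
  normalize-∷ a p = begin
    normalize (a ∷ p)                          ≡⟨ cong normalize (Listₚ.reverse-involutive (a ∷ p)) ⟨
    normalize (reverse (reverse (a ∷ p)))      ≡⟨ normalize-reverse (reverse (a ∷ p)) ⟩
    reverse (dropZeros′ (reverse (a ∷ p)))     ≡⟨ cong (λ w → reverse (dropZeros′ w)) (Listₚ.unfold-reverse a p) ⟩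
    reverse (dropZeros′ (reverse p ∷ʳ a))      ≡⟨ snoc (reverse p) ⟩
    cons a (reverse (dropZeros′ (reverse p)))  ≡⟨ cong (cons a) (normalize-reverse (reverse p)) ⟨
    cons a (normalize (reverse (reverse p)))   ≡⟨ cong (λ w → cons a (normalize w)) (Listₚ.reverse-involutive p) ⟩
    cons a (normalize p)                       ∎
    where
    open ≡-Reasoning
    keep : ∀ b w → reverse (b ∷ w ∷ʳ a) ≡ cons a (reverse (b ∷ w))
    keep b w = ≡.trans (Listₚ.reverse-++ (b ∷ w) (a ∷ [])) (front (reverse (b ∷ w)) (Listₚ.length-reverse (b ∷ w)))
      where
      front : ∀ r {k} → length r ≡ suc k → a ∷ r ≡ cons a r
      front (x ∷ r) _ = ≡.sym (cons-∷ a x r)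
    single : ∀ a → reverse (dropZeros′ (a ∷ [])) ≡ cons a []
    single (+ 0)     = ≡.refl
    single (+ suc _) = ≡.refl
    single -[1+ _ ]  = ≡.refl
    snoc : ∀ w → reverse (dropZeros′ (w ∷ʳ a)) ≡ cons a (reverse (dropZeros′ w))
    snoc []              = single a
    snoc (+ 0 ∷ w)       = snoc w
    snoc (+ suc n ∷ w)   = keep (+ suc n) w
    snoc (-[1+ n ] ∷ w)  = keep -[1+ n ] w

  normalize-≋ : ∀ p → normalize p ≋ p
  normalize-≋ []      = refl
  normalize-≋ (a ∷ p) = trans (reflexive (normalize-∷ a p)) (trans (cons-≋ a (normalize p)) (∷-cong ≡.refl (normalize-≋ p)))

  length-normalize-≤ : ∀ p {k} → Deg< p k → length (normalize p) ≤ k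
  length-normalize-≤ []      D = z≤n
  length-normalize-≤ (a ∷ p) {zero} D
    rewrite normalize-∷ a p | D 0 z≤n
    with normalize p | length-normalize-≤ p {0} (λ i _ → D (suc i) z≤n)
  ... | [] | _ = z≤n
  length-normalize-≤ (a ∷ p) {suc k} D
    rewrite normalize-∷ a p =
    ℕₚ.≤-trans (length-cons a (normalize p)) (s≤s (length-normalize-≤ p (λ i le → D (suc i) (s≤s le))))
    where
    length-cons : ∀ a r → length (cons a r) ≤ suc (length r)
    length-cons (+ 0)     []      = z≤n
    length-cons (+ suc _) []      = ℕₚ.≤-refl
    length-cons -[1+ _ ]  []      = ℕₚ.≤-refl
    length-cons a         (b ∷ r) = ℕₚ.≤-reflexive (cong length (cons-∷ a b r))

  Deg<-length : ∀ p → Deg< p (length p)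
  Deg<-length []      i       le       = ≡.refl
  Deg<-length (a ∷ p) (suc i) (s≤s le) = Deg<-length p i le

  Deg<-normalize : ∀ p → Deg< p (length (normalize p))
  Deg<-normalize p = Deg<-resp {normalize p} (normalize-≋ p) (Deg<-length (normalize p))

  length-normalize-Lead : ∀ {d e} → Lead d e 1ℤ → length (normalize d) ≡ suc e
  length-normalize-Lead {d} {e} (eq , D) = ℕₚ.≤-antisym (length-normalize-≤ d D)
    (ℕₚ.≰⇒> λ le → contradiction (≡.trans (≡.sym eq) (Deg<-normalize d e le)) λ ())

  last : Poly → ℤ
  last r = coeff r (pred (length r))

  private
    step : ℤ → ℕ → Poly → Poly → Poly
    step c f pn d = let t = monomial c (length pn ∸ length (normalize d)) in
      t +ₚ divMonicF f (pn -ₚ t *ₚ normalize d) d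

    divMonicF-stop : ∀ f p d → length (normalize p) < length (normalize d) → divMonicF (suc f) p d ≡ []
    divMonicF-stop f p d lt with length (normalize p) ℕ.<? length (normalize d)
    ... | yes _  = ≡.refl
    ... | no  ¬lt = contradiction lt ¬lt

    mutual
      divMonicF-step : ∀ f p d → length (normalize d) ≤ length (normalize p) →
        divMonicF (suc f) p d ≡ step (last (normalize p)) f (normalize p) d
      divMonicF-step f p d ge with length (normalize p) ℕ.<? length (normalize d)
      ... | yes lt = contradiction ge (ℕₚ.<⇒≱ lt)
      ... | no  _  with normalize p
      ...   | w = cong (λ c → step c f w d) (lastOr0-last w)

      lastOr0-last : ∀ r → _ ≡ last r
      lastOr0-last []          = ≡.refl
      lastOr0-last (a ∷ [])    = ≡.refl
      lastOr0-last (_ ∷ b ∷ p) = lastOr0-last (b ∷ p)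

  -- Induction on the fuel. Subtracting `t *ₚ d` leaves the exact multiple `(q -ₚ t) *ₚ d`, so no
  -- remainder ever has to be described; the normalized dividend gets shorter, which keeps the fuel
  -- sufficient.
  divMonicF-correct : ∀ f p d q {e} → Lead d e 1ℤ → p ≋ q *ₚ d → length (normalize p) < f → divMonicF f p d ≋ q
  divMonicF-correct (suc f) p d q {e} L@(_ , E) p≋qd (s≤s le) with ℕₚ.<-≤-connex (length (normalize p)) (length (normalize d))
  ... | inj₁ p<d = trans (reflexive (divMonicF-stop f p d p<d)) (sym (Deg<-*-Lead⇒≋[] q d L λ i e≤i → ≡.trans (≡.sym (at p≋qd i)) (Deg<-normalize p i
          (ℕₚ.≤-trans (ℕₚ.≤-pred (ℕₚ.≤-trans p<d (ℕₚ.≤-reflexive (length-normalize-Lead {d} L)))) e≤i))))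
  ... | inj₂ d≤p = trans (reflexive (divMonicF-step f p d d≤p)) (trans (+-congˡ {t} (divMonicF-correct f p₁ d (q -ₚ t) L p₁≋ p₁-short))
                     (solve 2 (λ t q → t :+ (q :- t) := q) refl t q))
    where
    e≤ : suc e ≤ length (normalize p)
    e≤ = ℕₚ.≤-trans (ℕₚ.≤-reflexive (≡.sym (length-normalize-Lead {d} L))) d≤p
    -- The degree of `p`. The monomial `t` has degree `E′ ∸ e`, so the leading terms of `p` and of
    -- `t *ₚ d` meet at `E′` and cancel.
    E′ = pred (length (normalize p))
    E′-suc : suc E′ ≡ length (normalize p)
    E′-suc = ℕₚ.suc-pred _ ⦃ ℕ.>-nonZero (ℕₚ.≤-trans (s≤s z≤n) e≤) ⦄
    t = monomial (last (normalize p)) (length (normalize p) ∸ length (normalize d))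
    p₁ = normalize p -ₚ t *ₚ normalize d
    p₁≋ : p₁ ≋ (q -ₚ t) *ₚ d
    p₁≋ = trans (+-cong (trans (normalize-≋ p) p≋qd) (-‿cong (*-congˡ {t} (normalize-≋ d))))
      (solve 3 (λ q t d → q :* d :- t :* d := (q :- t) :* d) refl q t d)
    deg : length (normalize p) ∸ length (normalize d) ℕ.+ e ≡ E′
    deg = ≡.trans (cong₂ (λ x y → x ∸ y ℕ.+ e) (≡.sym E′-suc) (length-normalize-Lead {d} L))
      (ℕₚ.m∸n+n≡m (ℕₚ.≤-pred (ℕₚ.≤-trans e≤ (ℕₚ.≤-reflexive (≡.sym E′-suc)))))
    Lt : Lead (t *ₚ normalize d) E′ (coeff p E′)
    Lt = ≡.subst₂ (Lead (t *ₚ normalize d)) deg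
      (≡.trans (ℤₚ.*-identityʳ _) (at (normalize-≋ p) _))
      (Lead-* t (normalize d) (Lead-monomial _ (length (normalize p) ∸ length (normalize d))) (Lead-resp {d} (sym (normalize-≋ d)) L))
    coeff-p₁ : ∀ i → coeff p₁ i ≡ coeff p i ℤ.- coeff (t *ₚ normalize d) i
    coeff-p₁ i = ≡.trans (coeff-+ (normalize p) _ i) (cong₂ ℤ._+_ (at (normalize-≋ p) i) (coeff-neg (t *ₚ normalize d) i))
    p₁-deg : Deg< p₁ E′
    p₁-deg i le with ℕₚ.m≤n⇒m<n∨m≡n le
    ... | inj₁ lt = ≡.trans (coeff-p₁ i) (cong₂ ℤ._-_ (Deg<-normalize p i (ℕₚ.≤-trans (ℕₚ.≤-reflexive (≡.sym E′-suc)) lt)) (proj₂ Lt i lt))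
    ... | inj₂ ≡.refl = ≡.trans (coeff-p₁ i) (ℤₚ.i≡j⇒i-j≡0 (≡.sym (proj₁ Lt)))
    p₁-short : length (normalize p₁) < f
    p₁-short = ℕₚ.≤-trans (s≤s (length-normalize-≤ p₁ p₁-deg)) (ℕₚ.≤-trans (ℕₚ.≤-reflexive E′-suc) le)

  divMonic-correct : ∀ p d q {e} → Lead d e 1ℤ → p ≋ q *ₚ d → divMonic p d ≋ q
  divMonic-correct p d q L eq = divMonicF-correct _ p d q L eq (s≤s (length-normalize-≤ p (Deg<-length p)))

-- Coprimality by Bézout identities; Bézout identities for x^m - 1.

module CoprimalityInRings {c ℓ} (R : CommutativeRing c ℓ) where
  open import Level using (_⊔_)
  import Data.Nat
  open import Data.Integer using (+_)
  open import Data.Product using (Σ; _,_)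
  open CommutativeRing R
  open import Relation.Binary.Reasoning.Setoid setoid
  open IntegerRingSolver R

  infix 4 _∣_
  record _∣_ (x y : Carrier) : Set (c ⊔ ℓ) where
    constructor divides
    field
      quotient : Carrier
      equality : y ≈ x * quotient

  -- `S` consists of the elements that count as units. With the nonzero integer constants for `S`,
  -- identities of ℚ[q] are expressed inside ℤ[q].
  module Coprimality {s} (S : Carrier → Set s)
    (S-1 : S 1#) (S-* : ∀ {x y} → S x → S y → S (x * y)) where

    record Coprime (v p : Carrier) : Set (c ⊔ ℓ ⊔ s) where
      constructor coprime
      field
        a b e   : Carrier
        e∈S     : S e
        bézout  : a * v + b * p ≈ e

    coprime-sym : ∀ {v p} → Coprime v p → Coprime p v
    coprime-sym (coprime a b e e∈S eq) = coprime b a e e∈S (trans (+-comm _ _) eq)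

    coprime-1 : ∀ {p} → Coprime 1# p
    coprime-1 {p} = coprime 1# 0# 1# S-1 (solve 1 (λ p → con (+ 1) :* con (+ 1) :+ con (+ 0) :* p := con (+ 1)) refl p)

    coprime-* : ∀ {v w p} → Coprime v p → Coprime w p → Coprime (v * w) p
    coprime-* {v} {w} {p} (coprime a b e e∈S eq) (coprime a′ b′ e′ e′∈S eq′) =
      coprime (a * a′) (a * v * b′ + b * a′ * w + b * p * b′) (e * e′) (S-* e∈S e′∈S) (begin
        a * a′ * (v * w) + (a * v * b′ + b * a′ * w + b * p * b′) * p
          ≈⟨ solve 7 (λ a a′ v w b b′ p → a :* a′ :* (v :* w) :+ (a :* v :* b′ :+ b :* a′ :* w :+ b :* p :* b′) :* p
               := (a :* v :+ b :* p) :* (a′ :* w :+ b′ :* p)) refl a a′ v w b b′ p ⟩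
        (a * v + b * p) * (a′ * w + b′ * p) ≈⟨ *-cong eq eq′ ⟩
        e * e′ ∎)

    coprime-∣ : ∀ {v w p} → v ∣ w → Coprime w p → Coprime v p
    coprime-∣ {v} {w} {p} (divides u w≈) (coprime a b e e∈S eq) = coprime (a * u) b e e∈S (begin
      a * u * v + b * p     ≈⟨ +-congʳ (solve 3 (λ a u v → a :* u :* v := a :* (v :* u)) refl a u v) ⟩
      a * (v * u) + b * p   ≈⟨ +-congʳ (*-congˡ w≈) ⟨
      a * w + b * p         ≈⟨ eq ⟩
      e                     ∎)

    coprime-resp : ∀ {v w p} → v ≈ w → Coprime v p → Coprime w p
    coprime-resp v≈w = coprime-∣ (divides 1# (trans v≈w (sym (*-identityʳ _))))

    coprime-combination : ∀ {v w p} x y → x * v + y * p ≈ w → Coprime w p → Coprime v p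
    coprime-combination {v} {w} {p} x y xv+yp≈w (coprime a b e e∈S eq) = coprime (a * x) (a * y + b) e e∈S (begin
      a * x * v + (a * y + b) * p
        ≈⟨ solve 6 (λ a x v y b p → a :* x :* v :+ (a :* y :+ b) :* p := a :* (x :* v :+ y :* p) :+ b :* p) refl a x v y b p ⟩
      a * (x * v + y * p) + b * p ≈⟨ +-congʳ (*-congˡ xv+yp≈w) ⟩
      a * w + b * p ≈⟨ eq ⟩
      e ∎)

    coprime-shift : ∀ {v p} w → Coprime v p → Coprime (v + w * p) p
    coprime-shift {v} {p} w = coprime-combination 1# (- w)
      (solve 3 (λ v w p → con (+ 1) :* (v :+ w :* p) :+ :- w :* p := v) refl v w p)

    coprime-unit : ∀ {v p} → S v → Coprime v p
    coprime-unit {v} {p} v∈S = coprime 1# 0# v v∈S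
      (solve 2 (λ v p → con (+ 1) :* v :+ con (+ 0) :* p := v) refl v p)

  module Geometric (x : Data.Nat.ℕ → Carrier)
    (x-zero : x 0 ≈ 1#) (x-+ : ∀ m n → x (m Data.Nat.+ n) ≈ x m * x n) where
    open import Data.Nat as ℕ using (ℕ; zero; suc)
    open import Data.Nat.GCD using (module Bézout)
    open import Data.Product using (∃₂)

    x^_−1 : ℕ → Carrier
    x^ n −1 = x n - 1#

    x^−1-+ : ∀ m n → x^ (m ℕ.+ n) −1 ≈ x m * x^ n −1 + x^ m −1
    x^−1-+ m n = trans (+-congʳ (x-+ m n))
      (solve 2 (λ a b → a :* b :- con (+ 1) := a :* (b :- con (+ 1)) :+ (a :- con (+ 1))) refl (x m) (x n))

    -- The sum 1 + x^m + ... + x^((u-1)m) in Horner form.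
    geometric : ℕ → ℕ → Carrier
    geometric m zero    = 0#
    geometric m (suc u) = x m * geometric m u + 1#

    x^−1-* : ∀ u m → x^ (u ℕ.* m) −1 ≈ geometric m u * x^ m −1
    x^−1-* zero    m = trans (+-congʳ x-zero) (trans (-‿inverseʳ 1#) (sym (zeroˡ _)))
    x^−1-* (suc u) m = trans (x^−1-+ m (u ℕ.* m)) (trans (+-congʳ (*-congˡ (x^−1-* u m)))
      (solve 3 (λ p g e → p :* (g :* e) :+ e := (p :* g :+ con (+ 1)) :* e) refl (x m) (geometric m u) (x^ m −1)))

    -- Each power of `x m` is 1 modulo `x^ m −1`, so the sum becomes its number of terms. Positive
    -- integers are therefore required to lie in `S` later on.
    geometric-≈ : ∀ m u → Σ Carrier λ t → geometric m u ≈ ofℤ (+ u) + t * x^ m −1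
    geometric-≈ m zero    = 0# , solve 1 (λ e → con (+ 0) := con (+ 0) :+ con (+ 0) :* e) refl (x^ m −1)
    geometric-≈ m (suc u) with t , eq ← geometric-≈ m u = x m * t + ofℤ (+ u) , (begin
      x m * geometric m u + 1#                ≈⟨ +-congʳ (*-congˡ eq) ⟩
      x m * (ofℤ (+ u) + t * x^ m −1) + 1#
        ≈⟨ solve 3 (λ p u t → p :* (u :+ t :* (p :- con (+ 1))) :+ con (+ 1)
             := (con (+ 1) :+ u) :+ (p :* t :+ u) :* (p :- con (+ 1))) refl (x m) (ofℤ (+ u)) t ⟩
      (1# + ofℤ (+ u)) + (x m * t + ofℤ (+ u)) * x^ m −1 ≈⟨ +-congʳ (ofℤ-+ (+ 1) (+ u)) ⟨
      ofℤ (+ suc u) + (x m * t + ofℤ (+ u)) * x^ m −1 ∎)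

    -- No negative exponents arise: g + vn = um gives x^(um) - 1 = x^g (x^(vn) - 1) + (x^g - 1), and
    -- x^(um) - 1, x^(vn) - 1 are multiples of x^m - 1, x^n - 1.
    bézout-−1 : ∀ {g m n} → Bézout.Identity g m n → ∃₂ λ a b → a * x^ m −1 + b * x^ n −1 ≈ x^ g −1
    bézout-−1 {g} {m} {n} (Bézout.+- u v eq) = geometric m u , - (x g * geometric n v) , (begin
      geometric m u * x^ m −1 + - (x g * geometric n v) * x^ n −1
        ≈⟨ +-congʳ (sym (x^−1-* u m)) ⟩
      x^ (u ℕ.* m) −1 + - (x g * geometric n v) * x^ n −1
        ≈⟨ +-congʳ (trans (reflexive (≡.cong x^_−1 (≡.sym eq))) (x^−1-+ g (v ℕ.* n))) ⟩
      (x g * x^ (v ℕ.* n) −1 + x^ g −1) + - (x g * geometric n v) * x^ n −1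
        ≈⟨ +-congʳ (+-congʳ (*-congˡ (x^−1-* v n))) ⟩
      (x g * (geometric n v * x^ n −1) + x^ g −1) + - (x g * geometric n v) * x^ n −1
        ≈⟨ solve 4 (λ p s e f → (p :* (s :* e) :+ f) :+ :- (p :* s) :* e := f) refl (x g) (geometric n v) (x^ n −1) (x^ g −1) ⟩
      x^ g −1 ∎)
      where import Relation.Binary.PropositionalEquality as ≡
    bézout-−1 {g} {m} {n} (Bézout.-+ u v eq) with a , b , eq′ ← bézout-−1 {g} {n} {m} (Bézout.+- v u eq) =
      b , a , trans (+-comm _ _) eq′

-- Divisibility and coprimality of the cyclotomic polynomials.

module CyclotomicPolynomials where
  open import Defs
  open PolynomialRing
  open MonicDivision
  open import Algebra.Bundles using (CommutativeRing)
  open import Data.Nat as ℕ using (ℕ; zero; suc; _≤_; _<_; z≤n; s≤s)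
  import Data.Nat.Properties as ℕₚ
  open import Data.Nat.Divisibility as ℕ∣ using (_∣?_)
  open import Data.Nat.GCD using (module Bézout; module GCD)
  open import Data.Nat.Induction using (<-rec)
  import Data.Integer as ℤ hiding (+_)
  open ℤ using (ℤ; 0ℤ; 1ℤ; -1ℤ)
  open import Data.Integer using (+_)
  import Data.Integer.Properties as ℤₚ
  open import Data.Integer.Tactic.RingSolver using (solve-∀)
  open import Data.List using (List; []; _∷_; map; filter; upTo; applyUpTo; drop)
  import Data.List.Properties as Listₚ
  open import Data.List.Relation.Unary.All as All using (All; []; _∷_)
  open import Data.List.Relation.Unary.Any using (here; there)
  open import Data.List.Membership.Propositional using (_∈_)
  open import Data.List.Membership.Propositional.Properties using (∈-filter⁺; ∈-filter⁻; ∈-applyUpTo⁺; ∈-applyUpTo⁻)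
  open import Data.List.Relation.Unary.Unique.Propositional using (Unique; []; _∷_)
  import Data.List.Relation.Unary.Unique.Propositional.Properties as Uniqueₚ
  open import Data.Product using (Σ; ∃; _×_; _,_; proj₁; proj₂)
  open import Data.Sum using (_⊎_; inj₁; inj₂)
  open import Function using (_∘_)
  open import Relation.Binary.Definitions using (tri<; tri≈; tri>)
  open import Relation.Nullary using (¬_; yes; no; contradiction)
  open import Relation.Binary.PropositionalEquality as ≡ using (_≡_; _≢_; cong; cong₂; module ≡-Reasoning)
  open CommutativeRing polyRing hiding (zero; _≉_)
  open import Relation.Binary.Reasoning.Setoid setoid
  open IntegerRingSolver polyRing using (solve; con; _:=_; _:+_; _:*_; _:-_; :-_; ofℤ; ofℤ-+)
  open CoprimalityInRings polyRing

  NonzeroConst : Poly → Set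
  NonzeroConst p = Σ ℤ λ c → c ≢ 0ℤ × p ≋ const c

  NonzeroConst-* : ∀ {p r} → NonzeroConst p → NonzeroConst r → NonzeroConst (p *ₚ r)
  NonzeroConst-* {p} {r} (c , c≢0 , p≋c) (d , d≢0 , r≋d) = c ℤ.* d , cd≢0 ,
    trans (*ₚ-cong p≋c r≋d) (const-* c (const d))
    where
    cd≢0 : c ℤ.* d ≢ 0ℤ
    cd≢0 eq with ℤₚ.i*j≡0⇒i≡0∨j≡0 c eq
    ... | inj₁ c≡0 = c≢0 c≡0
    ... | inj₂ d≡0 = d≢0 d≡0

  NonzeroConst-1 : NonzeroConst oneₚ
  NonzeroConst-1 = 1ℤ , (λ ()) , refl

  open Coprimality NonzeroConst NonzeroConst-1 NonzeroConst-* public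

  ofℤ-const : ∀ n → ofℤ (+ suc n) ≋ const (+ suc n)
  ofℤ-const zero    = refl
  ofℤ-const (suc n) = trans (ofℤ-+ (+ 1) (+ suc n)) (+-congˡ {ofℤ (+ 1)} (ofℤ-const n))

  NonzeroConst-ofℤ : ∀ n → NonzeroConst (ofℤ (+ suc n))
  NonzeroConst-ofℤ n = + suc n , (λ ()) , ofℤ-const n

  X^-+ : ∀ m n → X^ (m ℕ.+ n) ≋ X^ m *ₚ X^ n
  X^-+ zero    n = sym (*-identityˡ (X^ n))
  X^-+ (suc m) n = trans (∷-cong ≡.refl (X^-+ m n)) (sym (0∷-* (X^ m) (X^ n)))

  open Geometric X^ refl X^-+

  -- The derivation q·d/dq.
  θ : Poly → Poly
  θ []      = []
  θ (a ∷ p) = 0ℤ ∷ p +ₚ θ p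

  -- Unlike d/dq, this derivation preserves degrees: every power of q is an eigenvector, and on q^N
  -- - 1 it leaves the constant N after N (q^N - 1) is subtracted.
  coeff-θ : ∀ p i → coeff (θ p) i ≡ + i ℤ.* coeff p i
  coeff-θ []      i       = ≡.sym (ℤₚ.*-zeroʳ (+ i))
  coeff-θ (a ∷ p) zero    = ≡.refl
  coeff-θ (a ∷ p) (suc i) = ≡.trans (coeff-+ p (θ p) i)
    (≡.trans (cong (λ z → coeff p i ℤ.+ z) (coeff-θ p i)) (≡.sym (ℤₚ.suc-* (+ i) (coeff p i))))

  θ-+ : ∀ p r → θ (p +ₚ r) ≋ θ p +ₚ θ r
  θ-+ p r = mk≋ λ i → ≡.trans (coeff-θ (p +ₚ r) i) (≡.trans (cong (+ i ℤ.*_) (coeff-+ p r i))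
    (≡.trans (ℤₚ.*-distribˡ-+ (+ i) (coeff p i) (coeff r i))
      (≡.sym (≡.trans (coeff-+ (θ p) (θ r) i) (cong₂ ℤ._+_ (coeff-θ p i) (coeff-θ r i))))))

  θ-scale : ∀ c p → θ (scale c p) ≋ scale c (θ p)
  θ-scale c p = mk≋ λ i → ≡.trans (coeff-θ (scale c p) i) (≡.trans (cong (+ i ℤ.*_) (coeff-scale c p i))
    (≡.trans (swap (+ i) c (coeff p i)) (≡.sym (≡.trans (coeff-scale c (θ p) i) (cong (c ℤ.*_) (coeff-θ p i))))))
    where
    swap : ∀ i c x → i ℤ.* (c ℤ.* x) ≡ c ℤ.* (i ℤ.* x)
    swap = solve-∀

  θ-* : ∀ p r → θ (p *ₚ r) ≋ θ p *ₚ r +ₚ p *ₚ θ r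
  θ-* []      r = refl
  θ-* (a ∷ p) r = begin
    θ (scale a r +ₚ (0ℤ ∷ p *ₚ r))                           ≈⟨ θ-+ (scale a r) _ ⟩
    θ (scale a r) +ₚ (0ℤ ∷ p *ₚ r +ₚ θ (p *ₚ r))             ≈⟨ +-cong (θ-scale a r) (∷-cong ≡.refl (+-congˡ {p *ₚ r} (θ-* p r))) ⟩
    scale a (θ r) +ₚ ((0ℤ ∷ p *ₚ r) +ₚ ((0ℤ ∷ θ p *ₚ r) +ₚ (0ℤ ∷ p *ₚ θ r)))
      ≈⟨ solve 4 (λ s x y z → s :+ (x :+ (y :+ z)) := (x :+ y) :+ (s :+ z)) refl (scale a (θ r)) (0ℤ ∷ p *ₚ r) (0ℤ ∷ θ p *ₚ r) (0ℤ ∷ p *ₚ θ r) ⟩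
    (0ℤ ∷ p *ₚ r +ₚ θ p *ₚ r) +ₚ (a ∷ p) *ₚ θ r              ≈⟨ +-congʳ {(a ∷ p) *ₚ θ r} (∷-cong {0ℤ} ≡.refl (*ₚ-distribʳ r p (θ p))) ⟨
    (0ℤ ∷ (p +ₚ θ p) *ₚ r) +ₚ (a ∷ p) *ₚ θ r                 ≈⟨ +-congʳ {(a ∷ p) *ₚ θ r} (0∷-* (p +ₚ θ p) r) ⟨
    (0ℤ ∷ p +ₚ θ p) *ₚ r +ₚ (a ∷ p) *ₚ θ r                   ∎

  θ-cong : ∀ {p r} → p ≋ r → θ p ≋ θ r
  θ-cong {p} {r} p≋r = mk≋ λ i → ≡.trans (coeff-θ p i) (≡.trans (cong (+ i ℤ.*_) (at p≋r i)) (≡.sym (coeff-θ r i)))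

  coeff-X^-≢ : ∀ n {i} → i ≢ n → coeff (X^ n) i ≡ 0ℤ
  coeff-X^-≢ zero    {zero}  i≢n = contradiction ≡.refl i≢n
  coeff-X^-≢ zero    {suc i} i≢n = ≡.refl
  coeff-X^-≢ (suc n) {zero}  i≢n = ≡.refl
  coeff-X^-≢ (suc n) {suc i} i≢n = coeff-X^-≢ n (i≢n ∘ cong suc)

  θ-X^ : ∀ n → θ (X^ n) ≋ scale (+ n) (X^ n)
  θ-X^ n = mk≋ λ i → ≡.trans (coeff-θ (X^ n) i) (≡.trans (lemma i) (≡.sym (coeff-scale (+ n) (X^ n) i)))
    where
    lemma : ∀ i → + i ℤ.* coeff (X^ n) i ≡ + n ℤ.* coeff (X^ n) i
    lemma i with i ℕ.≟ n
    ... | yes ≡.refl = ≡.refl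
    ... | no  i≢n    = ≡.trans (cong (+ i ℤ.*_) z) (≡.trans (ℤₚ.*-zeroʳ (+ i)) (≡.sym (≡.trans (cong (+ n ℤ.*_) z) (ℤₚ.*-zeroʳ (+ n)))))
      where z = coeff-X^-≢ n i≢n

  -- From N = q·d/dq (X^N − 1) − N (X^N − 1).
  squarefree : ∀ {N f g} → 0 < N → f *ₚ g ≋ x^ N −1 → Coprime f g
  squarefree {N} {f} {g} 0<N eq = coprime (θ g) (θ f -ₚ const (+ N) *ₚ f) (const (+ N))
    (+ N , (λ N≡0 → ℕₚ.<⇒≢ 0<N (≡.sym (ℤₚ.+-injective N≡0))) , refl) (begin
    θ g *ₚ f +ₚ (θ f -ₚ const (+ N) *ₚ f) *ₚ g
      ≈⟨ solve 5 (λ θg f θf c g → θg :* f :+ (θf :- c :* f) :* g := (θf :* g :+ f :* θg) :- c :* (f :* g)) refl (θ g) f (θ f) (const (+ N)) g ⟩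
    (θ f *ₚ g +ₚ f *ₚ θ g) -ₚ const (+ N) *ₚ (f *ₚ g)
      ≈⟨ +-cong (trans (sym (θ-* f g)) (θ-cong eq)) (-‿cong (*-congˡ {const (+ N)} eq)) ⟩
    θ (x^ N −1) -ₚ const (+ N) *ₚ (x^ N −1)
      ≈⟨ +-congʳ { -ₚ (const (+ N) *ₚ (x^ N −1))} (trans (θ-+ (X^ N) (-ₚ oneₚ)) (+-cong {y = _} {u = θ (-ₚ oneₚ)} {v = []} (θ-X^ N) (mk≋ λ { zero → ≡.refl ; (suc i) → ≡.refl }))) ⟩
    scale (+ N) (X^ N) +ₚ [] -ₚ const (+ N) *ₚ (x^ N −1)
      ≈⟨ +-congʳ { -ₚ (const (+ N) *ₚ (x^ N −1))} (+-congʳ {[]} (const-* (+ N) (X^ N))) ⟨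
    const (+ N) *ₚ X^ N +ₚ [] -ₚ const (+ N) *ₚ (x^ N −1)
      ≈⟨ solve 2 (λ c x → c :* x :+ con (+ 0) :- c :* (x :- con (+ 1)) := c) refl (const (+ N)) (X^ N) ⟩
    const (+ N) ∎)

  -- This takes the place of primitivity in Gauss's lemma. A constant term invertible in ℤ permits
  -- division from the bottom up with integer coefficients, and it passes to divisors.
  UnitConst : Poly → Set
  UnitConst p = Σ ℤ λ u → u ℤ.* coeff p 0 ≡ 1ℤ

  UnitConst-factor : ∀ p r → UnitConst (p *ₚ r) → UnitConst p
  UnitConst-factor p r (u , eq) = u ℤ.* coeff r 0 , ≡.trans (swap u (coeff r 0) (coeff p 0)) (≡.trans (cong (u ℤ.*_) (≡.sym (coeff-*-zero p r))) eq)
    where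
    swap : ∀ u x y → u ℤ.* x ℤ.* y ≡ u ℤ.* (y ℤ.* x)
    swap = solve-∀

  const-cancel : ∀ {c p r} → c ≢ 0ℤ → const c *ₚ p ≋ const c *ₚ r → p ≋ r
  const-cancel {c} {p} {r} c≢0 eq = mk≋ λ i → ℤₚ.*-cancelˡ-≡ c _ _ ⦃ ℤ.≢-nonZero c≢0 ⦄
    (≡.trans (≡.sym (coeff-scale c p i)) (≡.trans (at (trans (sym (const-* c p)) (trans eq (const-* c r))) i) (coeff-scale c r i)))

  tail : Poly → Poly
  tail []      = []
  tail (_ ∷ p) = p

  coeff-tail : ∀ p i → coeff (tail p) i ≡ coeff p (suc i)
  coeff-tail []      i = ≡.refl
  coeff-tail (a ∷ p) i = ≡.refl

  -- Gauss: the coefficients of the quotient s are divisible by c one after the other, from the bottom up.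
  ∣-const-* : ∀ d s c p → UnitConst d → c ≢ 0ℤ → d *ₚ s ≋ const c *ₚ p → d ∣ p
  ∣-const-* d s c p (u , ud₀≡1) c≢0 eq =
    divides (proj₁ s/c) (const-cancel c≢0 (trans (sym eq) (trans (*-congˡ {d} (proj₂ s/c))
      (solve 3 (λ d c s → d :* (c :* s) := c :* (d :* s)) refl d (const c) (proj₁ s/c)))))
    where
    quot : ∀ s p → d *ₚ s ≋ scale c p → ∃ λ s′ → s ≋ const c *ₚ s′
    quot []      p eq = [] , sym (zeroʳ (const c))
    quot (a ∷ s) p eq = b ∷ proj₁ rec , trans (∷-cong a≡cb (trans (proj₂ rec) (const-* c (proj₁ rec)))) (sym (const-* c (b ∷ proj₁ rec)))
      where
      -- The constant terms satisfy a d₀ = c p₀, and u d₀ = 1, hence a = c (u p₀).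
      b = u ℤ.* coeff p 0
      eq₀ : a ℤ.* coeff d 0 ≡ c ℤ.* coeff p 0
      eq₀ = ≡.trans (≡.trans (ℤₚ.*-comm a (coeff d 0)) (≡.sym (coeff-*-zero d (a ∷ s)))) (≡.trans (at eq 0) (coeff-scale c p 0))
      a≡cb : a ≡ c ℤ.* b
      a≡cb = ≡.trans (≡.sym (≡.trans (cong (a ℤ.*_) ud₀≡1) (ℤₚ.*-identityʳ a)))
        (≡.trans (swap₁ a u (coeff d 0)) (≡.trans (cong (u ℤ.*_) eq₀) (swap₂ u c (coeff p 0))))
        where
        swap₁ : ∀ a u d → a ℤ.* (u ℤ.* d) ≡ u ℤ.* (a ℤ.* d)
        swap₁ = solve-∀
        swap₂ : ∀ u c p → u ℤ.* (c ℤ.* p) ≡ c ℤ.* (u ℤ.* p)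
        swap₂ = solve-∀
      eqₛ : d *ₚ s ≋ scale c (tail p -ₚ scale b (tail d))
      eqₛ = mk≋ λ i → ≡.sym (≡.trans (coeff-scale c (tail p -ₚ scale b (tail d)) i) (≡.trans
        (cong (c ℤ.*_) (≡.trans (coeff-+ (tail p) _ i) (cong₂ ℤ._+_ (coeff-tail p i)
          (≡.trans (coeff-neg (scale b (tail d)) i) (cong ℤ.-_ (≡.trans (coeff-scale b (tail d) i) (cong (b ℤ.*_) (coeff-tail d i))))))))
        (≡.trans (distr c b (coeff p (suc i)) (coeff d (suc i)))
        (≡.trans (cong₂ (λ x y → x ℤ.+ ℤ.- (y ℤ.* coeff d (suc i)))
          (≡.trans (≡.sym (coeff-scale c p (suc i))) (≡.trans (≡.sym (at eq (suc i)))
            (≡.trans (at (*ₚ-∷ d a s) (suc i)) (≡.trans (coeff-+ (scale a d) _ (suc i)) (cong (ℤ._+ coeff (d *ₚ s) i) (coeff-scale a d (suc i)))))))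
          (≡.sym a≡cb))
        (simp (a ℤ.* coeff d (suc i)) (coeff (d *ₚ s) i))))))
        where
        distr : ∀ c b x y → c ℤ.* (x ℤ.+ ℤ.- (b ℤ.* y)) ≡ c ℤ.* x ℤ.+ ℤ.- (c ℤ.* b ℤ.* y)
        distr = solve-∀
        simp : ∀ x y → x ℤ.+ y ℤ.+ ℤ.- x ≡ y
        simp = solve-∀
      rec = quot s (tail p -ₚ scale b (tail d)) eqₛ
    s/c = quot s p (trans eq (const-* c p))

  properDivisors : ℕ → List ℕ
  properDivisors N = filter (λ d → d ∣? N) (drop 1 (upTo N))

  record ProperDivisor (d N : ℕ) : Set where
    constructor properDivisor
    field
      positive : 0 < d
      smaller  : d < N
      divisor  : d ℕ∣.∣ N
  open ProperDivisor

  ∈-properDivisors⁻ : ∀ N {d} → d ∈ properDivisors N → ProperDivisor d N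
  ∈-properDivisors⁻ (suc N) {d} d∈ with d∈range , d∣N ← ∈-filter⁻ (λ d → d ∣? suc N) {xs = applyUpTo suc N} d∈
    with i , i<N , ≡.refl ← ∈-applyUpTo⁻ suc d∈range = properDivisor (s≤s z≤n) (s≤s i<N) d∣N

  ∈-properDivisors⁺ : ∀ {d N} → ProperDivisor d N → d ∈ properDivisors N
  ∈-properDivisors⁺ {suc d} {suc N} (properDivisor _ (s≤s d<N) d∣N) = ∈-filter⁺ (λ d → d ∣? suc N) {xs = applyUpTo suc N} (∈-applyUpTo⁺ suc d<N) d∣N

  properDivisors-unique : ∀ N → Unique (properDivisors N)
  properDivisors-unique N = Uniqueₚ.filter⁺ (λ d → d ∣? N) (Uniqueₚ.drop⁺ 1 (Uniqueₚ.upTo⁺ N))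

  -- Inside `Φ N` the factor with index e is computed with fuel N, whereas `Φ e` itself has fuel e +
  -- 1. Both exceed e, and this is all that counts.
  cycF-fuel : ∀ f g d → d < f → d < g → cycF f d ≡ cycF g d
  cycF-fuel (suc f) (suc g) d (s≤s d≤f) (s≤s d≤g) = cong (λ ps → divMonic (X^ d -ₚ oneₚ) (prodₚ ps))
    (Listₚ.map-cong-local (All.tabulate {xs = properDivisors d} λ {e} e∈ → let e<d = smaller (∈-properDivisors⁻ d e∈) in
      cycF-fuel f g e (ℕₚ.<-≤-trans e<d d≤f) (ℕₚ.<-≤-trans e<d d≤g)))

  Ψ : ℕ → Poly
  Ψ N = prodₚ (map Φ (properDivisors N))

  Φ-unfold : ∀ N → Φ N ≡ divMonic (x^ N −1) (Ψ N)
  Φ-unfold N = cong (λ ps → divMonic (x^ N −1) (prodₚ ps))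
    (Listₚ.map-cong-local (All.tabulate {xs = properDivisors N} λ {e} e∈ → cycF-fuel N (suc e) e (smaller (∈-properDivisors⁻ N e∈)) (ℕₚ.n<1+n e)))

  ∈⇒∣prod : ∀ {f : ℕ → Poly} {d ds} → d ∈ ds → f d ∣ prodₚ (map f ds)
  ∈⇒∣prod {f} {d} {ds = d ∷ ds} (here ≡.refl) = divides (prodₚ (map f ds)) refl
  ∈⇒∣prod {f} {d} {ds = e ∷ ds} (there d∈) with divides s eq ← ∈⇒∣prod {f} d∈ =
    divides (f e *ₚ s) (trans (*-congˡ {f e} eq) (solve 3 (λ e d s → e :* (d :* s) := d :* (e :* s)) refl (f e) (f d) s))

  coprime-prod : ∀ {f : ℕ → Poly} {p ds} → (∀ {d} → d ∈ ds → Coprime (f d) p) → Coprime (prodₚ (map f ds)) p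
  coprime-prod {ds = []}     C = coprime-1
  coprime-prod {ds = d ∷ ds} C = coprime-* (C (here ≡.refl)) (coprime-prod (C ∘ there))

  ∣-trans : ∀ {p r s} → p ∣ r → r ∣ s → p ∣ s
  ∣-trans {p} (divides u eq) (divides v eq′) = divides (u *ₚ v) (trans eq′ (trans (*-congʳ eq) (*-assoc p u v)))

  ∣⇒−1∣−1 : ∀ {d n} → d ℕ∣.∣ n → x^ d −1 ∣ x^ n −1
  ∣⇒−1∣−1 {d} (ℕ∣.divides u ≡.refl) = divides (geometric d u) (trans (x^−1-* u d) (*-comm (geometric d u) (x^ d −1)))

  record Monic (p : Poly) : Set where
    constructor monic
    field
      {degree} : ℕ
      lead     : Lead p degree 1ℤ

  -- The invariant of the strong induction. Monic factors make `Ψ N` an admissible divisor for long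
  -- division, and invertible constant terms allow coprime divisors to be multiplied over ℤ.
  record Cyclotomic (N : ℕ) : Set where
    field
      Φ-monic : Monic (Φ N)
      Φ-unit  : UnitConst (Φ N)
      Φ*Ψ     : Φ N *ₚ Ψ N ≋ x^ N −1

    Φ∣−1 : Φ N ∣ x^ N −1
    Φ∣−1 = divides (Ψ N) (sym Φ*Ψ)
  open Cyclotomic

  private
    UpTo : ℕ → Set
    UpTo N = ∀ {d} → 0 < d → d ≤ N → Cyclotomic d

  -- X^d − 1 is a product of Φ_e with e ∣ d, and Φ_e Φ_N divides the squarefree X^N − 1.
  coprime-properDivisor : ∀ {N d} → UpTo N → ProperDivisor d N → Coprime (x^ d −1) (Φ N)
  coprime-properDivisor {N} {d} cyc D@(properDivisor 0<d d<N d∣N) =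
    coprime-resp (Φ*Ψ (cyc 0<d (ℕₚ.<⇒≤ d<N))) (coprime-* (factor D) (coprime-prod {Φ} λ {e} e∈ → factor (below (∈-properDivisors⁻ d e∈))))
    where
    0<N : 0 < N
    0<N = ℕₚ.<-trans 0<d d<N
    below : ∀ {e} → ProperDivisor e d → ProperDivisor e N
    below (properDivisor 0<e e<d e∣d) = properDivisor 0<e (ℕₚ.<-trans e<d d<N) (ℕ∣.∣-trans e∣d d∣N)
    factor : ∀ {e} → ProperDivisor e N → Coprime (Φ e) (Φ N)
    factor {e} E = coprime-∣ (∈⇒∣prod {Φ} (∈-properDivisors⁺ E))
      (squarefree 0<N (trans (*-comm (Ψ N) (Φ N)) (Φ*Ψ (cyc 0<N ℕₚ.≤-refl))))

  -- Bézout replaces m by g = gcd(m, N) at the cost of a multiple of q^N - 1, hence of `Φ N`. As N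
  -- does not divide m, g is a proper divisor of N.
  coprime-−1 : ∀ {N} → 0 < N → UpTo N → ∀ {m} → ¬ N ℕ∣.∣ m → Coprime (x^ m −1) (Φ N)
  coprime-−1 {N} 0<N cyc {m} N∤m with Bézout.result g G ident ← Bézout.lemma m N
    with a , b , eq ← bézout-−1 {g} {m} {N} ident =
    coprime-combination a (b *ₚ Ψ N) (begin
      a *ₚ x^ m −1 +ₚ b *ₚ Ψ N *ₚ Φ N
        ≈⟨ +-congˡ {a *ₚ x^ m −1} (trans (solve 3 (λ b p f → b :* p :* f := b :* (f :* p)) refl b (Ψ N) (Φ N)) (*-congˡ {b} (Φ*Ψ (cyc 0<N ℕₚ.≤-refl)))) ⟩
      a *ₚ x^ m −1 +ₚ b *ₚ x^ N −1 ≈⟨ eq ⟩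
      x^ g −1 ∎)
    (coprime-properDivisor cyc (properDivisor 0<g g<N g∣N))
    where
    g∣N = GCD.gcd∣n G
    0<g : 0 < g
    0<g = ℕₚ.n≢0⇒n>0 λ { ≡.refl → ℕₚ.<⇒≢ 0<N (≡.sym (ℕ∣.0∣⇒≡0 g∣N)) }
    g<N : g < N
    g<N = ℕₚ.≤∧≢⇒< (ℕ∣.∣⇒≤ ⦃ ℕ.>-nonZero 0<N ⦄ g∣N) λ { ≡.refl → N∤m (GCD.gcd∣m G) }

  -- Distinct indices cannot divide each other. If e does not divide d, then `Φ d` is a factor of
  -- q^d - 1, which is coprime to `Φ e`; otherwise the roles are exchanged.
  coprime-Φ : ∀ {d e} → 0 < d → 0 < e → UpTo d → UpTo e → d ≢ e → Coprime (Φ d) (Φ e)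
  coprime-Φ {d} {e} 0<d 0<e cyc-d cyc-e d≢e with e ∣? d | d ∣? e
  ... | no  e∤d | _       = coprime-∣ (Φ∣−1 (cyc-d 0<d ℕₚ.≤-refl)) (coprime-−1 0<e cyc-e e∤d)
  ... | yes e∣d | no d∤e  = coprime-sym (coprime-∣ (Φ∣−1 (cyc-e 0<e ℕₚ.≤-refl)) (coprime-−1 0<d cyc-d d∤e))
  ... | yes e∣d | yes d∣e = contradiction (ℕ∣.∣-antisym d∣e e∣d) d≢e

  -- Euclid's lemma. The Bézout identity only shows that `f` divides a nonzero integer multiple of
  -- `t`; the invertible constant term of `f` removes the integer.
  coprime-∣-cancel : ∀ {f p s t} → UnitConst f → Coprime f p → f ∣ s → s ≋ p *ₚ t → f ∣ t
  coprime-∣-cancel {f} {p} {s} {t} unit (coprime a b e (c , c≢0 , e≋c) eq) (divides u s≋) s≋pt =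
    ∣-const-* f (a *ₚ t +ₚ b *ₚ u) c t unit c≢0 (begin
      f *ₚ (a *ₚ t +ₚ b *ₚ u)       ≈⟨ solve 5 (λ f a t b u → f :* (a :* t :+ b :* u) := a :* f :* t :+ b :* (f :* u)) refl f a t b u ⟩
      a *ₚ f *ₚ t +ₚ b *ₚ (f *ₚ u)  ≈⟨ +-congˡ {a *ₚ f *ₚ t} (*-congˡ {b} (trans (sym s≋) s≋pt)) ⟩
      a *ₚ f *ₚ t +ₚ b *ₚ (p *ₚ t)  ≈⟨ solve 5 (λ a f t b p → a :* f :* t :+ b :* (p :* t) := (a :* f :+ b :* p) :* t) refl a f t b p ⟩
      (a *ₚ f +ₚ b *ₚ p) *ₚ t       ≈⟨ *-congʳ (trans eq e≋c) ⟩
      const c *ₚ t                  ∎)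

  Monic-prod : ∀ {f : ℕ → Poly} {ds} → (∀ {d} → d ∈ ds → Monic (f d)) → Monic (prodₚ (map f ds))
  Monic-prod {f} {[]}     M = monic {degree = 0} (≡.refl , λ { (suc i) _ → ≡.refl })
  Monic-prod {f} {d ∷ ds} M with monic l ← M (here ≡.refl) | monic l′ ← Monic-prod {f} (M ∘ there) = monic (Lead-* (f d) _ l l′)

  ∣-product : ∀ {f p s} → UnitConst f → Coprime p f → f ∣ s → p ∣ s → f *ₚ p ∣ s
  ∣-product {f} {p} {s} unit C f∣s (divides t s≋) = combine (coprime-∣-cancel unit (coprime-sym C) f∣s s≋)
    where
    combine : f ∣ t → f *ₚ p ∣ s
    combine (divides v t≋) = divides v (trans s≋ (trans (*-congˡ {p} t≋) (solve 3 (λ p d v → p :* (d :* v) := d :* p :* v) refl p f v)))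

  prod∣ : ∀ {f : ℕ → Poly} {s ds} → Unique ds → (∀ {d} → d ∈ ds → UnitConst (f d)) → (∀ {d} → d ∈ ds → f d ∣ s) →
    (∀ {d e} → d ∈ ds → e ∈ ds → d ≢ e → Coprime (f d) (f e)) → prodₚ (map f ds) ∣ s
  prod∣ {f} {s} {[]}     []            U D C = divides s (sym (*-identityˡ s))
  prod∣ {f} {s} {d ∷ ds} (d∉ds ∷ uniq) U D C = ∣-product {f d} {prodₚ (map f ds)} {s} (U {d} (here ≡.refl))
    (coprime-prod {f} {f d} {ds} λ {e} e∈ → C {e} {d} (there e∈) (here ≡.refl) (≡.≢-sym (All.lookup d∉ds e∈)))
    (D {d} (here ≡.refl))
    (prod∣ {f} {s} {ds} uniq (λ x → U (there x)) (λ x → D (there x)) (λ x y → C (there x) (there y)))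

  Lead-unique : ∀ {p e f c d} → c ≢ 0ℤ → d ≢ 0ℤ → Lead p e c → Lead p f d → c ≡ d
  Lead-unique {p} {e} {f} c≢0 d≢0 (eq , D) (eq′ , E) with ℕₚ.<-cmp e f
  ... | tri< e<f _ _ = contradiction (≡.trans (≡.sym eq′) (D f e<f)) d≢0
  ... | tri≈ _ ≡.refl _ = ≡.trans (≡.sym eq) eq′
  ... | tri> _ _ f<e = contradiction (≡.trans (≡.sym eq) (E e f<e)) c≢0

  zero-or-Lead : ∀ p → p ≋ [] ⊎ ∃ λ e → ∃ λ c → c ≢ 0ℤ × Lead p e c
  zero-or-Lead []      = inj₁ refl
  zero-or-Lead (a ∷ p) with zero-or-Lead p
  ... | inj₂ (e , c , c≢0 , eq , D) = inj₂ (suc e , c , c≢0 , eq , λ { (suc i) (s≤s le) → D i le })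
  ... | inj₁ p≋[] with a ℤ.≟ 0ℤ
  ...   | yes ≡.refl = inj₁ (mk≋ λ { zero → ≡.refl ; (suc i) → at p≋[] i })
  ...   | no  a≢0    = inj₂ (0 , a , a≢0 , ≡.refl , λ { (suc i) _ → at p≋[] i })

  Lead-−1 : ∀ {N} → 0 < N → Lead (x^ N −1) N 1ℤ
  Lead-−1 {suc N} _ with eq , D ← Lead-monomial 1ℤ N = ≡.trans (at (+ₚ-identityʳ (X^ N)) N) eq ,
    λ { (suc i) (s≤s le) → ≡.trans (at (+ₚ-identityʳ (X^ N)) i) (D i le) }

  Monic-quotient : ∀ {q d p e} → Monic d → Lead p e 1ℤ → q *ₚ d ≋ p → Monic q
  Monic-quotient {q} {d} {p} {e} (monic l) L eq with zero-or-Lead q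
  ... | inj₁ q≋[] = contradiction (≡.trans (≡.sym (proj₁ L)) (at (trans (sym eq) (trans (*-congʳ q≋[]) (zeroˡ d))) e)) λ ()
  ... | inj₂ (f , c , c≢0 , l′) with ≡.refl ← Lead-unique {p} c≢0 (λ ()) (≡.subst (Lead p _) (ℤₚ.*-identityʳ c) (Lead-resp eq (Lead-* q d l′ l))) L = monic l′

  UnitConst-−1 : ∀ {N} → 0 < N → UnitConst (x^ N −1)
  UnitConst-−1 {suc N} _ = -1ℤ , ≡.refl

  cyclotomic : ∀ {N} → 0 < N → Cyclotomic N
  cyclotomic {N} = <-rec (λ N → 0 < N → Cyclotomic N) build N
    where
    build : ∀ N → (∀ {d} → d < N → 0 < d → Cyclotomic d) → 0 < N → Cyclotomic N
    build N rec 0<N = record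
      { Φ-monic = Monic-quotient Ψ-monic (Lead-−1 0<N) ΦΨ
      ; Φ-unit  = UnitConst-factor (Φ N) (Ψ N) (≡.subst (λ z → ∃ λ u → u ℤ.* z ≡ 1ℤ) (≡.sym (at ΦΨ 0)) (UnitConst-−1 0<N))
      ; Φ*Ψ     = ΦΨ }
      where
      upTo-d : ∀ {d} → ProperDivisor d N → UpTo d
      upTo-d D 0<e e≤d = rec (ℕₚ.≤-<-trans e≤d (smaller D)) 0<e
      cyc : ∀ {d} → d ∈ properDivisors N → Cyclotomic d
      cyc d∈ = let D = ∈-properDivisors⁻ N d∈ in rec (smaller D) (positive D)
      Ψ-monic : Monic (Ψ N)
      Ψ-monic = Monic-prod {Φ} (Φ-monic ∘ cyc)
      -- The factors are pairwise coprime divisors of q^N - 1, so their product divides it. The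
      -- division that defines `Φ N` is therefore exact and returns the cofactor.
      Ψ∣ : Ψ N ∣ x^ N −1
      Ψ∣ = prod∣ {Φ} (properDivisors-unique N) (Φ-unit ∘ cyc)
        (λ d∈ → ∣-trans (Φ∣−1 (cyc d∈)) (∣⇒−1∣−1 (divisor (∈-properDivisors⁻ N d∈))))
        λ d∈ e∈ d≢e → let D = ∈-properDivisors⁻ N d∈ ; E = ∈-properDivisors⁻ N e∈ in
          coprime-Φ (positive D) (positive E) (upTo-d D) (upTo-d E) d≢e
      open _∣_ Ψ∣ renaming (quotient to Q; equality to Q-eq)
      ΦΨ : Φ N *ₚ Ψ N ≋ x^ N −1
      ΦΨ = trans (*-congʳ (trans (reflexive (Φ-unfold N)) (divMonic-correct (x^ N −1) (Ψ N) Q (Monic.lead Ψ-monic)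
        (trans Q-eq (*-comm (Ψ N) Q))))) (trans (*-comm Q (Ψ N)) (sym Q-eq))

  Φ-coprime-−1 : ∀ {N} → 0 < N → ∀ {m} → ¬ N ℕ∣.∣ m → Coprime (x^ m −1) (Φ N)
  Φ-coprime-−1 0<N = coprime-−1 0<N λ 0<d _ → cyclotomic 0<d

  Φ-coprime : ∀ {d e} → 0 < d → 0 < e → d ≢ e → Coprime (Φ d) (Φ e)
  Φ-coprime 0<d 0<e = coprime-Φ 0<d 0<e (λ 0<c _ → cyclotomic 0<c) (λ 0<c _ → cyclotomic 0<c)

-- Fractions with regular denominators.

module Fractions (R : CommutativeRing 0ℓ 0ℓ) where
  open import Data.Product using (_,_)
  open import Data.Integer using (+_)
  open CommutativeRing R
  open import Relation.Binary.Reasoning.Setoid setoid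
  open IntegerRingSolver R

  -- Not being a zero divisor is what transitivity of `≃` requires of the middle denominator, and it
  -- is closed under products.
  record Regular (d : Carrier) : Set where
    constructor mkRegular
    field cancel₀ : ∀ {p} → d * p ≈ 0# → p ≈ 0#
  open Regular public

  x-y≈0 : ∀ {x y} → x - y ≈ 0# → x ≈ y
  x-y≈0 {x} {y} eq = begin
    x            ≈⟨ solve 2 (λ x y → x := (x :- y) :+ y) refl x y ⟩
    (x - y) + y  ≈⟨ +-congʳ eq ⟩
    0# + y       ≈⟨ +-identityˡ y ⟩
    y            ∎

  cancel : ∀ {d p r} → Regular d → d * p ≈ d * r → p ≈ r
  cancel {d} {p} {r} reg eq = x-y≈0 (cancel₀ reg (begin
    d * (p - r)   ≈⟨ solve 3 (λ d p r → d :* (p :- r) := d :* p :- d :* r) refl d p r ⟩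
    d * p - d * r ≈⟨ +-congʳ eq ⟩
    d * r - d * r ≈⟨ -‿inverseʳ _ ⟩
    0#            ∎))

  Regular-1 : Regular 1#
  Regular-1 = mkRegular λ eq → trans (sym (*-identityˡ _)) eq

  Regular-* : ∀ {d e} → Regular d → Regular e → Regular (d * e)
  Regular-* D E = mkRegular λ eq → cancel₀ E (cancel₀ D (trans (sym (*-assoc _ _ _)) eq))

  record Fraction : Set where
    constructor frac
    field
      numer denom : Carrier
      regular : Regular denom
  open Fraction public

  infix 4 _≃_
  record _≃_ (x y : Fraction) : Set where
    constructor mk≃
    field cross : numer x * denom y ≈ numer y * denom x
  open _≃_ public

  _+ᶠ_ _*ᶠ_ : Fraction → Fraction → Fraction
  frac a b B +ᶠ frac c d D = frac (a * d + c * b) (b * d) (Regular-* B D)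
  frac a b B *ᶠ frac c d D = frac (a * c) (b * d) (Regular-* B D)

  -ᶠ_ : Fraction → Fraction
  -ᶠ frac a b B = frac (- a) b B

  fractionRing : CommutativeRing 0ℓ 0ℓ
  fractionRing = record
    { Carrier = Fraction ; _≈_ = _≃_ ; _+_ = _+ᶠ_ ; _*_ = _*ᶠ_ ; -_ = -ᶠ_ ; 0# = 0ᶠ ; 1# = 1ᶠ
    ; isCommutativeRing = record
      { isRing = record
        { +-isAbelianGroup = record
          { isGroup = record
            { isMonoid = record
              { isSemigroup = record
                { isMagma = record
                  { isEquivalence = record { refl = mk≃ refl ; sym = λ e → mk≃ (sym (cross e)) ; trans = ≃-trans }
                  ; ∙-cong = +ᶠ-cong }
                ; assoc = λ x y z → mk≃ (solve 6 (λ a b c d e f →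
                    ((a :* d :+ c :* b) :* f :+ e :* (b :* d)) :* (b :* (d :* f))
                    := (a :* (d :* f) :+ (c :* f :+ e :* d) :* b) :* (b :* d :* f)) refl
                    (numer x) (denom x) (numer y) (denom y) (numer z) (denom z)) }
              ; identity = (λ x → mk≃ (solve 2 (λ a b → (con (+ 0) :* b :+ a :* con (+ 1)) :* b := a :* (con (+ 1) :* b)) refl (numer x) (denom x)))
                         , (λ x → mk≃ (solve 2 (λ a b → (a :* con (+ 1) :+ con (+ 0) :* b) :* b := a :* (b :* con (+ 1))) refl (numer x) (denom x))) }
            ; inverse = (λ x → mk≃ (solve 2 (λ a b → (:- a :* b :+ a :* b) :* con (+ 1) := con (+ 0) :* (b :* b)) refl (numer x) (denom x)))
                      , (λ x → mk≃ (solve 2 (λ a b → (a :* b :+ :- a :* b) :* con (+ 1) := con (+ 0) :* (b :* b)) refl (numer x) (denom x)))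
            ; ⁻¹-cong = -ᶠ-cong }
          ; comm = λ x y → mk≃ (solve 4 (λ a b c d → (a :* d :+ c :* b) :* (d :* b) := (c :* b :+ a :* d) :* (b :* d)) refl
                    (numer x) (denom x) (numer y) (denom y)) }
        ; *-cong = *ᶠ-cong
        ; *-assoc = λ x y z → mk≃ (solve 6 (λ a b c d e f → (a :* c :* e) :* (b :* (d :* f)) := (a :* (c :* e)) :* (b :* d :* f)) refl
                    (numer x) (denom x) (numer y) (denom y) (numer z) (denom z))
        ; *-identity = (λ x → mk≃ (solve 2 (λ a b → (con (+ 1) :* a) :* b := a :* (con (+ 1) :* b)) refl (numer x) (denom x)))
                     , (λ x → mk≃ (solve 2 (λ a b → (a :* con (+ 1)) :* b := a :* (b :* con (+ 1))) refl (numer x) (denom x)))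
        ; distrib = (λ x y z → mk≃ (solve 6 (λ a b c d e f →
                      (a :* (c :* f :+ e :* d)) :* ((b :* d) :* (b :* f))
                      := (a :* c :* (b :* f) :+ a :* e :* (b :* d)) :* (b :* (d :* f))) refl
                      (numer x) (denom x) (numer y) (denom y) (numer z) (denom z)))
                  , (λ x y z → mk≃ (solve 6 (λ a b c d e f →
                      ((c :* f :+ e :* d) :* a) :* ((d :* b) :* (f :* b))
                      := (c :* a :* (f :* b) :+ e :* a :* (d :* b)) :* ((d :* f) :* b)) refl
                      (numer x) (denom x) (numer y) (denom y) (numer z) (denom z))) }
      ; *-comm = λ x y → mk≃ (solve 4 (λ a b c d → (a :* c) :* (d :* b) := (c :* a) :* (b :* d)) refl
                    (numer x) (denom x) (numer y) (denom y)) } }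
    where
    0ᶠ 1ᶠ : Fraction
    0ᶠ = frac 0# 1# Regular-1
    1ᶠ = frac 1# 1# Regular-1

    ≃-trans : ∀ {x y z} → x ≃ y → y ≃ z → x ≃ z
    ≃-trans {frac a b _} {frac c d D} {frac e f _} (mk≃ p) (mk≃ r) = mk≃ (cancel D (begin
      d * (a * f) ≈⟨ solve 3 (λ a d f → d :* (a :* f) := (a :* d) :* f) refl a d f ⟩
      (a * d) * f ≈⟨ *-congʳ p ⟩
      (c * b) * f ≈⟨ solve 3 (λ b c f → (c :* b) :* f := (c :* f) :* b) refl b c f ⟩
      (c * f) * b ≈⟨ *-congʳ r ⟩
      (e * d) * b ≈⟨ solve 3 (λ b e d → (e :* d) :* b := d :* (e :* b)) refl b e d ⟩
      d * (e * b) ∎))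

    +ᶠ-cong : ∀ {x x′ y y′} → x ≃ x′ → y ≃ y′ → (x +ᶠ y) ≃ (x′ +ᶠ y′)
    +ᶠ-cong {frac a b _} {frac a′ b′ _} {frac c d _} {frac c′ d′ _} (mk≃ p) (mk≃ r) = mk≃ (begin
      (a * d + c * b) * (b′ * d′)
        ≈⟨ solve 6 (λ a b c d b′ d′ → (a :* d :+ c :* b) :* (b′ :* d′) := (a :* b′) :* (d :* d′) :+ (c :* d′) :* (b :* b′)) refl a b c d b′ d′ ⟩
      (a * b′) * (d * d′) + (c * d′) * (b * b′)
        ≈⟨ +-cong (*-congʳ p) (*-congʳ r) ⟩
      (a′ * b) * (d * d′) + (c′ * d) * (b * b′)
        ≈⟨ solve 6 (λ a b c d b′ d′ → (a :* b) :* (d :* d′) :+ (c :* d) :* (b :* b′) := (a :* d′ :+ c :* b′) :* (b :* d)) refl a′ b c′ d b′ d′ ⟩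
      (a′ * d′ + c′ * b′) * (b * d) ∎)

    *ᶠ-cong : ∀ {x x′ y y′} → x ≃ x′ → y ≃ y′ → (x *ᶠ y) ≃ (x′ *ᶠ y′)
    *ᶠ-cong {frac a b _} {frac a′ b′ _} {frac c d _} {frac c′ d′ _} (mk≃ p) (mk≃ r) = mk≃ (begin
      (a * c) * (b′ * d′)
        ≈⟨ solve 4 (λ a c b′ d′ → (a :* c) :* (b′ :* d′) := (a :* b′) :* (c :* d′)) refl a c b′ d′ ⟩
      (a * b′) * (c * d′) ≈⟨ *-cong p r ⟩
      (a′ * b) * (c′ * d)
        ≈⟨ solve 4 (λ a b c d → (a :* b) :* (c :* d) := (a :* c) :* (b :* d)) refl a′ b c′ d ⟩
      (a′ * c′) * (b * d) ∎)

    -ᶠ-cong : ∀ {x x′} → x ≃ x′ → (-ᶠ x) ≃ (-ᶠ x′)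
    -ᶠ-cong {frac a b _} {frac a′ b′ _} (mk≃ p) = mk≃ (begin
      - a * b′   ≈⟨ solve 2 (λ a b → :- a :* b := :- (a :* b)) refl a b′ ⟩
      - (a * b′) ≈⟨ -‿cong p ⟩
      - (a′ * b) ≈⟨ solve 2 (λ a b → :- (a :* b) := :- a :* b) refl a′ b ⟩
      - a′ * b   ∎)

-- Finite sums and products; a terminating well-poised sum.

module WellPoisedSum {c ℓ} (R : CommutativeRing c ℓ) where
  open import Data.Nat as ℕ using (ℕ; zero; suc)
  import Data.Nat.Properties as ℕₚ
  open import Data.Integer using (+_)
  import Relation.Binary.PropositionalEquality as ≡
  open CommutativeRing R
  open import Relation.Binary.Reasoning.Setoid setoid
  open IntegerRingSolver R

  Σ< : ℕ → (ℕ → Carrier) → Carrier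
  Σ< zero    f = 0#
  Σ< (suc n) f = Σ< n f + f n

  Π< : ℕ → (ℕ → Carrier) → Carrier
  Π< zero    f = 1#
  Π< (suc n) f = Π< n f * f n

  Σ<-*ʳ : ∀ n f a → Σ< n (λ k → f k * a) ≈ Σ< n f * a
  Σ<-*ʳ zero    f a = sym (zeroˡ a)
  Σ<-*ʳ (suc n) f a = trans (+-congʳ (Σ<-*ʳ n f a)) (sym (distribʳ a _ _))

  Σ<-− : ∀ n f g → Σ< n (λ k → f k - g k) ≈ Σ< n f - Σ< n g
  Σ<-− zero    f g = sym (-‿inverseʳ 0#)
  Σ<-− (suc n) f g = trans (+-congʳ (Σ<-− n f g))
    (solve 4 (λ a b c d → (a :- b) :+ (c :- d) := (a :+ c) :- (b :+ d)) refl _ _ _ _)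

  Σ<-split : ∀ m n f → Σ< (m ℕ.+ n) f ≈ Σ< m f + Σ< n (λ k → f (m ℕ.+ k))
  Σ<-split m zero    f = trans (reflexive (≡.cong (λ k → Σ< k f) (ℕₚ.+-identityʳ m))) (sym (+-identityʳ _))
  Σ<-split m (suc n) f = trans (reflexive (≡.cong (λ k → Σ< k f) (ℕₚ.+-suc m n)))
    (trans (+-congʳ (Σ<-split m n f)) (+-assoc _ _ _))

  Σ<-front : ∀ n f → Σ< (suc n) f ≈ f 0 + Σ< n (λ k → f (suc k))
  Σ<-front zero    f = +-comm 0# (f 0)
  Σ<-front (suc n) f = trans (+-congʳ (Σ<-front n f)) (+-assoc _ _ _)

  Π<-cong : ∀ n {f g} → (∀ {k} → k ℕ.< n → f k ≈ g k) → Π< n f ≈ Π< n g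
  Π<-cong zero    f≈g = refl
  Π<-cong (suc n) f≈g = *-cong (Π<-cong n λ k<n → f≈g (ℕₚ.m<n⇒m<1+n k<n)) (f≈g (ℕₚ.n<1+n n))

  Π<-* : ∀ n f g → Π< n (λ k → f k * g k) ≈ Π< n f * Π< n g
  Π<-* zero    f g = sym (*-identityʳ 1#)
  Π<-* (suc n) f g = trans (*-congʳ (Π<-* n f g))
    (solve 4 (λ a b c d → (a :* b) :* (c :* d) := (a :* c) :* (b :* d)) refl (Π< n f) (Π< n g) (f n) (g n))

  Π<-1 : ∀ n → Π< n (λ _ → 1#) ≈ 1#
  Π<-1 zero    = refl
  Π<-1 (suc n) = trans (*-identityʳ _) (Π<-1 n)

  Π<-front : ∀ n f → Π< (suc n) f ≈ f 0 * Π< n (λ k → f (suc k))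
  Π<-front zero    f = *-comm 1# (f 0)
  Π<-front (suc n) f = trans (*-congʳ (Π<-front n f)) (*-assoc _ _ _)

  Π<-reverse : ∀ n f → Π< n f ≈ Π< n (λ k → f (n ℕ.∸ suc k))
  Π<-reverse zero    f = refl
  Π<-reverse (suc n) f = trans (*-comm _ _) (trans (*-congˡ (Π<-reverse n f)) (sym (Π<-front n (λ k → f (n ℕ.∸ k)))))

  -- `y k` is Q^k and `d` is 1/c. The inverses of the denominator factors are parameters, which
  -- makes the summation meaningful in any commutative ring; `i₃ (k + m)` belongs to 1 -
  -- s²Q^(m+k+1).
  module WellPoised
    (Q s d : Carrier) (y i₁ i₂ i₃ : ℕ → Carrier)
    (y-zero : y 0 ≈ 1#) (y-suc : ∀ k → y (suc k) ≈ Q * y k)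
    (inv₁ : ∀ k → i₁ k * (1# - y (suc k)) ≈ 1#)
    (inv₂ : ∀ k → i₂ k * (1# - s * s * d * y (suc k)) ≈ 1#)
    (inv₃ : ∀ k → i₃ k * (1# - s * s * y (suc k)) ≈ 1#)
    where

    y-+ : ∀ k m → y (k ℕ.+ m) ≈ y k * y m
    y-+ zero    m = sym (trans (*-congʳ y-zero) (*-identityˡ _))
    y-+ (suc k) m = begin
      y (suc (k ℕ.+ m))   ≈⟨ y-suc _ ⟩
      Q * y (k ℕ.+ m)     ≈⟨ *-congˡ (y-+ k m) ⟩
      Q * (y k * y m)     ≈⟨ *-assoc _ _ _ ⟨
      (Q * y k) * y m     ≈⟨ *-congʳ (y-suc k) ⟨
      y (suc k) * y m     ∎

    -- The part of the ratio of consecutive terms that is free of m. The argument sQ^(m+1)/c is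
    -- distributed over the factors, by (1 - cQ^k)/c = d - Q^k and, in `h`, (1 - Q^(k-m)) Q^(m+1) =
    -- Q^(m+1) - Q^(k+1), so neither c nor a negative power of Q appears.
    c′ : ℕ → Carrier
    c′ k = (1# - s * s * y k) * (d - y k) * s * (i₁ k * i₂ k)

    h : ℕ → ℕ → Carrier
    h m zero    = 1#
    h m (suc k) = h m k * (c′ k * (y (suc m) - y (suc k)) * i₃ (k ℕ.+ m))

    h-zero : ∀ m → h m (suc m) ≈ 0#
    h-zero m = trans (*-congˡ (trans (*-congʳ (trans (*-congˡ (-‿inverseʳ _)) (zeroʳ _))) (zeroˡ _))) (zeroʳ _)

    -- Only the products of Q^(m+1) - Q^(j+1) and of the inverses of 1 - s²Q^(m+j+1) depend on m.
    -- Raising m and k together shifts both by one place up to powers of Q, so all but boundary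
    -- factors agree with those of `h m k`.
    h-shift : ∀ m k → h (suc m) (suc k) ≈
      h m k * (c′ k * ((y (suc m) - 1#) * y (suc k) * (1# - s * s * y (suc m)))
               * (i₃ (k ℕ.+ m) * i₃ (suc k ℕ.+ m)))
    h-shift m zero = begin
      1# * (c′ 0 * (y (suc (suc m)) - y 1) * i₃ (suc m))
        ≈⟨ *-congˡ (*-congʳ (*-congˡ (+-cong (y-suc (suc m)) (-‿cong y1)))) ⟩
      1# * (c′ 0 * (Q * Z - Q) * i₃ (suc m))
        ≈⟨ *-identityʳ _ ⟨
      1# * (c′ 0 * (Q * Z - Q) * i₃ (suc m)) * 1#
        ≈⟨ *-congˡ (inv₃ m) ⟨
      1# * (c′ 0 * (Q * Z - Q) * i₃ (suc m)) * (i₃ m * (1# - s * s * Z))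
        ≈⟨ solve 6 (λ c Q Z i i' s → let 𝟙 = con (+ 1) in 𝟙 :* (c :* (Q :* Z :- Q) :* i') :* (i :* (𝟙 :- s :* s :* Z))
              := 𝟙 :* (c :* ((Z :- 𝟙) :* Q :* (𝟙 :- s :* s :* Z)) :* (i :* i'))) refl _ _ _ _ _ _ ⟩
      1# * (c′ 0 * ((Z - 1#) * Q * (1# - s * s * Z)) * (i₃ m * i₃ (suc m)))
        ≈⟨ *-congˡ (*-congʳ (*-congˡ (*-congʳ (*-congˡ y1)))) ⟨
      1# * (c′ 0 * ((Z - 1#) * y 1 * (1# - s * s * Z)) * (i₃ m * i₃ (suc m)))
        ∎
      where
      Z = y (suc m)
      y1 : y 1 ≈ Q
      y1 = trans (y-suc 0) (trans (*-congˡ y-zero) (*-identityʳ Q))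
    h-shift m (suc k) = begin
      h (suc m) (suc k) * (c′ (suc k) * (y (suc (suc m)) - y (suc (suc k))) * i₃ (suc k ℕ.+ suc m))
        ≈⟨ *-cong (h-shift m k) (*-cong (*-congˡ (+-cong (y-suc (suc m)) (-‿cong (y-suc (suc k)))))
             (reflexive (≡.cong (λ j → i₃ (suc j)) (ℕₚ.+-suc k m)))) ⟩
      h m k * (c′ k * ((Z - 1#) * Y * (1# - s * s * Z)) * (i * i')) * (c′ (suc k) * (Q * Z - Q * Y) * i'')
        ≈⟨ solve 10 (λ h c Z Y s i i' i'' c' Q → let 𝟙 = con (+ 1) in
             h :* (c :* ((Z :- 𝟙) :* Y :* (𝟙 :- s :* s :* Z)) :* (i :* i')) :* (c' :* (Q :* Z :- Q :* Y) :* i'')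
             := h :* (c :* (Z :- Y) :* i) :* (c' :* ((Z :- 𝟙) :* (Q :* Y) :* (𝟙 :- s :* s :* Z)) :* (i' :* i'')))
             refl _ _ _ _ _ _ _ _ _ _ ⟩
      h m k * (c′ k * (Z - Y) * i) * (c′ (suc k) * ((Z - 1#) * (Q * Y) * (1# - s * s * Z)) * (i' * i''))
        ≈⟨ *-congˡ (*-congʳ (*-congˡ (*-congʳ (*-congˡ (y-suc (suc k)))))) ⟨
      h m (suc k) * (c′ (suc k) * ((Z - 1#) * y (suc (suc k)) * (1# - s * s * Z)) * (i' * i''))
        ∎
      where
      Z = y (suc m)
      Y = y (suc k)
      i = i₃ (k ℕ.+ m)
      i' = i₃ (suc k ℕ.+ m)
      i'' = i₃ (suc (suc k) ℕ.+ m)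

    V : ℕ → Carrier
    V k = 1# + s * y k

    -- Denominator and numerator of the ratio of consecutive product sides: their products are
    -- (s²Q/c, sQ; Q)_m and (s²Q, sQ/c; Q)_m.
    a b : ℕ → Carrier
    a m = (1# - s * s * d * y (suc m)) * (1# - s * y (suc m))
    b m = (1# - s * s * y (suc m)) * (1# - s * d * y (suc m))

    private
      -- Gosper certificate of the difference of two consecutive (normalised) sums.
      G : ℕ → ℕ → Carrier
      G m k = (1# - s * s * Z) * Z * s * (1# - s * s * y k) * (d - y k) * i₃ (k ℕ.+ m) * h m k
        where Z = y (suc m)

      D : ℕ → ℕ → Carrier
      D m k = V k * h (suc m) k * a m - V k * h m k * b m

      inv₃′ : ∀ m k → i₃ (k ℕ.+ m) * (1# - s * s * (y (suc m) * y k)) ≈ 1#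
      inv₃′ m k = trans (*-congˡ (+-congˡ (-‿cong (*-congˡ yy)))) (inv₃ (k ℕ.+ m))
        where
        yy : y (suc m) * y k ≈ y (suc (k ℕ.+ m))
        yy = trans (*-comm _ _) (trans (sym (y-+ k (suc m))) (reflexive (≡.cong y (ℕₚ.+-suc k m))))

    -- `h-shift` and the definition of `h` express the new difference and `G m (suc k)` through
    -- `h m k`. Once the inverses are cleared, the step is a polynomial identity in s, d, Q^(m+1)
    -- and Q^(k+1).
    telescope : ∀ m k → Σ< (suc k) (D m) ≈ G m k
    telescope m zero = begin
      0# + D m 0
        ≈⟨ +-congˡ (+-cong (*-congʳ (*-congʳ V0)) (-‿cong (*-congʳ (*-congʳ V0)))) ⟩
      0# + ((1# + s * 1#) * 1# * a m - (1# + s * 1#) * 1# * b m)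
        ≈⟨ solve 3 (λ s d Z → let 𝟙 = con (+ 1) in con (+ 0) :+ ((𝟙 :+ s :* 𝟙) :* 𝟙 :* ((𝟙 :- s :* s :* d :* Z) :* (𝟙 :- s :* Z)) :- (𝟙 :+ s :* 𝟙) :* 𝟙 :* ((𝟙 :- s :* s :* Z) :* (𝟙 :- s :* d :* Z)))
             := Z :* s :* (𝟙 :- s :* s :* 𝟙) :* (d :- 𝟙) :* 𝟙) refl _ _ _ ⟩
      Z * s * (1# - s * s * 1#) * (d - 1#) * 1#
        ≈⟨ *-cong (*-cong (*-congˡ (+-congˡ (-‿cong (*-congˡ (sym y-zero))))) (+-congˡ (-‿cong (sym y-zero)))) (sym (inv₃ m)) ⟩
      Z * s * (1# - s * s * y 0) * (d - y 0) * (i₃ m * (1# - s * s * Z))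
        ≈⟨ solve 6 (λ Z s p q i e → Z :* s :* p :* q :* (i :* e) := e :* Z :* s :* p :* q :* i :* con (+ 1)) refl _ _ _ _ _ _ ⟩
      G m 0 ∎
      where
      Z = y (suc m)
      V0 : V 0 ≈ 1# + s * 1#
      V0 = +-congˡ (*-congˡ y-zero)
    telescope m (suc k) = begin
      Σ< (suc k) (D m) + D m (suc k)
        ≈⟨ +-cong (telescope m k) (+-cong (*-congʳ (*-congˡ (h-shift m k))) refl) ⟩
      G m k + (V (suc k) * (h m k * (c′ k * ((Z - 1#) * Y * (1# - s * s * Z)) * (i * w))) * a m
               - V (suc k) * (h m k * (c′ k * (Z - Y) * i)) * b m)
        ≈⟨ +-congʳ G≈ ⟩
      Hn * (Z * ((1# - Y) * (1# - s * s * d * Y)) * 1#) +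
        (V (suc k) * (h m k * (c′ k * ((Z - 1#) * Y * (1# - s * s * Z)) * (i * w))) * a m
               - V (suc k) * (h m k * (c′ k * (Z - Y) * i)) * b m)
        ≈⟨ solve 8 (λ h c Z Y s d i w → let 𝟙 = con (+ 1) in
              h :* c :* i :* (𝟙 :- s :* s :* Z) :* (Z :* ((𝟙 :- Y) :* (𝟙 :- s :* s :* d :* Y)) :* 𝟙) :+
              ((𝟙 :+ s :* Y) :* (h :* (c :* ((Z :- 𝟙) :* Y :* (𝟙 :- s :* s :* Z)) :* (i :* w))) :* ((𝟙 :- s :* s :* d :* Z) :* (𝟙 :- s :* Z))
               :- (𝟙 :+ s :* Y) :* (h :* (c :* (Z :- Y) :* i)) :* ((𝟙 :- s :* s :* Z) :* (𝟙 :- s :* d :* Z)))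
              := h :* c :* i :* (𝟙 :- s :* s :* Z) :*
                 (𝟙 :* (Z :* ((𝟙 :- Y) :* (𝟙 :- s :* s :* d :* Y)) :- (𝟙 :+ s :* Y) :* (𝟙 :- s :* d :* Z) :* (Z :- Y)) :+
                  w :* ((𝟙 :+ s :* Y) :* ((Z :- 𝟙) :* Y :* ((𝟙 :- s :* s :* d :* Z) :* (𝟙 :- s :* Z))))))
              refl _ _ _ _ _ _ _ _ ⟩
      Hn * (1# * B + w * C)
        -- To the solver `w` is a free variable. Writing 1 as `w` times the element it inverts gives
        -- both summands the factor `w`, and what remains is an identity of polynomials.
        ≈⟨ *-congˡ (+-congʳ (*-congʳ (inv₃′ m (suc k)))) ⟨
      Hn * (w * (1# - s * s * (Z * Y)) * B + w * C)
        ≈⟨ solve 8 (λ h c Z Y s d i w → let 𝟙 = con (+ 1) in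
              h :* c :* i :* (𝟙 :- s :* s :* Z) :*
              (w :* (𝟙 :- s :* s :* (Z :* Y)) :* (Z :* ((𝟙 :- Y) :* (𝟙 :- s :* s :* d :* Y)) :- (𝟙 :+ s :* Y) :* (𝟙 :- s :* d :* Z) :* (Z :- Y)) :+
               w :* ((𝟙 :+ s :* Y) :* ((Z :- 𝟙) :* Y :* ((𝟙 :- s :* s :* d :* Z) :* (𝟙 :- s :* Z)))))
              := (𝟙 :- s :* s :* Z) :* Z :* s :* (𝟙 :- s :* s :* Y) :* (d :- Y) :* w :* (h :* (c :* (Z :- Y) :* i)))
              refl _ _ _ _ _ _ _ _ ⟩
      G m (suc k) ∎
      where
      Z = y (suc m)
      Y = y (suc k)
      i = i₃ (k ℕ.+ m)
      w = i₃ (suc k ℕ.+ m)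
      Hn = h m k * c′ k * i * (1# - s * s * Z)
      B = Z * ((1# - Y) * (1# - s * s * d * Y)) - (1# + s * Y) * (1# - s * d * Z) * (Z - Y)
      C = (1# + s * Y) * ((Z - 1#) * Y * ((1# - s * s * d * Z) * (1# - s * Z)))
      G≈ : G m k ≈ Hn * (Z * ((1# - Y) * (1# - s * s * d * Y)) * 1#)
      G≈ = begin
        G m k ≈⟨ *-identityʳ _ ⟨
        G m k * 1# ≈⟨ *-congˡ (trans (*-congˡ (inv₂ k)) (*-identityʳ 1#)) ⟨
        G m k * (1# * (i₂ k * (1# - s * s * d * Y))) ≈⟨ *-congˡ (*-congʳ (inv₁ k)) ⟨
        G m k * (i₁ k * (1# - Y) * (i₂ k * (1# - s * s * d * Y)))
          ≈⟨ solve 11 (λ f Z s p q i h i1 i2 e1 e2 → f :* Z :* s :* p :* q :* i :* h :* (i1 :* e1 :* (i2 :* e2))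
               := h :* (p :* q :* s :* (i1 :* i2)) :* i :* f :* (Z :* (e1 :* e2) :* con (+ 1))) refl _ _ _ _ _ _ _ _ _ _ _ ⟩
        Hn * (Z * ((1# - Y) * (1# - s * s * d * Y)) * 1#) ∎

    sum : ℕ → Carrier
    sum m = Σ< (suc m) (λ k → V k * h m k)

    -- Summed over k ≤ m + 1, the differences leave `G m (suc m)`, which contains `h m (suc m)` = 0.
    -- For the same reason `sum m` may be extended by one term.
    sum-suc : ∀ m → sum (suc m) * a m ≈ sum m * b m
    sum-suc m = begin
      sum (suc m) * a m
        ≈⟨ solve 2 (λ x y → x := y :+ (x :- y)) refl _ _ ⟩
      S′ * b m + (sum (suc m) * a m - S′ * b m)
        ≈⟨ +-congˡ (+-cong (Σ<-*ʳ (suc (suc m)) _ _) (-‿cong (Σ<-*ʳ (suc (suc m)) _ _))) ⟨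
      S′ * b m + (Σ< (suc (suc m)) _ - Σ< (suc (suc m)) _)
        ≈⟨ +-congˡ (trans (sym (Σ<-− (suc (suc m)) _ _)) (telescope m (suc m))) ⟩
      S′ * b m + G m (suc m)
        ≈⟨ +-cong (*-congʳ (+-congˡ (*-congˡ (h-zero m)))) (*-congˡ (h-zero m)) ⟩
      (sum m + V (suc m) * 0#) * b m + _ * 0#
        ≈⟨ solve 4 (λ x v b g → (x :+ v :* con (+ 0)) :* b :+ g :* con (+ 0) := x :* b) refl _ _ _ _ ⟩
      sum m * b m ∎
      where
      S′ = Σ< (suc (suc m)) (λ k → V k * h m k)

    summation : ∀ m → sum m * Π< m a ≈ (1# + s) * Π< m b
    summation zero = begin
      (0# + (1# + s * y 0) * 1#) * 1# ≈⟨ *-congʳ (+-congˡ (*-congʳ (+-congˡ (*-congˡ y-zero)))) ⟩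
      (0# + (1# + s * 1#) * 1#) * 1#  ≈⟨ solve 1 (λ s → let 𝟙 = con (+ 1) in (con (+ 0) :+ (𝟙 :+ s :* 𝟙) :* 𝟙) :* 𝟙 := (𝟙 :+ s) :* 𝟙) refl s ⟩
      (1# + s) * 1# ∎
    summation (suc m) = begin
      sum (suc m) * (Π< m a * a m) ≈⟨ solve 3 (λ x p q → x :* (p :* q) := x :* q :* p) refl _ _ _ ⟩
      sum (suc m) * a m * Π< m a   ≈⟨ *-congʳ (sum-suc m) ⟩
      sum m * b m * Π< m a         ≈⟨ solve 3 (λ x p q → x :* p :* q := x :* q :* p) refl _ _ _ ⟩
      sum m * Π< m a * b m         ≈⟨ *-congʳ (summation m) ⟩
      (1# + s) * Π< m b * b m      ≈⟨ *-assoc _ _ _ ⟩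
      (1# + s) * (Π< m b * b m)    ∎

-- What the congruences use of the field of fractions and its subring.

module Interfaces (F : CommutativeRing 0ℓ 0ℓ) where
  open import Data.Integer as ℤ using (ℤ; 0ℤ)
  open import Relation.Binary.PropositionalEquality using (_≢_)
  open CommutativeRing F

  -- q is invertible and no root of unity: `inv j` inverts 1 - q^j for every nonzero integer j.
  record PowersOfQ : Set where
    field
      q^          : ℤ → Carrier
      q^-zero     : q^ 0ℤ ≈ 1#
      q^-+        : ∀ i j → q^ (i ℤ.+ j) ≈ q^ i * q^ j
      inv         : ℤ → Carrier
      inv-inverse : ∀ {j} → j ≢ 0ℤ → inv j * (1# - q^ j) ≈ 1#

  record SubringWithElement : Set₁ where
    field
      ε      : Carrier
      O      : Carrier → Set
      O-resp : ∀ {x y} → x ≈ y → O x → O y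
      O-1    : O 1#
      O-+    : ∀ {x y} → O x → O y → O (x + y)
      O-*    : ∀ {x y} → O x → O y → O (x * y)
      O-neg  : ∀ {x} → O x → O (- x)
      O-ε    : O ε

-- Integer powers of q as fractions; the local ring at a factor of q^n - 1.

module RationalFunctions (R : CommutativeRing 0ℓ 0ℓ) where
  open import Data.Nat as ℕ using (ℕ; zero; suc)
  import Data.Nat.Properties as ℕₚ
  import Data.Nat.Divisibility
  open import Data.Integer as ℤ using (ℤ; +_; -[1+_]; _⊖_; 0ℤ)
  import Data.Integer.Properties as ℤₚ
  open import Data.Product using (Σ; _×_; _,_)
  open import Relation.Nullary using (¬_; contradiction)
  open import Relation.Binary.PropositionalEquality as ≡ using (_≡_; _≢_)
  open CommutativeRing R hiding (zero)
  open Fractions R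
  open CoprimalityInRings R
  open IntegerRingSolver R
  private module F = CommutativeRing fractionRing
  module FS = IntegerRingSolver fractionRing
  open FS using () renaming (solve to solveᶠ; con to conᶠ; _:=_ to _:=ᶠ_; _:+_ to _:+ᶠ_; _:*_ to _:*ᶠ_; _:-_ to _:-ᶠ_; :-_ to :-ᶠ_)

  ι : Carrier → Fraction
  ι a = frac a 1# Regular-1

  ι-cong : ∀ {a b} → a ≈ b → ι a ≃ ι b
  ι-cong eq = mk≃ (*-congʳ eq)

  ι-+ : ∀ a b → ι (a + b) ≃ ι a F.+ ι b
  ι-+ a b = mk≃ (solve 2 (λ a b → (a :+ b) :* (con (+ 1) :* con (+ 1)) := (a :* con (+ 1) :+ b :* con (+ 1)) :* con (+ 1)) refl a b)

  ι-* : ∀ a b → ι (a * b) ≃ ι a F.* ι b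
  ι-* a b = mk≃ (solve 2 (λ a b → (a :* b) :* (con (+ 1) :* con (+ 1)) := (a :* b) :* con (+ 1)) refl a b)

  ι-− : ∀ a b → ι (a - b) ≃ ι a F.- ι b
  ι-− a b = mk≃ (solve 2 (λ a b → (a :- b) :* (con (+ 1) :* con (+ 1)) := (a :* con (+ 1) :+ :- b :* con (+ 1)) :* con (+ 1)) refl a b)

  1/ : ∀ {d} → Regular d → Fraction
  1/ {d} D = frac 1# d D

  1/-inverse : ∀ {d} (D : Regular d) → 1/ D F.* ι d ≃ F.1#
  1/-inverse {d} D = mk≃ (solve 1 (λ d → (con (+ 1) :* d) :* con (+ 1) := con (+ 1) :* (d :* con (+ 1))) refl d)

  frac≃ : ∀ a {d} (D : Regular d) → frac a d D ≃ ι a F.* 1/ D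
  frac≃ a {d} D = mk≃ (solve 2 (λ a d → a :* (con (+ 1) :* d) := (a :* con (+ 1)) :* d) refl a d)

  frac-unique : ∀ {a d x} (D : Regular d) → x F.* ι d ≃ ι a → frac a d D ≃ x
  frac-unique {a} {d} {x} D xd≃a = F.trans (frac≃ a D) (F.trans (F.*-congʳ {1/ D} {ι a} {x F.* ι d} (F.sym xd≃a))
    (F.trans (F.*-assoc x (ι d) (1/ D)) (F.trans (F.*-congˡ {x} (F.trans (F.*-comm (ι d) (1/ D)) (1/-inverse D))) (F.*-identityʳ x))))

  record RegularPowers : Set where
    field
      x           : ℕ → Carrier
      x-zero      : x 0 ≈ 1#
      x-+         : ∀ m n → x (m ℕ.+ n) ≈ x m * x n
      x-regular   : ∀ n → Regular (x n)
      1-x-regular : ∀ n → Regular (1# - x (suc n))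

  module Powers (X : RegularPowers) where
    open RegularPowers X

    open Geometric x x-zero x-+

    q^ : ℤ → Fraction
    q^ (+ n)    = ι (x n)
    q^ -[1+ n ] = 1/ (x-regular (suc n))

    q^-zero : q^ 0ℤ ≃ F.1#
    q^-zero = ι-cong x-zero

    q^-⊖ : ∀ m n → q^ (m ⊖ n) ≃ frac (x m) (x n) (x-regular n)
    q^-⊖ zero    zero    = mk≃ (*-congˡ x-zero)
    q^-⊖ (suc m) zero    = mk≃ (*-congˡ x-zero)
    q^-⊖ zero    (suc n) = mk≃ (*-congʳ (sym x-zero))
    q^-⊖ (suc m) (suc n) = F.trans (F.reflexive (≡.cong q^ (ℤₚ.[1+m]⊖[1+n]≡m⊖n m n))) (F.trans (q^-⊖ m n) (mk≃
      (trans (*-congˡ (x-+ 1 n)) (trans (solve 3 (λ a b c → a :* (b :* c) := b :* a :* c) refl (x m) (x 1) (x n)) (*-congʳ (sym (x-+ 1 m)))))))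

    q^-+ : ∀ i j → q^ (i ℤ.+ j) ≃ q^ i F.* q^ j
    q^-+ (+ m)    (+ n)    = F.trans (ι-cong (x-+ m n)) (ι-* (x m) (x n))
    q^-+ (+ m)    -[1+ n ] = F.trans (q^-⊖ m (suc n)) (frac≃ _ _)
    q^-+ -[1+ m ] (+ n)    = F.trans (q^-⊖ n (suc m)) (F.trans (frac≃ _ _) (F.*-comm (ι (x n)) (q^ -[1+ m ])))
    q^-+ -[1+ m ] -[1+ n ] = mk≃ (trans (*-congˡ (trans (sym (x-+ (suc m) (suc n))) (reflexive (≡.cong (λ k → x (suc k)) (ℕₚ.+-suc m n)))))
      (solve 1 (λ a → con (+ 1) :* a := con (+ 1) :* con (+ 1) :* a) refl _))

    e : ℤ → Fraction
    e j = F.1# F.- q^ j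

    -- junk value 0 at 0
    inv : ℤ → Fraction
    inv (+ zero)   = F.0#
    inv (+ suc n)  = 1/ (1-x-regular n)
    -- From 1 - q^(-j) = -q^(-j) (1 - q^j) with j = n + 1.
    inv -[1+ n ]   = F.- (q^ (+ suc n) F.* 1/ (1-x-regular n))

    q^-inverse : ∀ j → q^ (ℤ.- j) F.* q^ j ≃ F.1#
    q^-inverse j = F.trans (F.sym (q^-+ (ℤ.- j) j)) (F.trans (F.reflexive (≡.cong q^ (ℤₚ.+-inverseˡ j))) q^-zero)

    e-+ : ∀ n → e (+ n) ≃ ι (1# - x n)
    e-+ n = F.sym (ι-− 1# (x n))

    e-neg : ∀ j → e (ℤ.- j) ≃ F.- (q^ (ℤ.- j) F.* e j)
    e-neg j = F.trans (F.+-congʳ {F.- q^ (ℤ.- j)} (F.sym (q^-inverse j)))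
      (solveᶠ 2 (λ a b → a :*ᶠ b :-ᶠ a :=ᶠ :-ᶠ (a :*ᶠ (conᶠ (+ 1) :-ᶠ b))) F.refl (q^ (ℤ.- j)) (q^ j))

    inv-inverse : ∀ {j} → j ≢ 0ℤ → inv j F.* e j ≃ F.1#
    inv-inverse {+ zero}  j≢0 = contradiction ≡.refl j≢0
    inv-inverse {+ suc n} j≢0 = F.trans (F.*-congˡ {inv (+ suc n)} (e-+ (suc n))) (1/-inverse (1-x-regular n))
    inv-inverse { -[1+ n ]} j≢0 = F.trans (F.*-congˡ {inv -[1+ n ]} (e-neg (+ suc n)))
      (F.trans (solveᶠ 4 (λ a b c d → :-ᶠ (a :*ᶠ b) :*ᶠ :-ᶠ (c :*ᶠ d) :=ᶠ (c :*ᶠ a) :*ᶠ (b :*ᶠ d)) F.refl (q^ (+ suc n)) (inv (+ suc n)) (q^ -[1+ n ]) (e (+ suc n)))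
      (F.trans (F.*-cong (q^-inverse (+ suc n)) (inv-inverse {+ suc n} λ ())) (F.*-identityˡ F.1#)))

    module Localization {S : Carrier → Set} (S-1 : S 1#) (S-* : ∀ {x y} → S x → S y → S (x * y))
      (S-ℕ : ∀ n → S (ofℤ (+ suc n))) where
      open Coprimality S S-1 S-*

      module _ (φ : Carrier) where

        -- A second representation is recorded because the given denominator of `f` may share
        -- factors with `φ`, as in (1 - q^(an))/(1 - q^(bn)).
        record Integral (f : Fraction) : Set where
          constructor integral
          field
            top bottom   : Carrier
            coprime-φ    : Coprime bottom φ
            represents   : numer f * bottom ≈ top * denom f

        Integral-resp : ∀ {f g} → f ≃ g → Integral f → Integral g
        Integral-resp {frac a b B} {frac c d D} (mk≃ ad≈cb) (integral u v C eq) = integral u v C (cancel B (begin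
          b * (c * v)   ≈⟨ solve 3 (λ b c v → b :* (c :* v) := (c :* b) :* v) refl b c v ⟩
          (c * b) * v   ≈⟨ *-congʳ ad≈cb ⟨
          (a * d) * v   ≈⟨ solve 3 (λ a d v → (a :* d) :* v := (a :* v) :* d) refl a d v ⟩
          (a * v) * d   ≈⟨ *-congʳ eq ⟩
          (u * b) * d   ≈⟨ solve 3 (λ u b d → (u :* b) :* d := b :* (u :* d)) refl u b d ⟩
          b * (u * d)   ∎))
          where open import Relation.Binary.Reasoning.Setoid setoid

        Integral-+ : ∀ {f g} → Integral f → Integral g → Integral (f F.+ g)
        Integral-+ {frac a b _} {frac c d _} (integral u v C eq) (integral u′ v′ C′ eq′) =
          integral (u * v′ + u′ * v) (v * v′) (coprime-* C C′) (begin
          (a * d + c * b) * (v * v′)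
            ≈⟨ solve 6 (λ a b c d v v′ → (a :* d :+ c :* b) :* (v :* v′) := (a :* v) :* d :* v′ :+ (c :* v′) :* b :* v) refl a b c d v v′ ⟩
          (a * v) * d * v′ + (c * v′) * b * v
            ≈⟨ +-cong (*-congʳ (*-congʳ eq)) (*-congʳ (*-congʳ eq′)) ⟩
          (u * b) * d * v′ + (u′ * d) * b * v
            ≈⟨ solve 6 (λ u u′ b d v v′ → (u :* b) :* d :* v′ :+ (u′ :* d) :* b :* v := (u :* v′ :+ u′ :* v) :* (b :* d)) refl u u′ b d v v′ ⟩
          (u * v′ + u′ * v) * (b * d) ∎)
          where open import Relation.Binary.Reasoning.Setoid setoid

        Integral-* : ∀ {f g} → Integral f → Integral g → Integral (f F.* g)
        Integral-* {frac a b _} {frac c d _} (integral u v C eq) (integral u′ v′ C′ eq′) =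
          integral (u * u′) (v * v′) (coprime-* C C′) (trans
            (solve 4 (λ a c v v′ → (a :* c) :* (v :* v′) := (a :* v) :* (c :* v′)) refl a c v v′) (trans
            (*-cong eq eq′)
            (solve 4 (λ u b u′ d → (u :* b) :* (u′ :* d) := (u :* u′) :* (b :* d)) refl u b u′ d)))

        Integral-ι : ∀ a → Integral (ι a)
        Integral-ι a = integral a 1# coprime-1 refl

        Integral-neg : ∀ {f} → Integral f → Integral (F.- f)
        Integral-neg {frac a b _} (integral u v C eq) = integral (- u) v C (trans
          (solve 2 (λ a v → :- a :* v := :- (a :* v)) refl a v) (trans (-‿cong eq)
          (solve 2 (λ u b → :- (u :* b) := :- u :* b) refl u b)))

        Integral-1/ : ∀ {d} (D : Regular d) → Coprime d φ → Integral (1/ D)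
        Integral-1/ D C = integral 1# _ C refl

        clear-denominators : ∀ {a f x} → x ≃ ι a F.* f → Integral f →
          Σ Carrier λ u → Σ Carrier λ v → Coprime v φ × numer x * v ≈ a * u * denom x
        clear-denominators {a} {f} {x} (mk≃ eq) (integral u v C eq′) = u , v , C , cancel (regular f) (begin
          denom f * (numer x * v)             ≈⟨ solve 3 (λ d x v → d :* (x :* v) := x :* (con (+ 1) :* d) :* v) refl (denom f) (numer x) v ⟩
          numer x * (1# * denom f) * v        ≈⟨ *-congʳ eq ⟩
          a * numer f * denom x * v           ≈⟨ solve 4 (λ a t d v → a :* t :* d :* v := a :* (t :* v) :* d) refl a (numer f) (denom x) v ⟩
          a * (numer f * v) * denom x         ≈⟨ *-congʳ (*-congˡ eq′) ⟩
          a * (u * denom f) * denom x         ≈⟨ solve 4 (λ a u f d → a :* (u :* f) :* d := f :* (a :* u :* d)) refl a u (denom f) (denom x) ⟩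
          denom f * (a * u * denom x)         ∎)
          where open import Relation.Binary.Reasoning.Setoid setoid

        module At (n : ℕ) (φ∣ : φ ∣ x^ (suc n) −1) (x-coprime : Coprime (x 1) φ)
          (x−1-coprime : ∀ {m} → ¬ suc n Data.Nat.Divisibility.∣ m → Coprime (x^ m −1) φ) where
          open import Data.Nat.Divisibility as ℕ∣ using ()

          x-coprime′ : ∀ k → Coprime (x k) φ
          x-coprime′ zero    = coprime-resp (sym x-zero) coprime-1
          x-coprime′ (suc k) = coprime-resp (sym (x-+ 1 k)) (coprime-* x-coprime (x-coprime′ k))

          neg-coprime : ∀ {v} → Coprime v φ → Coprime (- v) φ
          neg-coprime {v} = coprime-∣ (divides (- 1#) (solve 1 (λ v → v := :- v :* con (ℤ.- + 1)) refl v))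

          1-x-coprime : ∀ {m} → ¬ suc n ℕ∣.∣ m → Coprime (1# - x m) φ
          1-x-coprime {m} n∤m = coprime-resp (solve 1 (λ x → :- (x :- con (+ 1)) := con (+ 1) :- x) refl (x m)) (neg-coprime (x−1-coprime n∤m))

          Integral-q^ : ∀ j → Integral (q^ j)
          Integral-q^ (+ k)    = Integral-ι (x k)
          Integral-q^ -[1+ k ] = Integral-1/ _ (x-coprime′ (suc k))

          Integral-inv : ∀ {j} → ¬ suc n ℕ∣.∣ ℤ.∣ j ∣ → Integral (inv j)
          Integral-inv {+ zero}   n∤j = contradiction (suc n ℕ∣.∣0) n∤j
          Integral-inv {+ suc k}  n∤j = Integral-1/ _ (1-x-coprime n∤j)
          Integral-inv { -[1+ k ]} n∤j = Integral-neg {q^ (+ suc k) F.* inv (+ suc k)} (Integral-* {q^ (+ suc k)} {inv (+ suc k)} (Integral-q^ (+ suc k)) (Integral-1/ (1-x-regular k) (1-x-coprime n∤j)))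

          -- As `φ` divides q^n - 1 for the period n, the geometric sum is congruent to the positive
          -- integer b + 1, a unit by `S-ℕ`.
          geometric-coprime : ∀ b → Coprime (geometric (suc n) (suc b)) φ
          geometric-coprime b with t , eq ← geometric-≈ (suc n) (suc b) =
            coprime-resp (sym (trans eq (+-congˡ (trans (*-congˡ x−1≈) (solve 3 (λ t p u → t :* (p :* u) := t :* u :* p) refl t φ u)))))
              (coprime-shift (t * u) (coprime-unit (S-ℕ b)))

            where open _∣_ φ∣ renaming (quotient to u; equality to x−1≈)

          -- Numerator and denominator are both divisible by `φ` when a is positive, but after
          -- division by 1 - q^n for the period n two geometric sums remain, the lower one coprime
          -- to `φ`.
          Integral-ratio-ℕ : ∀ a b → Integral (e (+ (a ℕ.* suc n)) F.* inv (+ (suc b ℕ.* suc n)))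
          Integral-ratio-ℕ a b = Integral-resp (F.*-congʳ {inv (+ (suc b ℕ.* suc n))} (F.sym (e-+ (a ℕ.* suc n))))
            (integral (geometric (suc n) a) (geometric (suc n) (suc b)) (geometric-coprime b) (begin
              (1# - x (a ℕ.* suc n)) * 1# * geometric (suc n) (suc b)
                ≈⟨ solve 2 (λ z g → (con (+ 1) :- z) :* con (+ 1) :* g := :- (z :- con (+ 1)) :* g) refl (x (a ℕ.* suc n)) _ ⟩
              - (x^ (a ℕ.* suc n) −1) * geometric (suc n) (suc b)
                ≈⟨ *-congʳ (-‿cong (x^−1-* a (suc n))) ⟩
              - (geometric (suc n) a * x^ (suc n) −1) * geometric (suc n) (suc b)
                ≈⟨ solve 3 (λ g e h → :- (g :* e) :* h := g :* (:- (h :* e))) refl (geometric (suc n) a) (x^ (suc n) −1) _ ⟩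
              geometric (suc n) a * - (geometric (suc n) (suc b) * x^ (suc n) −1)
                ≈⟨ *-congˡ (-‿cong (x^−1-* (suc b) (suc n))) ⟨
              geometric (suc n) a * - (x^ (suc b ℕ.* suc n) −1)
                ≈⟨ solve 2 (λ g z → g :* :- (z :- con (+ 1)) := g :* (con (+ 1) :* (con (+ 1) :- z))) refl (geometric (suc n) a) (x (suc b ℕ.* suc n)) ⟩
              geometric (suc n) a * (1# * (1# - x (suc b ℕ.* suc n))) ∎))
            where open import Relation.Binary.Reasoning.Setoid setoid

          Integral-ratio⁺ : ∀ a b → Integral (e (a ℤ.* + suc n) F.* inv (+ (suc b ℕ.* suc n)))
          Integral-ratio⁺ (+ a) b = ≡.subst (λ z → Integral (e z F.* inv (+ (suc b ℕ.* suc n)))) (ℤₚ.pos-* a (suc n)) (Integral-ratio-ℕ a b)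
          Integral-ratio⁺ -[1+ a ] b = Integral-resp
            (F.trans (solveᶠ 3 (λ q e i → :-ᶠ q :*ᶠ (e :*ᶠ i) :=ᶠ :-ᶠ (q :*ᶠ e) :*ᶠ i) F.refl (q^ j) (e (+ (suc a ℕ.* suc n))) i)
              (F.*-congʳ {i} (F.sym (e-neg (+ (suc a ℕ.* suc n))))))
            (Integral-* {F.- q^ j} {e (+ (suc a ℕ.* suc n)) F.* i} (Integral-neg {q^ j} (Integral-q^ j)) (Integral-ratio-ℕ (suc a) b))
            where
            j = -[1+ a ] ℤ.* + suc n
            i = inv (+ (suc b ℕ.* suc n))

          Integral-ratio : ∀ a {b} → b ≢ 0ℤ → Integral (e (a ℤ.* + suc n) F.* inv (b ℤ.* + suc n))
          Integral-ratio a {+ zero}   b≢0 = contradiction ≡.refl b≢0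
          Integral-ratio a {+ suc b}  _   = Integral-ratio⁺ a b
          Integral-ratio a { -[1+ b ]} _  = Integral-resp
            (solveᶠ 3 (λ q e i → (:-ᶠ q) :*ᶠ (e :*ᶠ i) :=ᶠ e :*ᶠ (:-ᶠ (q :*ᶠ i))) F.refl (q^ bn) (e (a ℤ.* + suc n)) (inv bn))
            (Integral-* {F.- q^ bn} {e (a ℤ.* + suc n) F.* inv bn} (Integral-neg {q^ bn} (Integral-q^ bn)) (Integral-ratio⁺ a b))
            where bn = + (suc b ℕ.* suc n)

-- The ideals generated by ε and ε².

module LocalRing (F : CommutativeRing 0ℓ 0ℓ) (D : Interfaces.SubringWithElement F) where
  open CommutativeRing F
  open Interfaces.SubringWithElement D
  open import Data.Nat as ℕ using (ℕ; zero; suc)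
  import Data.Nat.Properties as ℕₚ
  open import Data.Integer using (+_)
  open import Data.Sum using (inj₁; inj₂)
  import Relation.Binary.PropositionalEquality as ≡
  open IntegerRingSolver F
  open WellPoisedSum F using (Σ<; Π<)

  O-0 : O 0#
  O-0 = O-resp (-‿inverseʳ 1#) (O-+ O-1 (O-neg O-1))

  -- εO and ε²O
  record E (x : Carrier) : Set where
    constructor mkE
    field
      {o}  : Carrier
      o∈O  : O o
      x≈εo : x ≈ ε * o

  record I (x : Carrier) : Set where
    constructor mkI
    field
      {o}   : Carrier
      o∈O   : O o
      x≈ε²o : x ≈ ε * ε * o

  E⇒O : ∀ {x} → E x → O x
  E⇒O (mkE o eq) = O-resp (sym eq) (O-* O-ε o)

  E-*ˡ : ∀ {x y} → E x → O y → E (x * y)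
  E-*ˡ (mkE o eq) oy = mkE (O-* o oy) (trans (*-congʳ eq) (*-assoc _ _ _))

  E-*ʳ : ∀ {x y} → O x → E y → E (x * y)
  E-*ʳ ox (mkE o eq) = mkE (O-* ox o) (trans (*-congˡ eq) (solve 3 (λ x e o → x :* (e :* o) := e :* (x :* o)) refl _ _ _))

  E-resp : ∀ {x y} → x ≈ y → E x → E y
  E-resp x≈y (mkE o eq) = mkE o (trans (sym x≈y) eq)

  E-*-E : ∀ {x y} → E x → E y → I (x * y)
  E-*-E (mkE o eq) (mkE o′ eq′) = mkI (O-* o o′) (trans (*-cong eq eq′)
    (solve 3 (λ e o p → (e :* o) :* (e :* p) := e :* e :* (o :* p)) refl _ _ _))

  I-resp : ∀ {x y} → x ≈ y → I x → I y
  I-resp x≈y (mkI o eq) = mkI o (trans (sym x≈y) eq)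

  I-0 : I 0#
  I-0 = mkI O-0 (sym (zeroʳ _))

  I-+ : ∀ {x y} → I x → I y → I (x + y)
  I-+ (mkI o eq) (mkI o′ eq′) = mkI (O-+ o o′) (trans (+-cong eq eq′) (sym (distribˡ _ _ _)))

  I-neg : ∀ {x} → I x → I (- x)
  I-neg (mkI {o} o∈O eq) = mkI (O-neg o∈O) (trans (-‿cong eq) (solve 2 (λ e o → :- (e :* e :* o) := e :* e :* (:- o)) refl ε o))

  I-*ˡ : ∀ {x y} → I x → O y → I (x * y)
  I-*ˡ (mkI o eq) oy = mkI (O-* o oy) (trans (*-congʳ eq) (*-assoc _ _ _))

  I-*ʳ : ∀ {x y} → O x → I y → I (x * y)
  I-*ʳ ox iy = I-resp (*-comm _ _) (I-*ˡ iy ox)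

  -- The hats are inverses, and x/w - x′/w′ = -(x′ - x)/w + (w′ - w) x′/(w w′).
  I-quotient : ∀ {x x′ w w′ ŵ ŵ′} → O x′ → O ŵ → O ŵ′ → ŵ * w ≈ 1# → ŵ′ * w′ ≈ 1# →
    I (x′ - x) → I (w′ - w) → I (x * ŵ - x′ * ŵ′)
  I-quotient {x} {x′} {w} {w′} {ŵ} {ŵ′} x′∈O ŵ∈O ŵ′∈O ŵw≈1 ŵ′w′≈1 x≡ w≡ = I-resp eq
    (I-+ (I-neg (I-*ˡ x≡ ŵ∈O)) (I-*ˡ w≡ (O-* x′∈O (O-* ŵ∈O ŵ′∈O))))
    where
    open import Relation.Binary.Reasoning.Setoid setoid
    eq : - ((x′ - x) * ŵ) + (w′ - w) * (x′ * (ŵ * ŵ′)) ≈ x * ŵ - x′ * ŵ′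
    eq = begin
      - ((x′ - x) * ŵ) + (w′ - w) * (x′ * (ŵ * ŵ′))
        ≈⟨ solve 6 (λ x x′ w w′ u v → :- ((x′ :- x) :* u) :+ (w′ :- w) :* (x′ :* (u :* v))
             := x :* u :- x′ :* u :+ x′ :* (u :* (v :* w′)) :- x′ :* (v :* (u :* w))) refl x x′ w w′ ŵ ŵ′ ⟩
      x * ŵ - x′ * ŵ + x′ * (ŵ * (ŵ′ * w′)) - x′ * (ŵ′ * (ŵ * w))
        ≈⟨ +-cong (+-congˡ (*-congˡ (*-congˡ ŵ′w′≈1))) (-‿cong (*-congˡ (*-congˡ ŵw≈1))) ⟩
      x * ŵ - x′ * ŵ + x′ * (ŵ * 1#) - x′ * (ŵ′ * 1#)
        ≈⟨ solve 4 (λ x x′ u v → x :* u :- x′ :* u :+ x′ :* (u :* con (+ 1)) :- x′ :* (v :* con (+ 1)) := x :* u :- x′ :* v) refl x x′ ŵ ŵ′ ⟩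
      x * ŵ - x′ * ŵ′ ∎

  Σ<-I : ∀ n {f} → (∀ {k} → k ℕ.< n → I (f k)) → I (Σ< n f)
  Σ<-I zero    f∈I = I-0
  Σ<-I (suc n) f∈I = I-+ (Σ<-I n λ k<n → f∈I (ℕₚ.m<n⇒m<1+n k<n)) (f∈I (ℕₚ.n<1+n n))

  Π<-O : ∀ n {f} → (∀ {k} → k ℕ.< n → O (f k)) → O (Π< n f)
  Π<-O zero    f∈O = O-1
  Π<-O (suc n) f∈O = O-* (Π<-O n λ k<n → f∈O (ℕₚ.m<n⇒m<1+n k<n)) (f∈O (ℕₚ.n<1+n n))

  Π<-E : ∀ n {f j} → j ℕ.< n → E (f j) → (∀ {k} → k ℕ.< n → O (f k)) → E (Π< n f)
  Π<-E (suc n) j<1+n fj∈E f∈O with ℕₚ.m≤n⇒m<n∨m≡n (ℕₚ.≤-pred j<1+n)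
  ... | inj₁ j<n    = E-*ˡ (Π<-E n j<n fj∈E λ k<n → f∈O (ℕₚ.m<n⇒m<1+n k<n)) (f∈O (ℕₚ.n<1+n n))
  ... | inj₂ ≡.refl = E-*ʳ (Π<-O n λ k<n → f∈O (ℕₚ.m<n⇒m<1+n k<n)) fj∈E

  -- If g₁ g₂ g₃ = 1 and all gᵢ ≡ 1 mod ε, then ∏ (1 − z gᵢ) ≡ (1 − z)³ mod ε²: with gᵢ = 1 − εᵢ the
  -- constraint makes ∑ εᵢ a combination of products of at least two εᵢ.
  cube-congruence : ∀ {z g₁ g₂ g₃} → O z → E (1# - g₁) → E (1# - g₂) → E (1# - g₃) → g₁ * g₂ * g₃ ≈ 1# →
    I ((1# - z * g₁) * (1# - z * g₂) * (1# - z * g₃) - (1# - z) * (1# - z) * (1# - z))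
  cube-congruence {z} {g₁} {g₂} {g₃} z∈O E₁ E₂ E₃ g≈1 = I-resp eq
    (I-+ (I-*ʳ (O-* (O-* w∈O w∈O) z∈O) (I-+ e₂∈I (I-neg e₃∈I)))
      (I-+ (I-*ʳ (O-* w∈O (O-* z∈O z∈O)) e₂∈I) (I-*ʳ (O-* z∈O (O-* z∈O z∈O)) e₃∈I)))
    where
    a = 1# - g₁
    b = 1# - g₂
    c = 1# - g₃
    w = 1# - z
    w∈O : O w
    w∈O = O-+ O-1 (O-neg z∈O)
    -- Elementary symmetric functions of a, b, c. The constraint g₁g₂g₃ = 1 reads e₁ = e₂ - e₃, and
    -- the product to be compared with w³ is (w + za)(w + zb)(w + zc) = w³ + w²z e₁ + wz² e₂ + z³
    -- e₃.
    e₂ = a * b + (a * c + b * c)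
    e₃ = a * b * c
    e₂∈I : I e₂
    e₂∈I = I-+ (E-*-E E₁ E₂) (I-+ (E-*-E E₁ E₃) (E-*-E E₂ E₃))
    e₃∈I : I e₃
    e₃∈I = I-*ˡ (E-*-E E₁ E₂) (E⇒O E₃)
    open import Relation.Binary.Reasoning.Setoid setoid
    eq : w * w * z * (e₂ - e₃) + (w * (z * z) * e₂ + z * (z * z) * e₃) ≈
         (1# - z * g₁) * (1# - z * g₂) * (1# - z * g₃) - (1# - z) * (1# - z) * (1# - z)
    eq = begin
      w * w * z * (e₂ - e₃) + (w * (z * z) * e₂ + z * (z * z) * e₃)
        ≈⟨ solve 4 (λ z x y t → let 𝟙 = con (+ 1) ; a = 𝟙 :- x ; b = 𝟙 :- y ; c = 𝟙 :- t ; w = 𝟙 :- z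
                                    e₂ = a :* b :+ (a :* c :+ b :* c) ; e₃ = a :* b :* c in
              w :* w :* z :* (e₂ :- e₃) :+ (w :* (z :* z) :* e₂ :+ z :* (z :* z) :* e₃)
              := ((𝟙 :- z :* x) :* (𝟙 :- z :* y) :* (𝟙 :- z :* t) :- w :* w :* w) :+ w :* w :* z :* (x :* y :* t :- 𝟙))
              refl z g₁ g₂ g₃ ⟩
      ((1# - z * g₁) * (1# - z * g₂) * (1# - z * g₃) - w * w * w) + w * w * z * (g₁ * g₂ * g₃ - 1#)
        ≈⟨ +-congˡ (*-congˡ (+-congʳ g≈1)) ⟩
      ((1# - z * g₁) * (1# - z * g₂) * (1# - z * g₃) - w * w * w) + w * w * z * (1# - 1#)
        ≈⟨ solve 2 (λ x y → x :+ y :* (con (+ 1) :- con (+ 1)) := x) refl _ _ ⟩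
      (1# - z * g₁) * (1# - z * g₂) * (1# - z * g₃) - w * w * w ∎

-- The congruences in the field of fractions.

module Congruences (F : CommutativeRing 0ℓ 0ℓ) (Q : Interfaces.PowersOfQ F) where
  open import Data.Integer as ℤ using (ℤ; +_; 0ℤ)
  open import Relation.Binary.PropositionalEquality as ≡ using (_≡_; _≢_)
  open CommutativeRing F hiding (zero)
  open Interfaces.PowersOfQ Q
  open import Data.Nat as ℕ using (ℕ; zero; suc)
  import Data.Nat.Properties as ℕₚ
  open import Data.Nat.Divisibility as ℕ∣ using (_∣_)
  import Data.Integer.Properties as ℤₚ
  import Data.Integer.Divisibility.Signed as ℤ∣
  open import Data.Integer.Tactic.RingSolver using (solve-∀)
  import Data.Nat.Tactic.RingSolver as ℕSolver
  open import Data.Product using (_×_; _,_; proj₁; proj₂)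
  open import Data.Sum using (inj₁; inj₂)
  open import Relation.Nullary using (¬_; contradiction)
  open import Relation.Binary.Definitions using (tri<; tri≈; tri>)
  open import Relation.Binary.Reasoning.Setoid setoid
  open IntegerRingSolver F
  open WellPoisedSum F

  e : ℤ → Carrier
  e j = 1# - q^ j

  q^-≡ : ∀ {i j} → i ≡ j → q^ i ≈ q^ j
  q^-≡ i≡j = reflexive (≡.cong q^ i≡j)

  e-≡ : ∀ {i j} → i ≡ j → e i ≈ e j
  e-≡ i≡j = reflexive (≡.cong e i≡j)

  q^-+≡ : ∀ {i} j k → i ≡ j ℤ.+ k → q^ i ≈ q^ j * q^ k
  q^-+≡ j k i≡j+k = trans (q^-≡ i≡j+k) (q^-+ j k)

  -- α, β ↦ (q^α; q⁴)_k / (q^β; q⁴)_k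
  R : ℕ → ℕ → ℕ → Carrier
  R α β k = Π< k λ j → e (+ (α ℕ.+ 4 ℕ.* j)) * inv (+ (β ℕ.+ 4 ℕ.* j))

  -- Written as (1 - q)/(1 - q²), since `inv` provides inverses of the elements 1 - q^j only.
  1/1+q : Carrier
  1/1+q = e (+ 1) * inv (+ 2)

  T : ℕ → Carrier
  T k = (1# + q^ (+ (4 ℕ.* k ℕ.+ 1))) * (R 2 4 k * R 2 4 k * R 2 4 k) * q^ (+ k) * 1/1+q

  -- The right-hand side for n² = 2 m + 1.
  rhs : ℕ → Carrier
  rhs m = e (+ (2 ℕ.* suc (2 ℕ.* m))) * inv (+ 2) * R 3 5 m * q^ (ℤ.- + m)

  q^-inverse : ∀ j → q^ j * q^ (ℤ.- j) ≈ 1#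
  q^-inverse j = trans (sym (q^-+ j (ℤ.- j))) (trans (q^-≡ (ℤₚ.+-inverseʳ j)) q^-zero)

  Π<-q⁻¹ : ∀ k → Π< k (λ _ → q^ (ℤ.- + 1)) ≈ q^ (ℤ.- + k)
  Π<-q⁻¹ zero    = sym q^-zero
  Π<-q⁻¹ (suc k) = trans (*-congʳ (Π<-q⁻¹ k)) (sym (q^-+≡ (ℤ.- + k) (ℤ.- + 1) (shape (+ k))))
    where
    shape : ∀ k → ℤ.- (+ 1 ℤ.+ k) ≡ ℤ.- k ℤ.+ ℤ.- + 1
    shape = solve-∀

  -- By 1 - q^(-j) = -q^(-j) (1 - q^j) both sides are -q^(-1-i) (1 - q^i)(1 - q^(1+i)). Each use
  -- produces one factor q^(-1) of the power of q on the right-hand side of the theorem.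
  e-swap : ∀ i → e i * e (ℤ.- (+ 1 ℤ.+ i)) ≈ e (+ 1 ℤ.+ i) * q^ (ℤ.- + 1) * e (ℤ.- i)
  e-swap i = begin
    (1# - x) * (1# - q^ (ℤ.- (+ 1 ℤ.+ i)))
      ≈⟨ *-congˡ (+-congˡ (-‿cong (q^-+≡ (ℤ.- + 1) (ℤ.- i) (ℤₚ.neg-distrib-+ (+ 1) i)))) ⟩
    (1# - x) * (1# - p * u)
      ≈⟨ solve 3 (λ x p u → (con (+ 1) :- x) :* (con (+ 1) :- p :* u) := con (+ 1) :- x :- p :* u :+ p :* (x :* u)) refl x p u ⟩
    1# - x - p * u + p * (x * u)
      ≈⟨ +-cong (+-congʳ (+-congʳ refl)) (trans (*-congˡ (q^-inverse i)) (*-identityʳ p)) ⟩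
    1# - x - p * u + p
      ≈⟨ +-congʳ (+-congʳ (+-congʳ (q^-inverse i))) ⟨
    x * u - x - p * u + p
      ≈⟨ +-congʳ (+-congʳ (+-cong (trans (*-congʳ vp≈x) refl) (-‿cong vp≈x))) ⟨
    v * p * u - v * p - p * u + p
      ≈⟨ solve 3 (λ v p u → v :* p :* u :- v :* p :- p :* u :+ p := (con (+ 1) :- v) :* p :* (con (+ 1) :- u)) refl v p u ⟩
    (1# - v) * p * (1# - u) ∎
    where
    x = q^ i
    u = q^ (ℤ.- i)
    v = q^ (+ 1 ℤ.+ i)
    p = q^ (ℤ.- + 1)
    vp≈x : v * p ≈ x
    vp≈x = sym (q^-+≡ (+ 1 ℤ.+ i) (ℤ.- + 1) (shape i))
      where
      shape : ∀ i → i ≡ (+ 1 ℤ.+ i) ℤ.+ ℤ.- + 1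
      shape = solve-∀

  -- Some denominator exponents below can be negative. Being 2 modulo 4 keeps them away from 0.
  2+4z≢0 : ∀ {j} z → j ≡ + 2 ℤ.+ + 4 ℤ.* z → j ≢ 0ℤ
  2+4z≢0 z ≡.refl eq = 2*k≢1 ℤ.∣ z ∣ (≡.trans (≡.sym (ℤₚ.abs-* (+ 2) z)) (≡.cong ℤ.∣_∣ 2z≡-1))
    where
    2*k≢1 : ∀ k → 2 ℕ.* k ≢ 1
    2*k≢1 (suc k) eq with () ← ≡.trans (≡.sym (ℕₚ.+-suc k (k ℕ.+ 0))) (ℕₚ.suc-injective eq)
    expand : ∀ z → + 2 ℤ.+ + 4 ℤ.* z ≡ + 2 ℤ.* (+ 1 ℤ.+ + 2 ℤ.* z)
    expand = solve-∀
    1+2z≡0 : + 1 ℤ.+ + 2 ℤ.* z ≡ 0ℤ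
    1+2z≡0 = ℤₚ.*-cancelˡ-≡ (+ 2) _ _ (≡.trans (≡.sym (expand z)) eq)
    2z≡-1 : + 2 ℤ.* z ≡ ℤ.- + 1
    2z≡-1 = ≡.trans (shift z) (≡.cong (ℤ._- + 1) 1+2z≡0)
      where
      shift : ∀ z → + 2 ℤ.* z ≡ + 1 ℤ.+ + 2 ℤ.* z ℤ.- + 1
      shift = solve-∀

  -- The data of a local ring O at Φ_n, for n = 2 m + 1.
  record IntegralAt (m : ℕ) : Set₁ where
    n : ℕ
    n = suc (2 ℕ.* m)
    N : ℤ
    N = + n
    field
      O       : Carrier → Set
      O-resp  : ∀ {x y} → x ≈ y → O x → O y
      O-1     : O 1#
      O-+     : ∀ {x y} → O x → O y → O (x + y)
      O-*     : ∀ {x y} → O x → O y → O (x * y)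
      O-neg   : ∀ {x} → O x → O (- x)
      O-q^    : ∀ j → O (q^ j)
      O-inv   : ∀ {j} → ¬ n ∣ ℤ.∣ j ∣ → O (inv j)
      O-ratio : ∀ a {b} → b ≢ 0ℤ → O (e (a ℤ.* N) * inv (b ℤ.* N))

    O-e : ∀ j → O (e j)
    O-e j = O-+ O-1 (O-neg (O-q^ j))

    subring : Interfaces.SubringWithElement F
    subring = record
      { ε = e N ; O = O ; O-resp = O-resp ; O-1 = O-1 ; O-+ = O-+ ; O-* = O-* ; O-neg = O-neg ; O-ε = O-e N }

  module AtOdd (m : ℕ) (𝓘 : IntegralAt m) (0<m : 0 ℕ.< m) where
    open IntegralAt 𝓘
    open LocalRing F subring public

    N-odd : N ≡ + 1 ℤ.+ + 2 ℤ.* + m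
    N-odd = ≡.cong (λ z → + 1 ℤ.+ z) (ℤₚ.pos-* 2 m)

    E-e : ∀ a → E (e (a ℤ.* N))
    E-e a = mkE (O-ratio a {+ 1} λ ()) (begin
      e (a ℤ.* N)                                   ≈⟨ *-identityʳ _ ⟨
      e (a ℤ.* N) * 1#                              ≈⟨ *-congˡ (inv-inverse λ ()) ⟨
      e (a ℤ.* N) * (inv (+ 1 ℤ.* N) * e (+ 1 ℤ.* N)) ≈⟨ *-congˡ (*-congˡ (e-≡ (ℤₚ.*-identityˡ N))) ⟩
      e (a ℤ.* N) * (inv (+ 1 ℤ.* N) * e N)         ≈⟨ solve 3 (λ x i y → x :* (i :* y) := y :* (x :* i)) refl _ _ _ ⟩
      e N * (e (a ℤ.* N) * inv (+ 1 ℤ.* N))         ∎)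

    E-e∣ : ∀ {c} → n ∣ c → E (e (+ c))
    E-e∣ (ℕ∣.divides t ≡.refl) = E-resp (e-≡ (≡.sym (ℤₚ.pos-* t n))) (E-e (+ t))

    -- With n = 2m + 1, x = nx - m(2x).
    ∣2*⇒∣ : ∀ x → n ∣ 2 ℕ.* x → n ∣ x
    ∣2*⇒∣ x n∣2x = ℕ∣.∣m+n∣m⇒∣n (≡.subst (n ∣_) (expand m x) (ℕ∣.m∣m*n x)) (ℕ∣.∣n⇒∣m*n m n∣2x)
      where
      expand : ∀ m x → suc (2 ℕ.* m) ℕ.* x ≡ m ℕ.* (2 ℕ.* x) ℕ.+ x
      expand = ℕSolver.solve-∀

    ∣4*⇒∣ : ∀ x → n ∣ 4 ℕ.* x → n ∣ x
    ∣4*⇒∣ x n∣4x = ∣2*⇒∣ x (∣2*⇒∣ (2 ℕ.* x) (≡.subst (n ∣_) (expand x) n∣4x))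
      where
      expand : ∀ x → 4 ℕ.* x ≡ 2 ℕ.* (2 ℕ.* x)
      expand = ℕSolver.solve-∀

    gap : ∀ c {i j} → i ℕ.< j → n ∣ c ℕ.+ 4 ℕ.* i → n ∣ c ℕ.+ 4 ℕ.* j → n ℕ.≤ j ℕ.∸ i
    gap c {i} {j} i<j n∣i n∣j = ℕ∣.∣⇒≤ ⦃ ℕ.>-nonZero (ℕₚ.m<n⇒0<n∸m i<j) ⦄ (∣4*⇒∣ (j ℕ.∸ i) (ℕ∣.∣m+n∣m⇒∣n
      (≡.subst (n ∣_) (≡.trans (≡.cong (λ z → c ℕ.+ 4 ℕ.* z) (≡.sym (ℕₚ.m+[n∸m]≡n (ℕₚ.<⇒≤ i<j)))) (split c i (j ℕ.∸ i))) n∣j) n∣i))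
      where
      split : ∀ c i d → c ℕ.+ 4 ℕ.* (i ℕ.+ d) ≡ c ℕ.+ 4 ℕ.* i ℕ.+ 4 ℕ.* d
      split = ℕSolver.solve-∀

    zero-unique : ∀ c {i j} → i ℕ.< n → j ℕ.< n → n ∣ c ℕ.+ 4 ℕ.* i → n ∣ c ℕ.+ 4 ℕ.* j → i ≡ j
    zero-unique c {i} {j} i<n j<n n∣i n∣j with ℕₚ.<-cmp i j
    ... | tri≈ _ i≡j _ = i≡j
    ... | tri< i<j _ _ = contradiction j<n (ℕₚ.≤⇒≯ (ℕₚ.≤-trans (gap c i<j n∣i n∣j) (ℕₚ.m∸n≤m j i)))
    ... | tri> _ _ j<i = contradiction i<n (ℕₚ.≤⇒≯ (ℕₚ.≤-trans (gap c j<i n∣j n∣i) (ℕₚ.m∸n≤m i j)))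

    periodic : ∀ c l n r → c ℕ.+ 4 ℕ.* (l ℕ.* n ℕ.+ r) ≡ 4 ℕ.* l ℕ.* n ℕ.+ (c ℕ.+ 4 ℕ.* r)
    periodic = ℕSolver.solve-∀

    ∤-shift : ∀ c l r → ¬ n ∣ c ℕ.+ 4 ℕ.* r → ¬ n ∣ c ℕ.+ 4 ℕ.* (l ℕ.* n ℕ.+ r)
    ∤-shift c l r n∤ n∣ = n∤ (ℕ∣.∣m+n∣m⇒∣n (≡.subst (n ∣_) (periodic c l n r) n∣) (ℕ∣.n∣m*n (4 ℕ.* l)))

    ∣-shift : ∀ c l r → n ∣ c ℕ.+ 4 ℕ.* r → n ∣ c ℕ.+ 4 ℕ.* (l ℕ.* n ℕ.+ r)
    ∣-shift c l r n∣ = ≡.subst (n ∣_) (≡.sym (periodic c l n r)) (ℕ∣.∣m∣n⇒∣m+n (ℕ∣.n∣m*n (4 ℕ.* l)) n∣)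

    -- In each period, the zero of the numerator (at j₀) precedes that of the denominator (at j₁).
    module Ratio (α β j₀ j₁ : ℕ) (j₀<j₁ : j₀ ℕ.< j₁) (j₁<n : j₁ ℕ.< n) (0<β : 0 ℕ.< β)
      (n∣α : n ∣ α ℕ.+ 4 ℕ.* j₀) (n∣β : n ∣ β ℕ.+ 4 ℕ.* j₁) where

      -- `k` is the absolute index and `r` its position within the period. Between the two zeros of
      -- a period the quotient carries a factor ε, which later pays for the zero of the denominator.
      State : ℕ → ℕ → Set
      State r k = O (R α β k) × (j₀ ℕ.< r → r ℕ.≤ j₁ → E (R α β k))

      num∈O : ∀ k → O (e (+ (α ℕ.+ 4 ℕ.* k)))
      num∈O k = O-e _

      den∈O : ∀ l {r} → r ℕ.< n → r ≢ j₁ → O (inv (+ (β ℕ.+ 4 ℕ.* (l ℕ.* n ℕ.+ r))))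
      den∈O l {r} r<n r≢j₁ = O-inv (∤-shift β l r λ n∣r → r≢j₁ (zero-unique β r<n j₁<n n∣r n∣β))

      -- Whatever the multiple t n in the exponent, ε/(1 - q^(tn)) is integral for t nonzero: such a
      -- denominator costs a single factor ε.
      E*den∈O : ∀ l {x} → E x → O (x * inv (+ (β ℕ.+ 4 ℕ.* (l ℕ.* n ℕ.+ j₁))))
      E*den∈O l {x} (mkE {o} o∈O x≈) with ∣-shift β l j₁ n∣β
      ... | ℕ∣.divides t eq = O-resp (begin
          o * (e (+ 1 ℤ.* N) * inv (+ t ℤ.* N))
            ≈⟨ *-congˡ (*-cong (e-≡ (ℤₚ.*-identityˡ N)) (reflexive (≡.cong inv (≡.trans (≡.sym (ℤₚ.pos-* t n)) (≡.cong +_ (≡.sym eq)))))) ⟩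
          o * (e N * inv (+ k))   ≈⟨ solve 3 (λ o e i → o :* (e :* i) := e :* o :* i) refl _ _ _ ⟩
          e N * o * inv (+ k)     ≈⟨ *-congʳ x≈ ⟨
          x * inv (+ k)           ∎)
        (O-* o∈O (O-ratio (+ 1) t≢0))
        where
        k = β ℕ.+ 4 ℕ.* (l ℕ.* n ℕ.+ j₁)
        t≢0 : + t ≢ 0ℤ
        t≢0 t≡0 = ℕₚ.<⇒≢ (ℕₚ.<-≤-trans 0<β (ℕₚ.m≤m+n β _)) (≡.sym (≡.trans eq (≡.cong (ℕ._* n) (ℤₚ.+-injective t≡0))))

      step : ∀ l r → r ℕ.< n → State r (l ℕ.* n ℕ.+ r) → State (suc r) (suc (l ℕ.* n ℕ.+ r))
      step l r r<n (inO , inE) with ℕₚ.<-cmp r j₁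
      -- Here the strip ends, and the factor ε collected since `j₀` is spent on the denominator.
      ... | tri≈ _ ≡.refl _ = O-resp (solve 3 (λ x i y → (x :* i) :* y := x :* (y :* i)) refl _ _ _)
                                (O-* (E*den∈O l (inE j₀<j₁ ℕₚ.≤-refl)) (num∈O (l ℕ.* n ℕ.+ r)))
                            , λ _ j₁<j₁ → contradiction j₁<j₁ (ℕₚ.<⇒≱ (ℕₚ.n<1+n _))
      ... | tri> _ r≢j₁ j₁<r = O-* inO (O-* (num∈O (l ℕ.* n ℕ.+ r)) (den∈O l r<n r≢j₁))
                             , λ _ r<j₁ → contradiction (ℕₚ.<-trans j₁<r r<j₁) (ℕₚ.<-irrefl ≡.refl)
      ... | tri< r<j₁ r≢j₁ _ = O-* inO (O-* (num∈O (l ℕ.* n ℕ.+ r)) (den∈O l r<n r≢j₁)) , zero-passed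
        where
        zero-passed : j₀ ℕ.< suc r → suc r ℕ.≤ j₁ → E (R α β (suc (l ℕ.* n ℕ.+ r)))
        zero-passed j₀≤r _ with ℕₚ.m≤n⇒m<n∨m≡n (ℕₚ.≤-pred j₀≤r)
        ... | inj₁ j₀<r   = E-*ˡ (inE j₀<r (ℕₚ.<⇒≤ r<j₁)) (O-* (num∈O (l ℕ.* n ℕ.+ r)) (den∈O l r<n r≢j₁))
        ... | inj₂ ≡.refl = E-*ʳ inO (E-*ˡ (E-e∣ (∣-shift α l r n∣α)) (den∈O l r<n r≢j₁))

      state : ∀ l r → r ℕ.≤ n → State r (l ℕ.* n ℕ.+ r)
      state zero    zero    _   = O-1 , λ ()
      state (suc l) zero    _   = ≡.subst (λ k → O (R α β k)) (carry n (l ℕ.* n)) (proj₁ (state l n ℕₚ.≤-refl)) , λ ()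
        where
        carry : ∀ n k → k ℕ.+ n ≡ n ℕ.+ k ℕ.+ 0
        carry = ℕSolver.solve-∀
      state l       (suc r) r<n = ≡.subst (State (suc r)) (≡.sym (ℕₚ.+-suc (l ℕ.* n) r)) (step l r r<n (state l r (ℕₚ.<⇒≤ r<n)))

      R∈O : ∀ l {r} → r ℕ.≤ n → O (R α β (l ℕ.* n ℕ.+ r))
      R∈O l r≤n = proj₁ (state l _ r≤n)

      R∈E : ∀ l {r} → j₀ ℕ.< r → r ℕ.≤ j₁ → E (R α β (l ℕ.* n ℕ.+ r))
      R∈E l j₀<r r≤j₁ = proj₂ (state l _ (ℕₚ.≤-trans r≤j₁ (ℕₚ.<⇒≤ j₁<n))) j₀<r r≤j₁

    m<n : m ℕ.< n
    m<n = ℕ.s≤s (ℕₚ.m≤m+n m _)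

    O-1/1+q : O 1/1+q
    O-1/1+q = O-* (O-e (+ 1)) (O-inv {+ 2} λ n∣2 → contradiction (ℕ∣.∣⇒≤ n∣2)
      (ℕₚ.<⇒≱ (ℕ.s≤s (ℕₚ.*-monoʳ-≤ 2 0<m))))

    2+4m≡2n : ∀ m → 2 ℕ.+ 4 ℕ.* m ≡ 2 ℕ.* suc (2 ℕ.* m)
    2+4m≡2n = ℕSolver.solve-∀

    4+8m≡4n : ∀ m → 4 ℕ.+ 4 ℕ.* (2 ℕ.* m) ≡ 4 ℕ.* suc (2 ℕ.* m)
    4+8m≡4n = ℕSolver.solve-∀

    -- The zeros are 2 + 4m = 2n and 4 + 4(2m) = 4n. The second lies at the last place n - 1 of the
    -- period, so the strip covers all positions r with m < r < n.
    module R₂₄ = Ratio 2 4 m (2 ℕ.* m) (ℕₚ.m<m+n m (≡.subst (0 ℕ.<_) (≡.sym (ℕₚ.+-identityʳ m)) 0<m)) (ℕₚ.n<1+n _) (ℕ.s≤s ℕ.z≤n)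
      (ℕ∣.divides 2 (2+4m≡2n m)) (ℕ∣.divides 4 (4+8m≡4n m))

    -- The terms T (l n + r), r < n, are compared with the well-poised sum for s = q^(1+4ln) and 1/d = q^(2+4ln+2n):
    -- the exponents of its numerator factors are those of T, shifted by 4ln, 2n and -(4l+2)n, of sum 0.
    module Block (l : ℕ) where

      P : ℤ
      P = + l ℤ.* N

      σ γ : ℤ
      σ = + 1 ℤ.+ + 4 ℤ.* P
      γ = + 2 ℤ.+ + 4 ℤ.* P ℤ.+ + 2 ℤ.* N

      -- `α₀`, `β₀` are the exponents in the terms of the theorem. `α₁`, `α₂`, `α₃` belong to s²Q^k,
      -- cQ^k, Q^(k-m), and `β₁`, `β₂` to Q^(k+1), s²Q^(k+1)/c. `β₃` is independent of m like `i₃`: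
      -- it is taken at k + m for s²Q^(m+k+1).
      α₀ α₁ α₂ α₃ β₀ β₁ β₂ β₃ : ℕ → ℤ
      α₀ k = + 2 ℤ.+ + 4 ℤ.* P ℤ.+ + 4 ℤ.* + k
      α₁ k = + 2 ℤ.+ + 8 ℤ.* P ℤ.+ + 4 ℤ.* + k
      α₂ k = + 2 ℤ.+ + 4 ℤ.* P ℤ.+ + 2 ℤ.* N ℤ.+ + 4 ℤ.* + k
      α₃ k = + 2 ℤ.- + 2 ℤ.* N ℤ.+ + 4 ℤ.* + k
      β₀ k = + 4 ℤ.+ + 4 ℤ.* P ℤ.+ + 4 ℤ.* + k
      β₁ k = + 4 ℤ.* + suc k
      β₂ k = + 4 ℤ.+ + 4 ℤ.* P ℤ.- + 2 ℤ.* N ℤ.+ + 4 ℤ.* + k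
      β₃ k = + 2 ℤ.+ + 8 ℤ.* P ℤ.+ + 4 ℤ.* + suc k

      y : ℕ → Carrier
      y k = q^ (+ 4 ℤ.* + k)

      merge₃ : ∀ a b c → q^ a * q^ b * q^ c ≈ q^ (a ℤ.+ b ℤ.+ c)
      merge₃ a b c = trans (*-congʳ (sym (q^-+ a b))) (sym (q^-+ _ c))

      merge₄ : ∀ a b c d → q^ a * q^ b * q^ c * q^ d ≈ q^ (a ℤ.+ b ℤ.+ c ℤ.+ d)
      merge₄ a b c d = trans (*-congʳ (merge₃ a b c)) (sym (q^-+ _ d))

      β₂-shape : ∀ k → β₂ k ≡ + 2 ℤ.+ + 4 ℤ.* (P ℤ.- + m ℤ.+ + k)
      β₂-shape k = ≡.trans (≡.cong (λ z → + 4 ℤ.+ + 4 ℤ.* P ℤ.- + 2 ℤ.* z ℤ.+ + 4 ℤ.* + k) N-odd) (shape P (+ m) (+ k))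
        where
        shape : ∀ P m k → + 4 ℤ.+ + 4 ℤ.* P ℤ.- + 2 ℤ.* (+ 1 ℤ.+ + 2 ℤ.* m) ℤ.+ + 4 ℤ.* k ≡ + 2 ℤ.+ + 4 ℤ.* (P ℤ.- m ℤ.+ k)
        shape = solve-∀

      β₃-shape : ∀ k → β₃ k ≡ + 2 ℤ.+ + 4 ℤ.* (+ 2 ℤ.* P ℤ.+ + suc k)
      β₃-shape k = shape P (+ suc k)
        where
        shape : ∀ P k → + 2 ℤ.+ + 8 ℤ.* P ℤ.+ + 4 ℤ.* k ≡ + 2 ℤ.+ + 4 ℤ.* (+ 2 ℤ.* P ℤ.+ k)
        shape = solve-∀

      inv₁ : ∀ k → inv (β₁ k) * (1# - y (suc k)) ≈ 1#
      inv₁ k = inv-inverse λ ()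

      inv₂ : ∀ k → inv (β₂ k) * (1# - q^ σ * q^ σ * q^ (ℤ.- γ) * y (suc k)) ≈ 1#
      inv₂ k = trans (*-congˡ (+-congˡ (-‿cong (trans (merge₄ σ σ (ℤ.- γ) (+ 4 ℤ.* + suc k)) (q^-≡ (exponent P N (+ k)))))))
        (inv-inverse (2+4z≢0 (P ℤ.- + m ℤ.+ + k) (β₂-shape k)))
        where
        exponent : ∀ P N k → (+ 1 ℤ.+ + 4 ℤ.* P) ℤ.+ (+ 1 ℤ.+ + 4 ℤ.* P) ℤ.+ ℤ.- (+ 2 ℤ.+ + 4 ℤ.* P ℤ.+ + 2 ℤ.* N) ℤ.+ + 4 ℤ.* (+ 1 ℤ.+ k)
          ≡ + 4 ℤ.+ + 4 ℤ.* P ℤ.- + 2 ℤ.* N ℤ.+ + 4 ℤ.* k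
        exponent = solve-∀

      inv₃ : ∀ k → inv (β₃ k) * (1# - q^ σ * q^ σ * y (suc k)) ≈ 1#
      inv₃ k = trans (*-congˡ (+-congˡ (-‿cong (trans (merge₃ σ σ (+ 4 ℤ.* + suc k)) (q^-≡ (exponent P (+ suc k)))))))
        (inv-inverse (2+4z≢0 (+ 2 ℤ.* P ℤ.+ + suc k) (β₃-shape k)))
        where
        exponent : ∀ P k → (+ 1 ℤ.+ + 4 ℤ.* P) ℤ.+ (+ 1 ℤ.+ + 4 ℤ.* P) ℤ.+ + 4 ℤ.* k ≡ + 2 ℤ.+ + 8 ℤ.* P ℤ.+ + 4 ℤ.* k
        exponent = solve-∀

      y-suc : ∀ k → y (suc k) ≈ q^ (+ 4) * y k
      y-suc k = q^-+≡ (+ 4) (+ 4 ℤ.* + k) (shape (+ k))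
        where
        shape : ∀ k → + 4 ℤ.* (+ 1 ℤ.+ k) ≡ + 4 ℤ.+ + 4 ℤ.* k
        shape = solve-∀

      open WellPoised (q^ (+ 4)) (q^ σ) (q^ (ℤ.- γ)) y (λ k → inv (β₁ k)) (λ k → inv (β₂ k)) (λ k → inv (β₃ k))
        q^-zero y-suc inv₁ inv₂ inv₃ public using (h; sum; summation) renaming (V to factor; a to bottom; b to top)

      α̂ β̂ H : ℕ → Carrier
      α̂ k = e (α₁ k) * e (α₂ k) * e (α₃ k)
      β̂ k = inv (β₁ k) * inv (β₂ k) * inv (β₃ (k ℕ.+ m))
      H k = α̂ k * β̂ k * q^ (+ 1)

      -- Turning d - Q^k and Q^(m+1) - Q^(k+1) back into factors 1 - q^j releases the argument
      -- sQ^(m+1)/c. Its exponent is 4m + 3 - 2n = 1, which matches the factor q^k of the terms.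
      h-suc : ∀ k → h m (suc k) ≈ h m k * H k
      h-suc k = *-congˡ (begin
        (1# - q^ σ * q^ σ * y k) * (q^ (ℤ.- γ) - y k) * q^ σ * (i₁ * i₂) * (y (suc m) - y (suc k)) * i₃
          ≈⟨ *-congʳ (*-cong (*-congʳ (*-congʳ (*-cong
               (+-congˡ (-‿cong (trans (merge₃ σ σ (+ 4 ℤ.* + k)) (q^-≡ (exponent₁ P (+ k))))))
               (+-congˡ (-‿cong (q^-+≡ (ℤ.- γ) (α₂ k) (exponent₂ P N (+ k))))))))
               (+-congˡ (-‿cong (q^-+≡ (+ 4 ℤ.* + suc m) (α₃ k) exponent₃)))) ⟩
        e (α₁ k) * (d - d * q^ (α₂ k)) * q^ σ * (i₁ * i₂) * (y (suc m) - y (suc m) * q^ (α₃ k)) * i₃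
          ≈⟨ solve 9 (λ x d u s i₁ i₂ y v i₃ → let 𝟙 = con (+ 1) in x :* (d :- d :* u) :* s :* (i₁ :* i₂) :* (y :- y :* v) :* i₃
               := x :* (𝟙 :- u) :* (𝟙 :- v) :* (i₁ :* i₂ :* i₃) :* (d :* s :* y)) refl _ d _ _ i₁ i₂ _ _ i₃ ⟩
        α̂ k * β̂ k * (q^ (ℤ.- γ) * q^ σ * y (suc m))
          ≈⟨ *-congˡ (trans (merge₃ (ℤ.- γ) σ (+ 4 ℤ.* + suc m)) (q^-≡ exponent₄)) ⟩
        H k ∎)
        where
        d = q^ (ℤ.- γ)
        i₁ = inv (β₁ k)
        i₂ = inv (β₂ k)
        i₃ = inv (β₃ (k ℕ.+ m))
        exponent₁ : ∀ P k → (+ 1 ℤ.+ + 4 ℤ.* P) ℤ.+ (+ 1 ℤ.+ + 4 ℤ.* P) ℤ.+ + 4 ℤ.* k ≡ + 2 ℤ.+ + 8 ℤ.* P ℤ.+ + 4 ℤ.* k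
        exponent₁ = solve-∀
        exponent₂ : ∀ P N k → + 4 ℤ.* k ≡ ℤ.- (+ 2 ℤ.+ + 4 ℤ.* P ℤ.+ + 2 ℤ.* N) ℤ.+ (+ 2 ℤ.+ + 4 ℤ.* P ℤ.+ + 2 ℤ.* N ℤ.+ + 4 ℤ.* k)
        exponent₂ = solve-∀
        exponent₃′ : ∀ m k → + 4 ℤ.* (+ 1 ℤ.+ k) ≡ + 4 ℤ.* (+ 1 ℤ.+ m) ℤ.+ (+ 2 ℤ.- + 2 ℤ.* (+ 1 ℤ.+ + 2 ℤ.* m) ℤ.+ + 4 ℤ.* k)
        exponent₃′ = solve-∀
        exponent₃ : + 4 ℤ.* + suc k ≡ + 4 ℤ.* + suc m ℤ.+ α₃ k
        exponent₃ = ≡.trans (exponent₃′ (+ m) (+ k)) (≡.cong (λ z → + 4 ℤ.* + suc m ℤ.+ (+ 2 ℤ.- + 2 ℤ.* z ℤ.+ + 4 ℤ.* + k)) (≡.sym N-odd))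
        exponent₄′ : ∀ P m → ℤ.- (+ 2 ℤ.+ + 4 ℤ.* P ℤ.+ + 2 ℤ.* (+ 1 ℤ.+ + 2 ℤ.* m)) ℤ.+ (+ 1 ℤ.+ + 4 ℤ.* P) ℤ.+ + 4 ℤ.* (+ 1 ℤ.+ m) ≡ + 1
        exponent₄′ = solve-∀
        exponent₄ : ℤ.- γ ℤ.+ σ ℤ.+ + 4 ℤ.* + suc m ≡ + 1
        exponent₄ = ≡.trans (≡.cong (λ z → ℤ.- (+ 2 ℤ.+ + 4 ℤ.* P ℤ.+ + 2 ℤ.* z) ℤ.+ σ ℤ.+ + 4 ℤ.* + suc m) N-odd) (exponent₄′ P (+ m))

      α-congruence : ∀ k → I (α̂ k - e (α₀ k) * e (α₀ k) * e (α₀ k))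
      α-congruence k = I-resp (+-congʳ (*-cong (*-cong
          (+-congˡ (-‿cong (sym (q^-+≡ (α₀ k) _ (exponent₁ (+ l) N (+ k))))))
          (+-congˡ (-‿cong (sym (q^-+≡ (α₀ k) _ (exponent₂ P N (+ k)))))))
          (+-congˡ (-‿cong (sym (q^-+≡ (α₀ k) _ (exponent₃ (+ l) N (+ k))))))))
        (cube-congruence (O-q^ (α₀ k)) (E-e (+ 4 ℤ.* + l)) (E-e (+ 2)) (E-e (ℤ.- + 2 ℤ.- + 4 ℤ.* + l))
          (trans (merge₃ _ _ _) (trans (q^-≡ (exponent₀ (+ l) N)) q^-zero)))
        where
        exponent₀ : ∀ L N → + 4 ℤ.* L ℤ.* N ℤ.+ + 2 ℤ.* N ℤ.+ (ℤ.- + 2 ℤ.- + 4 ℤ.* L) ℤ.* N ≡ 0ℤ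
        exponent₀ = solve-∀
        exponent₁ : ∀ L N k → + 2 ℤ.+ + 8 ℤ.* (L ℤ.* N) ℤ.+ + 4 ℤ.* k ≡ + 2 ℤ.+ + 4 ℤ.* (L ℤ.* N) ℤ.+ + 4 ℤ.* k ℤ.+ + 4 ℤ.* L ℤ.* N
        exponent₁ = solve-∀
        exponent₂ : ∀ P N k → + 2 ℤ.+ + 4 ℤ.* P ℤ.+ + 2 ℤ.* N ℤ.+ + 4 ℤ.* k ≡ + 2 ℤ.+ + 4 ℤ.* P ℤ.+ + 4 ℤ.* k ℤ.+ + 2 ℤ.* N
        exponent₂ = solve-∀
        exponent₃ : ∀ L N k → + 2 ℤ.- + 2 ℤ.* N ℤ.+ + 4 ℤ.* k ≡ + 2 ℤ.+ + 4 ℤ.* (L ℤ.* N) ℤ.+ + 4 ℤ.* k ℤ.+ (ℤ.- + 2 ℤ.- + 4 ℤ.* L) ℤ.* N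
        exponent₃ = solve-∀

      β₃-exponent : ∀ k → β₃ (k ℕ.+ m) ≡ + 4 ℤ.+ + 8 ℤ.* P ℤ.+ + 2 ℤ.* N ℤ.+ + 4 ℤ.* + k
      β₃-exponent k = ≡.trans (shape P (+ k) (+ m)) (≡.cong (λ z → + 4 ℤ.+ + 8 ℤ.* P ℤ.+ + 2 ℤ.* z ℤ.+ + 4 ℤ.* + k) (≡.sym N-odd))
        where
        shape : ∀ P k m → + 2 ℤ.+ + 8 ℤ.* P ℤ.+ + 4 ℤ.* (+ 1 ℤ.+ (k ℤ.+ m)) ≡ + 4 ℤ.+ + 8 ℤ.* P ℤ.+ + 2 ℤ.* (+ 1 ℤ.+ + 2 ℤ.* m) ℤ.+ + 4 ℤ.* k
        shape = solve-∀

      -- Well-poisedness: the sums `α₀ k` + `β₀ k`, `α₁ k` + `β₁ k`, `α₂ k` + `β₂ k` and `α₃ k` +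
      -- `β₃ (k + m)` all coincide. Hence the shifts of the denominators are the negatives of those
      -- of the numerators, and again of sum zero.
      β-congruence : ∀ k → I (e (β₁ k) * e (β₂ k) * e (β₃ (k ℕ.+ m)) - e (β₀ k) * e (β₀ k) * e (β₀ k))
      β-congruence k = I-resp (+-congʳ (*-cong (*-cong
          (+-congˡ (-‿cong (sym (q^-+≡ (β₀ k) _ (exponent₁ (+ l) N (+ k))))))
          (+-congˡ (-‿cong (sym (q^-+≡ (β₀ k) _ (exponent₂ P N (+ k)))))))
          (+-congˡ (-‿cong (sym (q^-+≡ (β₀ k) _ (≡.trans (β₃-exponent k) (exponent₃ (+ l) N (+ k)))))))))
        (cube-congruence (O-q^ (β₀ k)) (E-e (ℤ.- (+ 4 ℤ.* + l))) (E-e (ℤ.- + 2)) (E-e (+ 2 ℤ.+ + 4 ℤ.* + l))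
          (trans (merge₃ _ _ _) (trans (q^-≡ (exponent₀ (+ l) N)) q^-zero)))
        where
        exponent₀ : ∀ L N → ℤ.- (+ 4 ℤ.* L) ℤ.* N ℤ.+ (ℤ.- + 2) ℤ.* N ℤ.+ (+ 2 ℤ.+ + 4 ℤ.* L) ℤ.* N ≡ 0ℤ
        exponent₀ = solve-∀
        exponent₁ : ∀ L N k → + 4 ℤ.* (+ 1 ℤ.+ k) ≡ + 4 ℤ.+ + 4 ℤ.* (L ℤ.* N) ℤ.+ + 4 ℤ.* k ℤ.+ ℤ.- (+ 4 ℤ.* L) ℤ.* N
        exponent₁ = solve-∀
        exponent₂ : ∀ P N k → + 4 ℤ.+ + 4 ℤ.* P ℤ.- + 2 ℤ.* N ℤ.+ + 4 ℤ.* k ≡ + 4 ℤ.+ + 4 ℤ.* P ℤ.+ + 4 ℤ.* k ℤ.+ (ℤ.- + 2) ℤ.* N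
        exponent₂ = solve-∀
        exponent₃ : ∀ L N k → + 4 ℤ.+ + 8 ℤ.* (L ℤ.* N) ℤ.+ + 2 ℤ.* N ℤ.+ + 4 ℤ.* k ≡ + 4 ℤ.+ + 4 ℤ.* (L ℤ.* N) ℤ.+ + 4 ℤ.* k ℤ.+ (+ 2 ℤ.+ + 4 ℤ.* L) ℤ.* N
        exponent₃ = solve-∀

      position : ∀ c k → + (c ℕ.+ 4 ℕ.* (l ℕ.* n ℕ.+ k)) ≡ + c ℤ.+ + 4 ℤ.* P ℤ.+ + 4 ℤ.* + k
      position c k = ≡.trans (≡.cong (λ z → + c ℤ.+ z) (≡.trans (ℤₚ.pos-* 4 (l ℕ.* n ℕ.+ k)) (≡.cong (λ z → + 4 ℤ.* (z ℤ.+ + k)) (ℤₚ.pos-* l n))))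
        (shape (+ c) P (+ k))
        where
        shape : ∀ c P k → c ℤ.+ + 4 ℤ.* (P ℤ.+ k) ≡ c ℤ.+ + 4 ℤ.* P ℤ.+ + 4 ℤ.* k
        shape = solve-∀

      -- All denominator exponents at k are 4(k + 1) modulo n. This decides how far the factorwise
      -- comparison reaches.
      n∤4* : ∀ {k} → k ℕ.< m → ¬ n ∣ 4 ℕ.* suc k
      n∤4* {k} k<m n∣ = contradiction (ℕ∣.∣⇒≤ (∣4*⇒∣ (suc k) n∣)) (ℕₚ.<⇒≱ (ℕₚ.≤-<-trans k<m (ℕ.s≤s (ℕₚ.m≤m+n m _))))

      O-inv′ : ∀ {c j} u → ¬ n ∣ c → j ≡ + c ℤ.+ u ℤ.* N → O (inv j)
      O-inv′ {c} {j} u n∤c j≡ = O-inv λ n∣j → n∤c (ℤ∣.∣⇒∣ᵤ (ℤ∣.∣m+n∣n⇒∣m {N} {+ c} {u ℤ.* N}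
        (≡.subst (N ℤ∣.∣_) j≡ (ℤ∣.∣ᵤ⇒∣ {N} {j} n∣j)) (ℤ∣.divides u ≡.refl)))

      β₀∈O : ∀ {k} → k ℕ.< m → O (inv (β₀ k))
      β₀∈O {k} k<m = O-inv′ {4 ℕ.* suc k} (+ 4 ℤ.* + l) (n∤4* k<m)
        (≡.trans (shape (+ l) N (+ k)) (≡.cong (ℤ._+ + 4 ℤ.* + l ℤ.* N) (≡.sym (ℤₚ.pos-* 4 (suc k)))))
        where
        shape : ∀ L N k → + 4 ℤ.+ + 4 ℤ.* (L ℤ.* N) ℤ.+ + 4 ℤ.* k ≡ + 4 ℤ.* (+ 1 ℤ.+ k) ℤ.+ + 4 ℤ.* L ℤ.* N
        shape = solve-∀

      β-case : ∀ {k} → k ℕ.< m → ∀ {j} u → j ≡ + 4 ℤ.* + suc k ℤ.+ u ℤ.* N → O (inv j)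
      β-case {k} k<m u eq = O-inv′ {4 ℕ.* suc k} u (n∤4* k<m) (≡.trans eq (≡.cong (ℤ._+ u ℤ.* N) (≡.sym (ℤₚ.pos-* 4 (suc k)))))

      β₂∈O : ∀ {k} → k ℕ.< m → O (inv (β₂ k))
      β₂∈O {k} k<m = β-case k<m (+ 4 ℤ.* + l ℤ.- + 2) (shape (+ l) N (+ k))
        where
        shape : ∀ L N k → + 4 ℤ.+ + 4 ℤ.* (L ℤ.* N) ℤ.- + 2 ℤ.* N ℤ.+ + 4 ℤ.* k ≡ + 4 ℤ.* (+ 1 ℤ.+ k) ℤ.+ (+ 4 ℤ.* L ℤ.- + 2) ℤ.* N
        shape = solve-∀

      β̂∈O : ∀ {k} → k ℕ.< m → O (β̂ k)
      β̂∈O {k} k<m = O-* (O-* (β-case k<m 0ℤ (shape₁ N (+ k))) (β₂∈O k<m))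
        (β-case k<m (+ 8 ℤ.* + l ℤ.+ + 2) (≡.trans (β₃-exponent k) (shape₃ (+ l) N (+ k))))
        where
        shape₁ : ∀ N k → + 4 ℤ.* (+ 1 ℤ.+ k) ≡ + 4 ℤ.* (+ 1 ℤ.+ k) ℤ.+ 0ℤ ℤ.* N
        shape₁ = solve-∀
        shape₃ : ∀ L N k → + 4 ℤ.+ + 8 ℤ.* (L ℤ.* N) ℤ.+ + 2 ℤ.* N ℤ.+ + 4 ℤ.* k ≡ + 4 ℤ.* (+ 1 ℤ.+ k) ℤ.+ (+ 8 ℤ.* L ℤ.+ + 2) ℤ.* N
        shape₃ = solve-∀

      -- The ratio of consecutive values of `cube` along block l, the counterpart of `H`.
      G : ℕ → Carrier
      G k = e (α₀ k) * e (α₀ k) * e (α₀ k) * (inv (β₀ k) * inv (β₀ k) * inv (β₀ k)) * q^ (+ 1)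

      g : ℕ → Carrier
      g r = Π< r G

      ratio-step : ∀ k → e (+ (2 ℕ.+ 4 ℕ.* (l ℕ.* n ℕ.+ k))) * inv (+ (4 ℕ.+ 4 ℕ.* (l ℕ.* n ℕ.+ k))) ≈ e (α₀ k) * inv (β₀ k)
      ratio-step k = reflexive (≡.cong₂ (λ a b → e a * inv b) (position 2 k) (position 4 k))

      cube : ℕ → Carrier
      cube k = R 2 4 k * R 2 4 k * R 2 4 k * q^ (+ k)

      cube-g : ∀ r → cube (l ℕ.* n ℕ.+ r) ≈ cube (l ℕ.* n) * g r
      cube-g zero    = trans (reflexive (≡.cong cube (ℕₚ.+-identityʳ (l ℕ.* n)))) (sym (*-identityʳ _))
      cube-g (suc r) = begin
        cube (l ℕ.* n ℕ.+ suc r)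
          ≈⟨ reflexive (≡.cong cube (ℕₚ.+-suc (l ℕ.* n) r)) ⟩
        cube (suc k)
          ≈⟨ *-cong (*-cong (*-cong R≈ R≈) R≈) (q^-+ (+ 1) (+ k)) ⟩
        R 2 4 k * (a * b) * (R 2 4 k * (a * b)) * (R 2 4 k * (a * b)) * (q^ (+ 1) * q^ (+ k))
          ≈⟨ solve 5 (λ r a b p t → (r :* (a :* b)) :* (r :* (a :* b)) :* (r :* (a :* b)) :* (p :* t)
               := (r :* r :* r :* t) :* (a :* a :* a :* (b :* b :* b) :* p)) refl (R 2 4 k) a b (q^ (+ 1)) (q^ (+ k)) ⟩
        cube k * G r            ≈⟨ *-congʳ (cube-g r) ⟩
        cube (l ℕ.* n) * g r * G r  ≈⟨ *-assoc _ _ _ ⟩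
        cube (l ℕ.* n) * g (suc r)  ∎
        where
        k = l ℕ.* n ℕ.+ r
        a = e (α₀ r)
        b = inv (β₀ r)
        R≈ : R 2 4 (suc k) ≈ R 2 4 k * (a * b)
        R≈ = *-congˡ (ratio-step r)

      G≡H : ∀ {k} → k ℕ.< m → I (G k - H k)
      G≡H {k} k<m = I-resp (solve 3 (λ x y t → (x :- y) :* t := x :* t :- y :* t) refl (a₀ * b₀) (α̂ k * β̂ k) (q^ (+ 1)))
        (I-*ˡ {a₀ * b₀ - α̂ k * β̂ k} {q^ (+ 1)} quotient (O-q^ (+ 1)))
        where
        a₀ = e (α₀ k) * e (α₀ k) * e (α₀ k)
        b₀ = inv (β₀ k) * inv (β₀ k) * inv (β₀ k)
        inverse-β₀ : inv (β₀ k) * e (β₀ k) ≈ 1#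
        inverse-β₀ = ≡.subst (λ j → inv j * e j ≈ 1#) (position 4 k) (inv-inverse {+ (4 ℕ.+ 4 ℕ.* (l ℕ.* n ℕ.+ k))} λ ())
        inverse₃ : ∀ {x x̂ y ŷ z ẑ} → x̂ * x ≈ 1# → ŷ * y ≈ 1# → ẑ * z ≈ 1# → (x̂ * ŷ * ẑ) * (x * y * z) ≈ 1#
        inverse₃ {x} {x̂} {y} {ŷ} {z} {ẑ} p q r = begin
          (x̂ * ŷ * ẑ) * (x * y * z)     ≈⟨ solve 6 (λ x x̂ y ŷ z ẑ → (x̂ :* ŷ :* ẑ) :* (x :* y :* z) := (x̂ :* x) :* (ŷ :* y) :* (ẑ :* z)) refl x x̂ y ŷ z ẑ ⟩
          (x̂ * x) * (ŷ * y) * (ẑ * z)   ≈⟨ *-cong (*-cong p q) r ⟩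
          1# * 1# * 1#                  ≈⟨ trans (*-identityʳ _) (*-identityʳ _) ⟩
          1#                            ∎
        α̂∈O : O (α̂ k)
        α̂∈O = O-* (O-* (O-e (α₁ k)) (O-e (α₂ k))) (O-e (α₃ k))
        b₀∈O : O b₀
        b₀∈O = O-* (O-* (β₀∈O k<m) (β₀∈O k<m)) (β₀∈O k<m)
        quotient : I (a₀ * b₀ - α̂ k * β̂ k)
        quotient = I-quotient {a₀} {α̂ k} {e (β₀ k) * e (β₀ k) * e (β₀ k)} {e (β₁ k) * e (β₂ k) * e (β₃ (k ℕ.+ m))} {b₀} {β̂ k}
          α̂∈O b₀∈O (β̂∈O k<m)
          (inverse₃ {e (β₀ k)} {inv (β₀ k)} {e (β₀ k)} {inv (β₀ k)} {e (β₀ k)} {inv (β₀ k)} inverse-β₀ inverse-β₀ inverse-β₀)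
          (inverse₃ {e (β₁ k)} {inv (β₁ k)} {e (β₂ k)} {inv (β₂ k)} {e (β₃ (k ℕ.+ m))} {inv (β₃ (k ℕ.+ m))} (inv-inverse {β₁ k} λ ())
            (inv-inverse {β₂ k} (2+4z≢0 (P ℤ.- + m ℤ.+ + k) (β₂-shape k)))
            (inv-inverse {β₃ (k ℕ.+ m)} (2+4z≢0 (+ 2 ℤ.* P ℤ.+ + suc (k ℕ.+ m)) (β₃-shape (k ℕ.+ m)))))
          (α-congruence k) (β-congruence k)

      G∈O : ∀ {k} → k ℕ.< m → O (G k)
      G∈O {k} k<m = O-* (O-* (O-* (O-* (O-e (α₀ k)) (O-e (α₀ k))) (O-e (α₀ k))) (O-* (O-* (β₀∈O k<m) (β₀∈O k<m)) (β₀∈O k<m))) (O-q^ (+ 1))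

      H∈O : ∀ {k} → k ℕ.< m → O (H k)
      H∈O {k} k<m = O-* (O-* (O-* (O-* (O-e (α₁ k)) (O-e (α₂ k))) (O-e (α₃ k))) (β̂∈O k<m)) (O-q^ (+ 1))

      g∈O : ∀ r → r ℕ.≤ m → O (g r)
      g∈O zero    _   = O-1
      g∈O (suc r) r<m = O-* {g r} {G r} (g∈O r (ℕₚ.<⇒≤ r<m)) (G∈O r<m)

      g≡h : ∀ r → r ℕ.≤ m → I (g r - h m r)
      g≡h zero    _   = I-resp (sym (-‿inverseʳ 1#)) I-0
      g≡h (suc r) r<m = I-resp {g r * (G r - H r) + (g r - h m r) * H r} {g (suc r) - h m (suc r)}
        (trans (solve 4 (λ g G h H → g :* (G :- H) :+ (g :- h) :* H := g :* G :- h :* H) refl (g r) (G r) (h m r) (H r)) (+-congˡ (-‿cong (sym (h-suc r)))))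
        (I-+ (I-*ʳ {g r} {G r - H r} (g∈O r (ℕₚ.<⇒≤ r<m)) (G≡H r<m)) (I-*ˡ {g r - h m r} {H r} (g≡h r (ℕₚ.<⇒≤ r<m)) (H∈O r<m)))

      -- The factor that all terms of block l inherit from the blocks before it. It is integral
      -- because every completed period of `R 2 4` has met its zero in the numerator first.
      C : Carrier
      C = cube (l ℕ.* n) * 1/1+q

      C∈O : O C
      C∈O = O-* (O-* (O-* (O-* R∈O R∈O) R∈O) (O-q^ _)) O-1/1+q
        where
        R∈O : O (R 2 4 (l ℕ.* n))
        R∈O = ≡.subst (λ k → O (R 2 4 k)) (ℕₚ.+-identityʳ (l ℕ.* n)) (R₂₄.R∈O l {0} ℕ.z≤n)

      T≈ : ∀ r → T (l ℕ.* n ℕ.+ r) ≈ factor r * (C * g r)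
      T≈ r = begin
        T k
          ≈⟨ solve 4 (λ x r p c → x :* (r :* r :* r) :* p :* c := x :* ((r :* r :* r :* p) :* c)) refl (1# + q^ (+ (4 ℕ.* k ℕ.+ 1))) (R 2 4 k) (q^ (+ k)) 1/1+q ⟩
        (1# + q^ (+ (4 ℕ.* k ℕ.+ 1))) * (cube k * 1/1+q)
          ≈⟨ *-cong (+-congˡ (q^-+≡ σ (+ 4 ℤ.* + r) (≡.trans (≡.cong +_ (ℕₚ.+-comm (4 ℕ.* k) 1)) (position 1 r)))) (*-congʳ (cube-g r)) ⟩
        factor r * (cube (l ℕ.* n) * g r * 1/1+q)
          ≈⟨ *-congˡ (solve 3 (λ x y z → x :* y :* z := x :* z :* y) refl (cube (l ℕ.* n)) (g r) 1/1+q) ⟩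
        factor r * (C * g r) ∎
        where k = l ℕ.* n ℕ.+ r

      head-sum : I (Σ< (suc m) (λ r → T (l ℕ.* n ℕ.+ r)) - sum m * C)
      head-sum = I-resp (trans (Σ<-− (suc m) _ _) (+-congˡ (-‿cong (Σ<-*ʳ (suc m) _ C))))
        (Σ<-I (suc m) λ {r} r≤m → I-resp {factor r * C * (g r - h m r)} {T (l ℕ.* n ℕ.+ r) - factor r * h m r * C}
          (trans (solve 4 (λ f c g h → f :* c :* (g :- h) := f :* (c :* g) :- f :* h :* c) refl (factor r) C (g r) (h m r)) (+-congʳ (sym (T≈ r))))
          (I-*ʳ {factor r * C} {g r - h m r} (O-* (O-+ O-1 (O-* (O-q^ σ) (O-q^ (+ 4 ℤ.* + r)))) C∈O) (g≡h r (ℕₚ.≤-pred r≤m))))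

      tail-sum : I (Σ< m (λ r → T (l ℕ.* n ℕ.+ (suc m ℕ.+ r))))
      tail-sum = Σ<-I m λ {r} r<m → T∈I (suc m ℕ.+ r) (ℕ.s≤s (ℕₚ.m≤m+n m r)) (bound r<m)
        where
        bound : ∀ {r} → r ℕ.< m → suc m ℕ.+ r ℕ.≤ 2 ℕ.* m
        bound {r} r<m = ≡.subst (ℕ._≤ 2 ℕ.* m) (ℕₚ.+-suc m r) (ℕₚ.+-monoʳ-≤ m (ℕₚ.≤-trans r<m (ℕₚ.m≤m+n m 0)))
        T∈I : ∀ r → m ℕ.< r → r ℕ.≤ 2 ℕ.* m → I (T (l ℕ.* n ℕ.+ r))
        T∈I r m<r r≤2m = I-*ˡ (I-*ˡ (I-*ʳ (O-+ O-1 (O-q^ _)) (I-*ˡ (E-*-E R∈E R∈E) (E⇒O R∈E))) (O-q^ _)) O-1/1+q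
          where R∈E = R₂₄.R∈E l m<r r≤2m

      block-sum : I (Σ< n (λ r → T (l ℕ.* n ℕ.+ r)) - sum m * C)
      block-sum = I-resp (trans (solve 3 (λ a b c → (a :- c) :+ b := (a :+ b) :- c) refl _ _ _)
          (+-congʳ (trans (sym (Σ<-split (suc m) m Tₗ)) (reflexive (≡.cong (λ z → Σ< (suc (m ℕ.+ z)) Tₗ) (≡.sym (ℕₚ.+-identityʳ m)))))))
        (I-+ head-sum tail-sum)
        where
        Tₗ : ℕ → Carrier
        Tₗ r = T (l ℕ.* n ℕ.+ r)

      -- The factors of (s²Q; Q)_m and (sQ/c; Q)_m on the product side; those of (s²Q/c; Q)_m and
      -- (sQ; Q)_m have exponents `β₂` and `β₄`.
      t₁ t₂ : ℕ → Carrier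
      t₁ j = e (+ 6 ℤ.+ + 8 ℤ.* P ℤ.+ + 4 ℤ.* + j)
      t₂ j = e (+ 3 ℤ.- + 2 ℤ.* N ℤ.+ + 4 ℤ.* + j)

      β₄ : ℕ → ℤ
      β₄ j = + 5 ℤ.+ + 4 ℤ.* P ℤ.+ + 4 ℤ.* + j

      inverse-β₄ : ∀ j → inv (β₄ j) * e (β₄ j) ≈ 1#
      inverse-β₄ j = ≡.subst (λ j → inv j * e j ≈ 1#) (position 5 j) (inv-inverse {+ (5 ℕ.+ 4 ℕ.* (l ℕ.* n ℕ.+ j))} λ ())

      top≈ : ∀ j → top j ≈ t₁ j * t₂ j
      top≈ j = *-cong
        (+-congˡ (-‿cong (trans (merge₃ σ σ (+ 4 ℤ.* + suc j)) (q^-≡ (exponent₁ P (+ j))))))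
        (+-congˡ (-‿cong (trans (merge₃ σ (ℤ.- γ) (+ 4 ℤ.* + suc j)) (q^-≡ (exponent₂ P N (+ j))))))
        where
        exponent₁ : ∀ P j → (+ 1 ℤ.+ + 4 ℤ.* P) ℤ.+ (+ 1 ℤ.+ + 4 ℤ.* P) ℤ.+ + 4 ℤ.* (+ 1 ℤ.+ j) ≡ + 6 ℤ.+ + 8 ℤ.* P ℤ.+ + 4 ℤ.* j
        exponent₁ = solve-∀
        exponent₂ : ∀ P N j → (+ 1 ℤ.+ + 4 ℤ.* P) ℤ.+ ℤ.- (+ 2 ℤ.+ + 4 ℤ.* P ℤ.+ + 2 ℤ.* N) ℤ.+ + 4 ℤ.* (+ 1 ℤ.+ j) ≡ + 3 ℤ.- + 2 ℤ.* N ℤ.+ + 4 ℤ.* j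
        exponent₂ = solve-∀

      bottom-inverse : ∀ j → bottom j * (inv (β₂ j) * inv (β₄ j)) ≈ 1#
      bottom-inverse j = begin
        (1# - q^ σ * q^ σ * q^ (ℤ.- γ) * y (suc j)) * (1# - q^ σ * y (suc j)) * (inv (β₂ j) * inv (β₄ j))
          ≈⟨ solve 4 (λ x y u v → x :* y :* (u :* v) := (u :* x) :* (v :* y)) refl _ _ _ _ ⟩
        (inv (β₂ j) * (1# - q^ σ * q^ σ * q^ (ℤ.- γ) * y (suc j))) * (inv (β₄ j) * (1# - q^ σ * y (suc j)))
          ≈⟨ *-cong (inv₂ j) (trans (*-congˡ (+-congˡ (-‿cong (sym (q^-+≡ σ (+ 4 ℤ.* + suc j) (exponent P (+ j))))))) (inverse-β₄ j)) ⟩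
        1# * 1# ≈⟨ *-identityʳ 1# ⟩
        1# ∎
        where
        exponent : ∀ P j → + 5 ℤ.+ + 4 ℤ.* P ℤ.+ + 4 ℤ.* j ≡ (+ 1 ℤ.+ + 4 ℤ.* P) ℤ.+ + 4 ℤ.* (+ 1 ℤ.+ j)
        exponent = solve-∀

      sum-closed : sum m ≈ (1# + q^ σ) * (Π< m t₁ * Π< m t₂ * Π< m (λ j → inv (β₂ j) * inv (β₄ j)))
      sum-closed = begin
        sum m                                ≈⟨ *-identityʳ _ ⟨
        sum m * 1#                           ≈⟨ *-congˡ (trans (Π<-cong m (λ {j} _ → bottom-inverse j)) (Π<-1 m)) ⟨
        sum m * Π< m (λ j → bottom j * b̂ j)  ≈⟨ *-congˡ (Π<-* m bottom b̂) ⟩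
        sum m * (Π< m bottom * Π< m b̂)       ≈⟨ *-assoc _ _ _ ⟨
        sum m * Π< m bottom * Π< m b̂         ≈⟨ *-congʳ (summation m) ⟩
        (1# + q^ σ) * Π< m top * Π< m b̂      ≈⟨ *-assoc _ _ _ ⟩
        (1# + q^ σ) * (Π< m top * Π< m b̂)    ≈⟨ *-congˡ (*-congʳ (trans (Π<-cong m (λ {j} _ → top≈ j)) (Π<-* m t₁ t₂))) ⟩
        (1# + q^ σ) * (Π< m t₁ * Π< m t₂ * Π< m b̂) ∎
        where
        b̂ : ℕ → Carrier
        b̂ j = inv (β₂ j) * inv (β₄ j)

    -- The first block in closed form.

    module Exact where
      open Block 0

      2+4_ : ℕ → ℤ
      2+4 j = + 2 ℤ.+ + 4 ℤ.* + j

      -- The exponents 6 + 4j are 2 + 4j shifted by one place. The shift trades 1 - q² for 1 -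
      -- q^(2n), and their quotient is the q-integer of the right-hand side.
      Π-t₁ : Π< m t₁ ≈ inv (+ 2) * (Π< m (λ j → e (2+4 j)) * e (+ (2 ℕ.* n)))
      Π-t₁ = begin
        Π< m t₁
          ≈⟨ Π<-cong m (λ {j} _ → e-≡ (exponent (+ j))) ⟩
        Π< m (λ j → e (2+4 suc j))
          ≈⟨ trans (*-congʳ (inv-inverse {+ 2} λ ())) (*-identityˡ _) ⟨
        inv (+ 2) * e (+ 2) * Π< m (λ j → e (2+4 suc j))
          ≈⟨ *-assoc _ _ _ ⟩
        inv (+ 2) * (e (2+4 0) * Π< m (λ j → e (2+4 suc j)))
          ≈⟨ *-congˡ (Π<-front m (λ j → e (2+4 j))) ⟨
        inv (+ 2) * (Π< m (λ j → e (2+4 j)) * e (2+4 m))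
          ≈⟨ *-congˡ (*-congˡ (e-≡ (≡.trans (≡.cong (λ z → + 2 ℤ.+ z) (≡.sym (ℤₚ.pos-* 4 m))) (≡.cong +_ (2+4m≡2n m))))) ⟩
        inv (+ 2) * (Π< m (λ j → e (2+4 j)) * e (+ (2 ℕ.* n))) ∎
        where
        exponent : ∀ j → + 6 ℤ.+ 0ℤ ℤ.+ + 4 ℤ.* j ≡ + 2 ℤ.+ + 4 ℤ.* (+ 1 ℤ.+ j)
        exponent = solve-∀

      -- Since 2n = 4m + 2, reading the product backwards removes n from its exponents.
      reversed : ∀ {j} → j ℕ.< m → ∀ c → c ℤ.- + 2 ℤ.* N ℤ.+ + 4 ℤ.* + (m ℕ.∸ suc j) ≡ c ℤ.- + 6 ℤ.- + 4 ℤ.* + j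
      reversed {j} j<m c = ≡.trans (≡.cong₂ (λ x y → c ℤ.- + 2 ℤ.* x ℤ.+ + 4 ℤ.* y) N-odd
          (≡.trans (≡.sym (ℤₚ.⊖-≥ j<m)) (≡.sym (ℤₚ.m-n≡m⊖n m (suc j)))))
        (shape c (+ m) (+ j))
        where
        shape : ∀ c m j → c ℤ.- + 2 ℤ.* (+ 1 ℤ.+ + 2 ℤ.* m) ℤ.+ + 4 ℤ.* (m ℤ.- (+ 1 ℤ.+ j)) ≡ c ℤ.- + 6 ℤ.- + 4 ℤ.* j
        shape = solve-∀

      Π-t₂ : Π< m t₂ ≈ Π< m (λ j → e (ℤ.- (+ 1 ℤ.+ (2+4 j))))
      Π-t₂ = trans (Π<-reverse m t₂) (Π<-cong m λ {j} j<m → e-≡ (≡.trans (reversed j<m (+ 3)) (shape (+ j))))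
        where
        shape : ∀ j → + 3 ℤ.- + 6 ℤ.- + 4 ℤ.* j ≡ ℤ.- (+ 1 ℤ.+ (+ 2 ℤ.+ + 4 ℤ.* j))
        shape = solve-∀

      Π-β₂ : Π< m (λ j → inv (β₂ j)) ≈ Π< m (λ j → inv (ℤ.- (2+4 j)))
      Π-β₂ = trans (Π<-reverse m (λ j → inv (β₂ j))) (Π<-cong m λ {j} j<m → reflexive (≡.cong inv (≡.trans (reversed j<m (+ 4)) (shape (+ j)))))
        where
        shape : ∀ j → + 4 ℤ.- + 6 ℤ.- + 4 ℤ.* j ≡ ℤ.- (+ 2 ℤ.+ + 4 ℤ.* j)
        shape = solve-∀

      swap : ∀ j → e (2+4 j) * e (ℤ.- (+ 1 ℤ.+ (2+4 j))) * inv (ℤ.- (2+4 j)) ≈ e (+ 1 ℤ.+ (2+4 j)) * q^ (ℤ.- + 1)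
      swap j = begin
        e i * e (ℤ.- (+ 1 ℤ.+ i)) * inv (ℤ.- i)                     ≈⟨ *-congʳ (e-swap i) ⟩
        e (+ 1 ℤ.+ i) * q^ (ℤ.- + 1) * e (ℤ.- i) * inv (ℤ.- i)      ≈⟨ *-assoc _ _ _ ⟩
        e (+ 1 ℤ.+ i) * q^ (ℤ.- + 1) * (e (ℤ.- i) * inv (ℤ.- i))    ≈⟨ *-congˡ (trans (*-comm _ _) (inv-inverse -i≢0)) ⟩
        e (+ 1 ℤ.+ i) * q^ (ℤ.- + 1) * 1#                           ≈⟨ *-identityʳ _ ⟩
        e (+ 1 ℤ.+ i) * q^ (ℤ.- + 1)                                ∎
        where
        i = 2+4 j
        -i≢0 : ℤ.- i ≢ 0ℤ
        -i≢0 = 2+4z≢0 (ℤ.- + 1 ℤ.- + j) (shape (+ j))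
          where
          shape : ∀ j → ℤ.- (+ 2 ℤ.+ + 4 ℤ.* j) ≡ + 2 ℤ.+ + 4 ℤ.* (ℤ.- + 1 ℤ.- j)
          shape = solve-∀

      -- After the reversal the products combine factor by factor: `swap` yields (1 - q^(3+4j))
      -- q^(-1), and `β₄` supplies the denominator 1 - q^(5+4j).
      products : Π< m (λ j → e (2+4 j)) * Π< m t₂ * Π< m (λ j → inv (β₂ j) * inv (β₄ j)) ≈ R 3 5 m * q^ (ℤ.- + m)
      products = begin
        Π< m x * Π< m t₂ * Π< m (λ j → inv (β₂ j) * inv (β₄ j))
          ≈⟨ *-cong (*-congˡ Π-t₂) (trans (Π<-* m (λ j → inv (β₂ j)) _) (*-congʳ Π-β₂)) ⟩
        Π< m x * Π< m w * (Π< m u * Π< m (λ j → inv (β₄ j)))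
          ≈⟨ *-assoc _ _ _ ⟨
        Π< m x * Π< m w * Π< m u * Π< m (λ j → inv (β₄ j))
          ≈⟨ *-congʳ (trans (Π<-* m (λ j → x j * w j) u) (*-congʳ (Π<-* m x w))) ⟨
        Π< m (λ j → x j * w j * u j) * Π< m (λ j → inv (β₄ j))
          ≈⟨ Π<-* m (λ j → x j * w j * u j) (λ j → inv (β₄ j)) ⟨
        Π< m (λ j → x j * w j * u j * inv (β₄ j))
          ≈⟨ Π<-cong m (λ {j} _ → trans (*-cong (trans (swap j) (*-congʳ (e-≡ (≡.trans (shape (+ j)) (≡.sym (position 3 j))))))
               (reflexive (≡.cong inv (≡.sym (position 5 j))))) (solve 3 (λ a b c → (a :* b) :* c := (a :* c) :* b) refl _ _ _)) ⟩
        Π< m (λ j → e (+ (3 ℕ.+ 4 ℕ.* j)) * inv (+ (5 ℕ.+ 4 ℕ.* j)) * q^ (ℤ.- + 1))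
          ≈⟨ Π<-* m (λ j → e (+ (3 ℕ.+ 4 ℕ.* j)) * inv (+ (5 ℕ.+ 4 ℕ.* j))) (λ _ → q^ (ℤ.- + 1)) ⟩
        R 3 5 m * Π< m (λ _ → q^ (ℤ.- + 1))
          ≈⟨ *-congˡ (Π<-q⁻¹ m) ⟩
        R 3 5 m * q^ (ℤ.- + m) ∎
        where
        x w u : ℕ → Carrier
        x j = e (2+4 j)
        w j = e (ℤ.- (+ 1 ℤ.+ (2+4 j)))
        u j = inv (ℤ.- (2+4 j))
        shape : ∀ j → + 1 ℤ.+ (+ 2 ℤ.+ + 4 ℤ.* j) ≡ + 3 ℤ.+ 0ℤ ℤ.+ + 4 ℤ.* j
        shape = solve-∀

      sum-C : (1# + q^ σ) * C ≈ 1#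
      sum-C = begin
        (1# + q^ (+ 1)) * (1# * 1# * 1# * q^ (+ 0) * (e (+ 1) * inv (+ 2)))
          ≈⟨ *-congˡ (*-congʳ (*-congˡ q^-zero)) ⟩
        (1# + q^ (+ 1)) * (1# * 1# * 1# * 1# * ((1# - q^ (+ 1)) * inv (+ 2)))
          ≈⟨ solve 2 (λ q i → let 𝟙 = con (+ 1) in (𝟙 :+ q) :* (𝟙 :* 𝟙 :* 𝟙 :* 𝟙 :* ((𝟙 :- q) :* i)) := i :* (𝟙 :- q :* q)) refl (q^ (+ 1)) (inv (+ 2)) ⟩
        inv (+ 2) * (1# - q^ (+ 1) * q^ (+ 1))
          ≈⟨ *-congˡ (+-congˡ (-‿cong (q^-+ (+ 1) (+ 1)))) ⟨
        inv (+ 2) * e (+ 2)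
          ≈⟨ inv-inverse {+ 2} (λ ()) ⟩
        1# ∎

      sum*C≈rhs : sum m * C ≈ rhs m
      sum*C≈rhs = begin
        sum m * C
          ≈⟨ *-congʳ sum-closed ⟩
        (1# + q^ σ) * (Π< m t₁ * Π< m t₂ * D) * C
          ≈⟨ solve 3 (λ a b c → (a :* b) :* c := (a :* c) :* b) refl (1# + q^ σ) _ C ⟩
        (1# + q^ σ) * C * (Π< m t₁ * Π< m t₂ * D)
          ≈⟨ trans (*-congʳ sum-C) (*-identityˡ _) ⟩
        Π< m t₁ * Π< m t₂ * D
          ≈⟨ *-congʳ (*-congʳ Π-t₁) ⟩
        inv (+ 2) * (A * z) * Π< m t₂ * D
          ≈⟨ solve 5 (λ i a z b d → i :* (a :* z) :* b :* d := z :* i :* (a :* b :* d)) refl (inv (+ 2)) A z (Π< m t₂) D ⟩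
        z * inv (+ 2) * (A * Π< m t₂ * D)
          ≈⟨ *-congˡ products ⟩
        z * inv (+ 2) * (R 3 5 m * q^ (ℤ.- + m))
          ≈⟨ *-assoc _ _ _ ⟨
        rhs m ∎
        where
        A = Π< m (λ j → e (2+4 j))
        D = Π< m (λ j → inv (β₂ j) * inv (β₄ j))
        z = e (+ (2 ℕ.* n))

      half-sum≡rhs : I (Σ< (suc m) T - rhs m)
      half-sum≡rhs = I-resp (+-congˡ (-‿cong sum*C≈rhs)) head-sum

      full-sum≡rhs : I (Σ< n T - rhs m)
      full-sum≡rhs = I-resp (+-congˡ (-‿cong sum*C≈rhs)) block-sum

    -- Vanishing of every block for n = 4t + 3.

    module Mod3 (t : ℕ) (m≡ : m ≡ suc (2 ℕ.* t)) where

      3+4t≡n : 3 ℕ.+ 4 ℕ.* t ≡ n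
      3+4t≡n = ≡.trans (shape t) (≡.cong (λ z → suc (2 ℕ.* z)) (≡.sym m≡))
        where
        shape : ∀ t → 3 ℕ.+ 4 ℕ.* t ≡ suc (2 ℕ.* suc (2 ℕ.* t))
        shape = ℕSolver.solve-∀

      -- The zero of 5 + 4j modulo n within a period, at 5 + 4j = 3n. It comes no earlier than m, so
      -- the denominators 1 - q^(5+4ln+4j) with j < m are units at Φ_n.
      j₁ : ℕ
      j₁ = 1 ℕ.+ 3 ℕ.* t

      5+4j₁≡3n : 5 ℕ.+ 4 ℕ.* j₁ ≡ 3 ℕ.* n
      5+4j₁≡3n = ≡.trans (shape t) (≡.cong (3 ℕ.*_) 3+4t≡n)
        where
        shape : ∀ t → 5 ℕ.+ 4 ℕ.* (1 ℕ.+ 3 ℕ.* t) ≡ 3 ℕ.* (3 ℕ.+ 4 ℕ.* t)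
        shape = ℕSolver.solve-∀

      n∣5+4j₁ : n ∣ 5 ℕ.+ 4 ℕ.* j₁
      n∣5+4j₁ = ℕ∣.divides 3 5+4j₁≡3n

      m≤j₁ : m ℕ.≤ j₁
      m≤j₁ = ≡.subst (ℕ._≤ j₁) (≡.sym m≡) (ℕ.s≤s (ℕₚ.*-monoˡ-≤ t (ℕₚ.n≤1+n 2)))

      t<m : t ℕ.< m
      t<m = ≡.subst (t ℕ.<_) (≡.sym m≡) (ℕ.s≤s (ℕₚ.m≤m+n t _))

      j₁<n : j₁ ℕ.< n
      j₁<n = ≡.subst (j₁ ℕ.<_) 3+4t≡n (ℕ.s≤s (ℕ.s≤s (ℕₚ.≤-trans (ℕₚ.*-monoˡ-≤ t (ℕₚ.n≤1+n 3)) (ℕₚ.n≤1+n _))))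

      module R₃₅ = Ratio 3 5 t j₁ (ℕₚ.<-≤-trans t<m m≤j₁) j₁<n (ℕ.s≤s ℕ.z≤n) (ℕ∣.divides 1 (≡.trans 3+4t≡n (≡.sym (ℕₚ.*-identityˡ n)))) n∣5+4j₁

      module _ (l : ℕ) where
        open Block l

        β₄∈O : ∀ {j} → j ℕ.< m → O (inv (β₄ j))
        β₄∈O {j} j<m = ≡.subst (λ z → O (inv z)) (position 5 j) (R₃₅.den∈O l (ℕₚ.<-trans j<m m<n) (ℕₚ.<⇒≢ (ℕₚ.<-≤-trans j<m m≤j₁)))

        -- The vanishing factor is the last one, j = 2t = m - 1; in `t₂∈E` it is the one at j = t.
        t₁∈E : E (Π< m t₁)
        t₁∈E = ≡.subst (λ k → E (Π< k t₁)) (≡.sym m≡) (Π<-E (suc (2 ℕ.* t)) (ℕₚ.n<1+n _)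
          (E-resp (e-≡ (≡.sym exponent)) (E-e (+ 2 ℤ.+ + 8 ℤ.* + l))) λ _ → O-e _)
          where
          shape : ∀ L N t → + 2 ℤ.+ + 4 ℤ.* (+ 1 ℤ.+ + 2 ℤ.* t) ≡ + 2 ℤ.* N →
            + 6 ℤ.+ + 8 ℤ.* (L ℤ.* N) ℤ.+ + 4 ℤ.* (+ 2 ℤ.* t) ≡ (+ 2 ℤ.+ + 8 ℤ.* L) ℤ.* N
          shape L N t eq = ≡.trans (shape₁ L N t) (≡.trans (≡.cong (ℤ._+ + 8 ℤ.* (L ℤ.* N)) eq) (shape₂ L N))
            where
            shape₁ : ∀ L N t → + 6 ℤ.+ + 8 ℤ.* (L ℤ.* N) ℤ.+ + 4 ℤ.* (+ 2 ℤ.* t) ≡ + 2 ℤ.+ + 4 ℤ.* (+ 1 ℤ.+ + 2 ℤ.* t) ℤ.+ + 8 ℤ.* (L ℤ.* N)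
            shape₁ = solve-∀
            shape₂ : ∀ L N → + 2 ℤ.* N ℤ.+ + 8 ℤ.* (L ℤ.* N) ≡ (+ 2 ℤ.+ + 8 ℤ.* L) ℤ.* N
            shape₂ = solve-∀
          exponent : + 6 ℤ.+ + 8 ℤ.* P ℤ.+ + 4 ℤ.* + (2 ℕ.* t) ≡ (+ 2 ℤ.+ + 8 ℤ.* + l) ℤ.* N
          exponent = ≡.trans (≡.cong (λ z → + 6 ℤ.+ + 8 ℤ.* P ℤ.+ + 4 ℤ.* z) (ℤₚ.pos-* 2 t)) (shape (+ l) N (+ t)
            (≡.trans (double (+ t)) (≡.cong (+ 2 ℤ.*_) (≡.trans (≡.cong (λ z → + 3 ℤ.+ z) (≡.sym (ℤₚ.pos-* 4 t))) (≡.cong +_ 3+4t≡n)))))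
            where
            double : ∀ t → + 2 ℤ.+ + 4 ℤ.* (+ 1 ℤ.+ + 2 ℤ.* t) ≡ + 2 ℤ.* (+ 3 ℤ.+ + 4 ℤ.* t)
            double = solve-∀

        t₂∈E : E (Π< m t₂)
        t₂∈E = Π<-E m t<m (E-resp (e-≡ (≡.sym exponent)) (E-e (ℤ.- + 1))) λ _ → O-e _
          where
          shape₁ : ∀ N t → + 3 ℤ.- + 2 ℤ.* N ℤ.+ + 4 ℤ.* t ≡ + 3 ℤ.+ + 4 ℤ.* t ℤ.- + 2 ℤ.* N
          shape₁ = solve-∀
          shape₂ : ∀ N → N ℤ.- + 2 ℤ.* N ≡ (ℤ.- + 1) ℤ.* N
          shape₂ = solve-∀
          exponent : + 3 ℤ.- + 2 ℤ.* N ℤ.+ + 4 ℤ.* + t ≡ (ℤ.- + 1) ℤ.* N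
          exponent = ≡.trans (shape₁ N (+ t)) (≡.trans (≡.cong (ℤ._- + 2 ℤ.* N)
            (≡.trans (≡.cong (λ z → + 3 ℤ.+ z) (≡.sym (ℤₚ.pos-* 4 t))) (≡.cong +_ 3+4t≡n))) (shape₂ N))

        sum∈I : I (sum m)
        sum∈I = I-resp (sym sum-closed) (I-*ʳ (O-+ O-1 (O-q^ σ)) (I-*ˡ (E-*-E t₁∈E t₂∈E)
          (Π<-O m λ j<m → O-* (β₂∈O j<m) (β₄∈O j<m))))

        private
          remove : ∀ {x} → I (x - sum m * C) → I x
          remove {x} x≡ = I-resp (solve 2 (λ x y → (x :- y) :+ y := x) refl x (sum m * C)) (I-+ x≡ (I-*ˡ sum∈I C∈O))

        head-sum∈I : I (Σ< (suc m) (λ r → T (l ℕ.* n ℕ.+ r)))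
        head-sum∈I = remove head-sum

        block-sum∈I : I (Σ< n (λ r → T (l ℕ.* n ℕ.+ r)))
        block-sum∈I = remove block-sum

      blocks∈I : ∀ l → I (Σ< (l ℕ.* n) T)
      blocks∈I zero    = I-0
      blocks∈I (suc l) = I-resp (trans (sym (Σ<-split (l ℕ.* n) n T)) (reflexive (≡.cong (λ k → Σ< k T) (ℕₚ.+-comm (l ℕ.* n) n))))
        (I-+ (blocks∈I l) (block-sum∈I l))

      partial-blocks∈I : ∀ l → I (Σ< (l ℕ.* n ℕ.+ suc m) T)
      partial-blocks∈I l = I-resp (sym (Σ<-split (l ℕ.* n) (suc m) T)) (I-+ (blocks∈I l) (head-sum∈I l))

      -- Position m lies after the numerator zero t and not beyond the denominator zero `j₁`, so the
      -- quotient carries an ε. For l = m this is the quotient in `rhs M`; the second ε comes from 1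
      -- - q^(2n²).
      R₃₅∈E : ∀ l → E (R 3 5 (l ℕ.* n ℕ.+ m))
      R₃₅∈E l = R₃₅.R∈E l t<m m≤j₁

      -- (n² − 1)/2
      M : ℕ
      M = m ℕ.* n ℕ.+ m

      n²≡ : n ℕ.* n ≡ suc (2 ℕ.* M)
      n²≡ = shape m
        where
        shape : ∀ m → suc (2 ℕ.* m) ℕ.* suc (2 ℕ.* m) ≡ suc (2 ℕ.* (m ℕ.* suc (2 ℕ.* m) ℕ.+ m))
        shape = ℕSolver.solve-∀

      rhs∈I : I (rhs M)
      rhs∈I = I-*ˡ (I-resp (solve 3 (λ x y z → (x :* z) :* y := x :* y :* z) refl _ _ _)
        (I-*ˡ (E-*-E (E-e∣ n∣) (R₃₅∈E m)) O-inv2)) (O-q^ (ℤ.- + M))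
        where
        n∣ : n ∣ 2 ℕ.* suc (2 ℕ.* M)
        n∣ = ℕ∣.∣n⇒∣m*n 2 (≡.subst (n ∣_) n²≡ (ℕ∣.m∣m*n n))
        O-inv2 : O (inv (+ 2))
        O-inv2 = O-inv {+ 2} λ n∣2 → contradiction (ℕ∣.∣⇒≤ n∣2) (ℕₚ.<⇒≱ (ℕ.s≤s (ℕₚ.*-monoʳ-≤ 2 0<m)))

      half-sum≡rhs : I (Σ< (suc M) T - rhs M)
      -- M + 1 = mn + (m + 1): m whole blocks and the first m + 1 terms of the next.
      half-sum≡rhs = I-+ (≡.subst (λ k → I (Σ< k T)) (ℕₚ.+-suc (m ℕ.* n) m) (partial-blocks∈I m)) (I-neg rhs∈I)

      full-sum≡rhs : I (Σ< (n ℕ.* n) T - rhs M)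
      full-sum≡rhs = I-+ (blocks∈I n) (I-neg rhs∈I)

-- Terms and right-hand side as explicit fractions.

module TermsAsFractions (R : CommutativeRing 0ℓ 0ℓ) (X : RationalFunctions.RegularPowers R) where
  open import Data.Nat as ℕ using (ℕ; zero; suc)
  import Data.Nat.Properties as ℕₚ
  open import Data.Integer as ℤ using (ℤ; +_; 1ℤ)
  open import Data.Product using (Σ; _×_; _,_)
  import Relation.Binary.PropositionalEquality as ≡
  open CommutativeRing R hiding (zero)
  open Fractions R
  open RationalFunctions R
  open RegularPowers X
  module F = CommutativeRing fractionRing
  module FW = WellPoisedSum fractionRing
  open IntegerRingSolver R
  open WellPoisedSum R
  open IntegerRingSolver fractionRing using () renaming (solve to solveᶠ; con to conᶠ; _:=_ to _:=ᶠ_; _:+_ to _:+ᶠ_; _:*_ to _:*ᶠ_; _:-_ to _:-ᶠ_)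
  open Powers X

  powersOfQ : Interfaces.PowersOfQ fractionRing
  powersOfQ = record { q^ = q^ ; q^-zero = q^-zero ; q^-+ = q^-+ ; inv = inv ; inv-inverse = λ {j} → inv-inverse {j} }

  module 𝓜 = Congruences fractionRing powersOfQ

  open import Relation.Binary.Reasoning.Setoid F.setoid

  poch : ℕ → ℕ → Carrier
  poch s k = Π< k λ j → 1# - x (s ℕ.+ 4 ℕ.* j)

  -- Shaped like the unfolding of a third power by `_^ₚ_`.
  cube : Carrier → Carrier
  cube p = p * (p * (p * 1#))

  ι-Π : ∀ n f → ι (Π< n f) ≃ FW.Π< n (λ j → ι (f j))
  ι-Π zero    f = F.refl
  ι-Π (suc n) f = F.trans (ι-* (Π< n f) (f n)) (F.*-congʳ {ι (f n)} (ι-Π n f))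

  ι-poch : ∀ s k → ι (poch s k) ≃ FW.Π< k (λ j → e (+ (s ℕ.+ 4 ℕ.* j)))
  ι-poch s k = F.trans (ι-Π k (λ j → 1# - x (s ℕ.+ 4 ℕ.* j))) (FW.Π<-cong k λ {j} _ → F.sym (e-+ (s ℕ.+ 4 ℕ.* j)))

  cubeᶠ : Fraction → Fraction
  cubeᶠ f = f F.* f F.* f

  ι-cube : ∀ p → ι (cube p) ≃ cubeᶠ (ι p)
  ι-cube p = F.trans (ι-cong (solve 1 (λ p → p :* (p :* (p :* con 1ℤ)) := p :* p :* p) refl p))
    (F.trans (ι-* (p * p) p) (F.*-congʳ {ι p} (ι-* p p)))

  R-poch : ∀ s t k → 𝓜.R s (suc t) k F.* ι (poch (suc t) k) ≃ ι (poch s k)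
  R-poch s t k = begin
    FW.Π< k (λ j → a j F.* b̂ j) F.* ι (poch (suc t) k)      ≈⟨ F.*-cong (FW.Π<-* k a b̂) (ι-poch (suc t) k) ⟩
    FW.Π< k a F.* FW.Π< k b̂ F.* FW.Π< k b                   ≈⟨ F.*-assoc (FW.Π< k a) (FW.Π< k b̂) (FW.Π< k b) ⟩
    FW.Π< k a F.* (FW.Π< k b̂ F.* FW.Π< k b)                 ≈⟨ F.*-congˡ {FW.Π< k a} (FW.Π<-* k b̂ b) ⟨
    FW.Π< k a F.* FW.Π< k (λ j → b̂ j F.* b j)
      ≈⟨ F.*-congˡ {FW.Π< k a} (F.trans (FW.Π<-cong k λ {j} _ → inv-inverse {+ (suc t ℕ.+ 4 ℕ.* j)} λ ()) (FW.Π<-1 k)) ⟩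
    FW.Π< k a F.* F.1#                                      ≈⟨ F.*-identityʳ (FW.Π< k a) ⟩
    FW.Π< k a                                               ≈⟨ ι-poch s k ⟨
    ι (poch s k)                                            ∎
    where
    a b b̂ : ℕ → Fraction
    a j = e (+ (s ℕ.+ 4 ℕ.* j))
    b j = e (+ (suc t ℕ.+ 4 ℕ.* j))
    b̂ j = inv (+ (suc t ℕ.+ 4 ℕ.* j))

  1/1+q-inverse : 𝓜.1/1+q F.* ι (1# + x 1) ≃ F.1#
  1/1+q-inverse = begin
    e (+ 1) F.* inv (+ 2) F.* ι (1# + x 1)
      ≈⟨ F.*-congˡ {e (+ 1) F.* inv (+ 2)} (ι-+ 1# (x 1)) ⟩
    e (+ 1) F.* inv (+ 2) F.* (F.1# F.+ q^ (+ 1))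
      ≈⟨ solveᶠ 2 (λ q i → let 𝟙 = conᶠ 1ℤ in (𝟙 :-ᶠ q) :*ᶠ i :*ᶠ (𝟙 :+ᶠ q) :=ᶠ i :*ᶠ (𝟙 :-ᶠ q :*ᶠ q)) F.refl (q^ (+ 1)) (inv (+ 2)) ⟩
    inv (+ 2) F.* (F.1# F.- q^ (+ 1) F.* q^ (+ 1))
      ≈⟨ F.*-congˡ {inv (+ 2)} (F.+-congˡ {F.1#} (F.-‿cong (q^-+ (+ 1) (+ 1)))) ⟨
    inv (+ 2) F.* e (+ 2)
      ≈⟨ inv-inverse {+ 2} (λ ()) ⟩
    F.1# ∎

  poch-regular : ∀ s k → Regular (poch (suc s) k)
  poch-regular s zero    = Regular-1
  poch-regular s (suc k) = Regular-* (poch-regular s k) (1-x-regular (s ℕ.+ 4 ℕ.* k))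

  -- 1 + q divides 1 - q², and a factor of a regular element is regular.
  1+x-regular : Regular (1# + x 1)
  1+x-regular = mkRegular λ {p} eq → cancel₀ (1-x-regular 1) (trans (*-congʳ (+-congˡ (-‿cong (x-+ 1 1))))
    (trans (solve 2 (λ q p → (con 1ℤ :- q :* q) :* p := (con 1ℤ :- q) :* ((con 1ℤ :+ q) :* p)) refl (x 1) p) (trans (*-congˡ eq) (zeroʳ _))))

  -- The congruence to be proved speaks of unreduced numerators and denominators. They are kept
  -- apart from the fraction `f`, in which the computation takes place.
  record Represents (a d : Carrier) (f : Fraction) : Set where
    constructor represents
    field
      den-regular : Regular d
      value       : frac a d den-regular ≃ f

  Represents-resp : ∀ {a a′ d d′ f} → a ≈ a′ → d ≈ d′ → Represents a d f → Represents a′ d′ f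
  Represents-resp {a} {a′} {d} {d′} {f} a≈ d≈ (represents D v) = represents D′ (F.trans {frac a′ d′ D′} {frac a d D} {f}
      (mk≃ (*-cong (sym a≈) d≈)) v)
    where
    D′ : Regular d′
    D′ = mkRegular λ eq → cancel₀ D (trans (*-congʳ d≈) eq)

  Represents-respᶠ : ∀ {a d f g} → f ≃ g → Represents a d f → Represents a d g
  Represents-respᶠ {a} {d} {f} {g} f≃g (represents D v) = represents D (F.trans {frac a d D} {f} {g} v f≃g)

  Represents-+ : ∀ {a b c d f g} → Represents a b f → Represents c d g → Represents (a * d + c * b) (b * d) (f F.+ g)
  Represents-+ {a} {b} {c} {d} {f} {g} (represents B v) (represents D w) =
    represents (Regular-* B D) (F.+-cong {frac a b B} {f} {frac c d D} {g} v w)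

  Represents-0 : Represents 0# 1# F.0#
  Represents-0 = represents Regular-1 (mk≃ refl)

  term-represents : ∀ k → Represents ((1# + x (4 ℕ.* k ℕ.+ 1)) * cube (poch 2 k) * x k) ((1# + x 1) * cube (poch 4 k)) (𝓜.T k)
  term-represents k = represents D (frac-unique {_} {_} {𝓜.T k} D (begin
    v F.* cubeᶠ r F.* z F.* c F.* ι (o * cube p₄)
      ≈⟨ F.*-congˡ {v F.* cubeᶠ r F.* z F.* c} (F.trans (ι-* o (cube p₄)) (F.*-congˡ {ι o} (ι-cube p₄))) ⟩
    v F.* cubeᶠ r F.* z F.* c F.* (ι o F.* cubeᶠ (ι p₄))
      ≈⟨ solveᶠ 6 (λ v r x c o p → v :*ᶠ (r :*ᶠ r :*ᶠ r) :*ᶠ x :*ᶠ c :*ᶠ (o :*ᶠ (p :*ᶠ p :*ᶠ p))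
           :=ᶠ v :*ᶠ ((r :*ᶠ p) :*ᶠ (r :*ᶠ p) :*ᶠ (r :*ᶠ p)) :*ᶠ x :*ᶠ (c :*ᶠ o)) F.refl v r z c (ι o) (ι p₄) ⟩
    v F.* cubeᶠ (r F.* ι p₄) F.* z F.* (c F.* ι o)
      ≈⟨ F.*-cong (F.*-congʳ {z} (F.*-congˡ {v} (F.*-cong (F.*-cong rp rp) rp))) 1/1+q-inverse ⟩
    v F.* cubeᶠ (ι p₂) F.* z F.* F.1#
      ≈⟨ F.*-identityʳ _ ⟩
    v F.* cubeᶠ (ι p₂) F.* z
      ≈⟨ F.*-congʳ {z} (F.*-cong (ι-+ 1# (x (4 ℕ.* k ℕ.+ 1))) (ι-cube p₂)) ⟨
    ι (1# + x (4 ℕ.* k ℕ.+ 1)) F.* ι (cube p₂) F.* z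
      ≈⟨ F.*-congʳ {z} (ι-* (1# + x (4 ℕ.* k ℕ.+ 1)) (cube p₂)) ⟨
    ι ((1# + x (4 ℕ.* k ℕ.+ 1)) * cube p₂) F.* z
      ≈⟨ ι-* ((1# + x (4 ℕ.* k ℕ.+ 1)) * cube p₂) (x k) ⟨
    ι ((1# + x (4 ℕ.* k ℕ.+ 1)) * cube p₂ * x k) ∎))
    where
    o = 1# + x 1
    p₂ = poch 2 k
    p₄ = poch 4 k
    v = F.1# F.+ q^ (+ (4 ℕ.* k ℕ.+ 1))
    r = 𝓜.R 2 4 k
    z = q^ (+ k)
    c = 𝓜.1/1+q
    rp : r F.* ι p₄ ≃ ι p₂
    rp = R-poch 2 3 k
    D₄ : Regular p₄
    D₄ = poch-regular 3 k
    D : Regular (o * cube p₄)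
    D = Regular-* 1+x-regular (Regular-* D₄ (Regular-* D₄ (Regular-* D₄ Regular-1)))

  q-integer : ℕ → Carrier
  q-integer N = Σ< N λ j → x (2 ℕ.* j)

  q-integer-closed : ∀ N → (1# - x 2) * q-integer N ≈ 1# - x (2 ℕ.* N)
  q-integer-closed zero    = trans (zeroʳ _) (sym (trans (+-congˡ (-‿cong x-zero)) (-‿inverseʳ 1#)))
  q-integer-closed (suc N) = trans (distribˡ _ _ _) (trans (+-congʳ (q-integer-closed N)) (trans
    (solve 2 (λ z y → let 𝟙 = con 1ℤ in (𝟙 :- z) :+ (𝟙 :- y) :* z := 𝟙 :- y :* z) refl (x (2 ℕ.* N)) (x 2))
    (+-congˡ (-‿cong (trans (sym (x-+ 2 (2 ℕ.* N))) (reflexive (≡.cong x (≡.sym (ℕₚ.*-suc 2 N)))))))))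

  rhs-represents : ∀ M → Represents (q-integer (suc (2 ℕ.* M)) * poch 3 M) (poch 5 M * x M) (𝓜.rhs M)
  rhs-represents M = represents D (frac-unique {_} {_} {𝓜.rhs M} D (begin
    z F.* i F.* r F.* x⁻ F.* ι (p₅ * x M)
      ≈⟨ F.*-congˡ {z F.* i F.* r F.* x⁻} (ι-* p₅ (x M)) ⟩
    z F.* i F.* r F.* x⁻ F.* (ι p₅ F.* q^ (+ M))
      ≈⟨ solveᶠ 6 (λ z i r x p y → z :*ᶠ i :*ᶠ r :*ᶠ x :*ᶠ (p :*ᶠ y) :=ᶠ z :*ᶠ i :*ᶠ (r :*ᶠ p) :*ᶠ (x :*ᶠ y)) F.refl z i r x⁻ (ι p₅) (q^ (+ M)) ⟩
    z F.* i F.* (r F.* ι p₅) F.* (x⁻ F.* q^ (+ M))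
      ≈⟨ F.*-cong (F.*-cong zi (R-poch 3 4 M)) (q^-inverse (+ M)) ⟩
    ι (q-integer N) F.* ι (poch 3 M) F.* F.1#
      ≈⟨ F.*-identityʳ _ ⟩
    ι (q-integer N) F.* ι (poch 3 M)
      ≈⟨ ι-* (q-integer N) (poch 3 M) ⟨
    ι (q-integer N * poch 3 M) ∎))
    where
    N = suc (2 ℕ.* M)
    p₅ = poch 5 M
    z = e (+ (2 ℕ.* N))
    i = inv (+ 2)
    r = 𝓜.R 3 5 M
    x⁻ = q^ (ℤ.- + M)
    D : Regular (p₅ * x M)
    D = Regular-* (poch-regular 4 M) (x-regular M)
    zi : z F.* i ≃ ι (q-integer N)
    zi = begin
      z F.* i                                       ≈⟨ F.*-congʳ {i} (e-+ (2 ℕ.* N)) ⟩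
      ι (1# - x (2 ℕ.* N)) F.* i                    ≈⟨ F.*-congʳ {i} (F.trans (F.sym (ι-cong (q-integer-closed N))) (ι-* (1# - x 2) (q-integer N))) ⟩
      ι (1# - x 2) F.* ι (q-integer N) F.* i        ≈⟨ F.*-congʳ {i} (F.*-congʳ {ι (q-integer N)} (e-+ 2)) ⟨
      e (+ 2) F.* ι (q-integer N) F.* i             ≈⟨ solveᶠ 3 (λ a b c → a :*ᶠ b :*ᶠ c :=ᶠ b :*ᶠ (c :*ᶠ a)) F.refl (e (+ 2)) (ι (q-integer N)) i ⟩
      ι (q-integer N) F.* (i F.* e (+ 2))           ≈⟨ F.*-congˡ {ι (q-integer N)} (inv-inverse {+ 2} λ ()) ⟩
      ι (q-integer N) F.* F.1#                      ≈⟨ F.*-identityʳ (ι (q-integer N)) ⟩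
      ι (q-integer N)                               ∎

  module Congruence {S : Carrier → Set} (S-1 : S 1#) (S-* : ∀ {x y} → S x → S y → S (x * y))
    (S-ℕ : ∀ n → S (ofℤ (+ suc n))) where
    open CoprimalityInRings R
    open Coprimality S S-1 S-*
    open Geometric x x-zero x-+
    open Localization {S} S-1 S-* S-ℕ
    open import Relation.Nullary using (¬_)
    open import Data.Nat.Divisibility as ℕ∣ using ()

    -- a/b ≡ c/d (mod φ²)
    record Congruent (φ a b c d : Carrier) : Set where
      constructor congruent
      field
        u v       : Carrier
        coprime-φ : Coprime v φ
        equality  : (a * d - c * b) * v ≈ φ * φ * u * (b * d)

    module _ (φ : Carrier) (m : ℕ) (φ∣ : φ ∣ x^ suc (2 ℕ.* m) −1) (x-coprime : Coprime (x 1) φ)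
      (x−1-coprime : ∀ {k} → ¬ suc (2 ℕ.* m) ℕ∣.∣ k → Coprime (x^ k −1) φ) (0<m : 0 ℕ.< m) where

      open At φ (2 ℕ.* m) φ∣ x-coprime x−1-coprime
      integralAt : 𝓜.IntegralAt m
      integralAt = record
        { O = Integral φ ; O-resp = Integral-resp φ ; O-1 = Integral-ι φ 1# ; O-+ = Integral-+ φ ; O-* = Integral-* φ
        ; O-neg = Integral-neg φ ; O-q^ = Integral-q^ ; O-inv = λ {j} → Integral-inv {j} ; O-ratio = λ a {b} → Integral-ratio a {b} }

      private
        module 𝓞 = 𝓜.AtOdd m integralAt 0<m

      private
        w = _∣_.quotient φ∣

        e≃ : e (+ suc (2 ℕ.* m)) ≃ ι φ F.* ι (- w)
        e≃ = F.trans (e-+ (suc (2 ℕ.* m))) (F.trans (ι-cong (trans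
          (solve 1 (λ z → con 1ℤ :- z := :- (z :- con 1ℤ)) refl (x (suc (2 ℕ.* m))))
          (trans (-‿cong (_∣_.equality φ∣)) (solve 2 (λ φ w → :- (φ :* w) := φ :* :- w) refl φ w)))) (ι-* φ (- w)))

      -- ε is a multiple of φ, not φ itself. The square of its cofactor joins the integral factor
      -- before denominators are cleared.
      I⇒Congruent : ∀ {a b c d f g} → Represents a b f → Represents c d g → 𝓞.I (f F.- g) → Congruent φ a b c d
      I⇒Congruent {a} {b} {c} {d} {f} {g} (represents B a/b) (represents D c/d) (𝓞.mkI {o} o∈O f-g≃) =
        extract (clear-denominators φ {φ * φ} {ι (- w) F.* ι (- w) F.* o} {frac a b B F.- frac c d D} eq
          (Integral-* φ {ι (- w) F.* ι (- w)} {o} (Integral-* φ {ι (- w)} {ι (- w)} (Integral-ι φ (- w)) (Integral-ι φ (- w))) o∈O))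
        where
        eq : frac a b B F.- frac c d D ≃ ι (φ * φ) F.* (ι (- w) F.* ι (- w) F.* o)
        eq = begin
          frac a b B F.- frac c d D
            ≈⟨ F.+-cong {frac a b B} {f} {F.- frac c d D} {F.- g} a/b (F.-‿cong {frac c d D} {g} c/d) ⟩
          f F.- g
            ≈⟨ f-g≃ ⟩
          e (+ suc (2 ℕ.* m)) F.* e (+ suc (2 ℕ.* m)) F.* o
            ≈⟨ F.*-congʳ {o} (F.*-cong e≃ e≃) ⟩
          ι φ F.* ι (- w) F.* (ι φ F.* ι (- w)) F.* o
            ≈⟨ solveᶠ 3 (λ p w o → p :*ᶠ w :*ᶠ (p :*ᶠ w) :*ᶠ o :=ᶠ (p :*ᶠ p) :*ᶠ (w :*ᶠ w :*ᶠ o)) F.refl (ι φ) (ι (- w)) o ⟩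
          ι φ F.* ι φ F.* (ι (- w) F.* ι (- w) F.* o)
            ≈⟨ F.*-congʳ {ι (- w) F.* ι (- w) F.* o} (ι-* φ φ) ⟨
          ι (φ * φ) F.* (ι (- w) F.* ι (- w) F.* o) ∎

        extract : (Σ Carrier λ u → Σ Carrier λ v → Coprime v φ × (a * d + - c * b) * v ≈ φ * φ * u * (b * d)) → Congruent φ a b c d
        extract (u , v , C , e) = congruent u v C (trans (*-congʳ (+-congˡ (solve 2 (λ c b → :- (c :* b) := :- c :* b) refl c b))) e)

      module _ {a b c d : Carrier} where

        -- In the outer congruences `suc (2 * m)` is n² itself; in the inner ones it is n, and n² is
        -- `suc (2 * M)`.
        outer-half : Represents a b (FW.Σ< (suc m) 𝓜.T) → Represents c d (𝓜.rhs m) → Congruent φ a b c d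
        outer-half A B = I⇒Congruent A B 𝓞.Exact.half-sum≡rhs

        outer-full : Represents a b (FW.Σ< (suc (2 ℕ.* m)) 𝓜.T) → Represents c d (𝓜.rhs m) → Congruent φ a b c d
        outer-full A B = I⇒Congruent A B 𝓞.Exact.full-sum≡rhs

      module _ (t : ℕ) (m≡ : m ≡.≡ suc (2 ℕ.* t)) (M : ℕ) (M≡ : M ≡.≡ m ℕ.* suc (2 ℕ.* m) ℕ.+ m) {a b c d : Carrier} where

        inner-half : Represents a b (FW.Σ< (suc M) 𝓜.T) → Represents c d (𝓜.rhs M) → Congruent φ a b c d
        inner-half A B = I⇒Congruent A B (≡.subst (λ M → 𝓞.I (FW.Σ< (suc M) 𝓜.T F.- 𝓜.rhs M)) (≡.sym M≡) (𝓞.Mod3.half-sum≡rhs t m≡))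

        inner-full : Represents a b (FW.Σ< (suc (2 ℕ.* M)) 𝓜.T) → Represents c d (𝓜.rhs M) → Congruent φ a b c d
        inner-full A B = I⇒Congruent A B (≡.subst (λ M → 𝓞.I (FW.Σ< (suc (2 ℕ.* M)) 𝓜.T F.- 𝓜.rhs M)) (≡.sym M≡)
          (≡.subst (λ k → 𝓞.I (FW.Σ< k 𝓜.T F.- 𝓜.rhs (𝓞.Mod3.M t m≡))) (𝓞.Mod3.n²≡ t m≡) (𝓞.Mod3.full-sum≡rhs t m≡)))

    -- If v₁ and v₂ are the cofactors modulo φ₁² and φ₂², then v₁ φ₂² + v₂ φ₁² is one modulo φ₁² φ₂².
    combine : ∀ {φ₁ φ₂ a b c d} → Coprime φ₁ φ₂ → Congruent φ₁ a b c d → Congruent φ₂ a b c d →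
      Σ Carrier λ u → Σ Carrier λ v → Coprime v (φ₁ * (φ₁ * 1#) * (φ₂ * (φ₂ * 1#))) ×
        (a * d - c * b) * v ≈ φ₁ * (φ₁ * 1#) * (φ₂ * (φ₂ * 1#)) * u * (b * d)
    combine {φ₁} {φ₂} {a} {b} {c} {d} C₁₂ (congruent u₁ v₁ C₁ eq₁) (congruent u₂ v₂ C₂ eq₂) =
      u₁ + u₂ , v₁ * (φ₂ * φ₂) + v₂ * (φ₁ * φ₁)
      , coprime-sym (coprime-* (square φ₁ mod₁) (square φ₂ mod₂))
      , trans (solve 4 (λ z v f w → z :* (v :+ w :* f) := (z :* v) :+ (z :* w) :* f) refl _ _ _ _)
          (trans (+-cong (trans (sym (*-assoc _ _ _)) (*-congʳ eq₁)) (*-congʳ eq₂))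
            (solve 5 (λ p q u v bd → p :* p :* u :* bd :* (q :* q) :+ q :* q :* v :* bd :* (p :* p)
              := p :* (p :* con 1ℤ) :* (q :* (q :* con 1ℤ)) :* (u :+ v) :* bd) refl φ₁ φ₂ u₁ u₂ (b * d)))
      where
      v = v₁ * (φ₂ * φ₂) + v₂ * (φ₁ * φ₁)
      square : ∀ φ → Coprime v φ → Coprime (φ * (φ * 1#)) v
      square φ C = coprime-* (coprime-sym C) (coprime-* (coprime-sym C) coprime-1)
      mod₁ : Coprime v φ₁
      mod₁ = coprime-resp (+-congˡ (*-assoc v₂ φ₁ φ₁)) (coprime-shift (v₂ * φ₁) (coprime-* C₁ (coprime-* (coprime-sym C₁₂) (coprime-sym C₁₂))))
      mod₂ : Coprime v φ₂
      mod₂ = coprime-resp (trans (+-comm _ _) (+-congʳ (*-assoc v₁ φ₂ φ₂))) (coprime-shift (v₁ * φ₂) (coprime-* C₂ (coprime-* C₁₂ C₁₂)))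

-- Return to the polynomials of the statement.

module Assembly where
  open import Defs
  open PolynomialRing
  open CyclotomicPolynomials
  open import Algebra.Bundles using (CommutativeRing)
  open import Data.Nat as ℕ using (ℕ; zero; suc; z≤n; s≤s)
  import Data.Nat.Properties as ℕₚ
  import Data.Nat.Divisibility as ℕ∣
  import Data.Nat.DivMod as DivMod
  open import Data.Nat.Tactic.RingSolver using (solve-∀)
  open import Data.Integer as ℤ using (ℤ; +_; 0ℤ; 1ℤ)
  import Data.Integer.Properties as ℤₚ
  open import Data.List using ([]; _∷_; map; upTo; applyUpTo; foldr)
  import Data.List.Properties as Listₚ
  open import Data.Product using (Σ; _×_; _,_)
  open import Function using (_∘_)
  open import Relation.Nullary using (¬_)
  open import Relation.Binary.PropositionalEquality as ≡ using (_≡_; _≢_)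
  private module Pₚ = CommutativeRing polyRing
  open Fractions polyRing
  open CoprimalityInRings polyRing
  private
    module PS = IntegerRingSolver polyRing
    module PW = WellPoisedSum polyRing

  -- An invertible constant term forces the coefficients of the other factor to vanish one after the
  -- other, from the bottom.
  UnitConst⇒Regular : ∀ {p} → UnitConst p → Regular p
  UnitConst⇒Regular {p} (u , up₀≡1) = mkRegular λ {r} → go r
    where
    open ≡.≡-Reasoning
    go : ∀ r → p *ₚ r ≋ [] → r ≋ []
    go []      _  = Pₚ.refl
    go (a ∷ r) eq = mk≋ λ { zero → a≡0 ; (suc i) → at (go r eq′) i }
      where
      a≡0 : a ≡ 0ℤ
      a≡0 = begin
        a                                  ≡⟨ ≡.trans (≡.cong (ℤ._* a) up₀≡1) (ℤₚ.*-identityˡ a) ⟨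
        u ℤ.* coeff p 0 ℤ.* a              ≡⟨ ℤₚ.*-assoc u (coeff p 0) a ⟩
        u ℤ.* (coeff p 0 ℤ.* a)            ≡⟨ ≡.cong (u ℤ.*_) (≡.trans (≡.sym (coeff-*-zero p (a ∷ r))) (at eq 0)) ⟩
        u ℤ.* 0ℤ                           ≡⟨ ℤₚ.*-zeroʳ u ⟩
        0ℤ                                 ∎
      eq′ : p *ₚ r ≋ []
      eq′ = mk≋ λ i → begin
        coeff (p *ₚ r) i                                      ≡⟨ ℤₚ.+-identityˡ _ ⟨
        0ℤ ℤ.+ coeff (p *ₚ r) i                               ≡⟨ ≡.cong (ℤ._+ coeff (p *ₚ r) i) (≡.cong (ℤ._* coeff p (suc i)) a≡0) ⟨
        a ℤ.* coeff p (suc i) ℤ.+ coeff (p *ₚ r) i            ≡⟨ ≡.cong (ℤ._+ coeff (p *ₚ r) i) (coeff-scale a p (suc i)) ⟨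
        coeff (scale a p) (suc i) ℤ.+ coeff (p *ₚ r) i        ≡⟨ coeff-+ (scale a p) (0ℤ ∷ p *ₚ r) (suc i) ⟨
        coeff (scale a p +ₚ (0ℤ ∷ p *ₚ r)) (suc i)            ≡⟨ at (*ₚ-∷ p a r) (suc i) ⟨
        coeff (p *ₚ (a ∷ r)) (suc i)                          ≡⟨ at eq (suc i) ⟩
        0ℤ                                                    ∎

  X^-regular : ∀ n → Regular (X^ n)
  X^-regular zero    = Regular-1
  X^-regular (suc n) = mkRegular λ {r} eq → cancel₀ (X^-regular n)
    (mk≋ λ i → at (Pₚ.trans (Pₚ.sym (0∷-* (X^ n) r)) eq) (suc i))

  1-X^-regular : ∀ n → Regular (oneₚ -ₚ X^ (suc n))
  1-X^-regular n = UnitConst⇒Regular (1ℤ , ≡.refl)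


  X^-powers : RationalFunctions.RegularPowers polyRing
  X^-powers = record { x = X^ ; x-zero = Pₚ.refl ; x-+ = X^-+ ; x-regular = X^-regular ; 1-x-regular = 1-X^-regular }

  open TermsAsFractions polyRing X^-powers hiding (poch)
  module Cvₚ = TermsAsFractions polyRing X^-powers
  open Congruence {NonzeroConst} NonzeroConst-1 NonzeroConst-* NonzeroConst-ofℤ

  -- Splitting off the constant term gives p = p₀ + q `tail p`, so u p - q (u `tail p`) = u p₀ = 1.
  coprime-X : ∀ {p} → UnitConst p → Coprime (X^ 1) p
  coprime-X {p} (u , up₀≡1) = coprime (-ₚ scale u (tail p)) (const u) oneₚ NonzeroConst-1 (begin
    -ₚ scale u (tail p) *ₚ X^ 1 +ₚ const u *ₚ p
      ≈⟨ Pₚ.+-cong (PS.solve 2 (λ t x → PS.:- t PS.:* x PS.:= PS.:- (x PS.:* t)) Pₚ.refl (scale u (tail p)) (X^ 1)) (const-* u p) ⟩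
    -ₚ (X^ 1 *ₚ scale u (tail p)) +ₚ scale u p
      ≈⟨ Pₚ.+-congʳ {scale u p} (Pₚ.-‿cong (Pₚ.trans (0∷-* oneₚ (scale u (tail p))) (∷-cong ≡.refl (Pₚ.*-identityˡ (scale u (tail p)))))) ⟩
    -ₚ (0ℤ ∷ scale u (tail p)) +ₚ scale u p
      ≈⟨ (mk≋ λ i → ≡.trans (coeff-+ (-ₚ (0ℤ ∷ scale u (tail p))) (scale u p) i) (≡.trans
           (≡.cong₂ ℤ._+_ (coeff-neg (0ℤ ∷ scale u (tail p)) i) (coeff-scale u p i)) (constant i))) ⟩
    oneₚ ∎)
    where
    open import Relation.Binary.Reasoning.Setoid Pₚ.setoid
    constant : ∀ i → ℤ.- coeff (0ℤ ∷ scale u (tail p)) i ℤ.+ u ℤ.* coeff p i ≡ coeff oneₚ i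
    constant zero    = ≡.trans (ℤₚ.+-identityˡ _) up₀≡1
    constant (suc i) = ≡.trans (≡.cong (λ z → ℤ.- z ℤ.+ u ℤ.* coeff p (suc i)) (≡.trans (coeff-scale u (tail p) i) (≡.cong (u ℤ.*_) (coeff-tail p i))))
      (ℤₚ.+-inverseˡ (u ℤ.* coeff p (suc i)))

  foldr-upTo : ∀ {A : Set} (f : ℕ → A) (_∙_ : A → A → A) (ε : A) n → foldr _∙_ ε (map f (upTo n)) ≡ foldr _∙_ ε (applyUpTo f n)
  foldr-upTo f _∙_ ε n = ≡.cong (foldr _∙_ ε) (Listₚ.map-upTo f n)

  prod-upTo : ∀ f n → prodₚ (map f (upTo n)) ≋ PW.Π< n f
  prod-upTo f n = Pₚ.trans (Pₚ.reflexive (foldr-upTo f _*ₚ_ oneₚ n)) (go f n)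
    where
    go : ∀ f n → prodₚ (applyUpTo f n) ≋ PW.Π< n f
    go f zero    = Pₚ.refl
    go f (suc n) = Pₚ.trans (Pₚ.*-congˡ {f 0} (go (f ∘ suc) n)) (Pₚ.sym (PW.Π<-front n f))

  sum-upTo : ∀ f n → sumₚ (map f (upTo n)) ≋ PW.Σ< n f
  sum-upTo f n = Pₚ.trans (Pₚ.reflexive (foldr-upTo f _+ₚ_ [] n)) (go f n)
    where
    go : ∀ f n → sumₚ (applyUpTo f n) ≋ PW.Σ< n f
    go f zero    = Pₚ.refl
    go f (suc n) = Pₚ.trans (Pₚ.+-congˡ {f 0} (go (f ∘ suc) n)) (Pₚ.sym (PW.Σ<-front n f))

  poch≋ : ∀ s k → poch s 4 k ≋ Cvₚ.poch s k
  poch≋ s k = prod-upTo (λ j → oneₚ -ₚ X^ (s ℕ.+ 4 ℕ.* j)) k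

  ^3≋ : ∀ {p r} → p ≋ r → p ^ₚ 3 ≋ cube r
  ^3≋ p≋r = Pₚ.*-cong p≋r (Pₚ.*-cong p≋r (Pₚ.*-congʳ {oneₚ} p≋r))

  FracRepresents : Frac → Fraction → Set
  FracRepresents f = Represents (num f) (den f)

  term-fraction : ∀ k → FracRepresents (term k) (𝓜.T k)
  term-fraction k = Represents-resp
    (Pₚ.*-congʳ {X^ k} (Pₚ.*-congˡ {oneₚ +ₚ X^ (4 ℕ.* k ℕ.+ 1)} (Pₚ.sym (^3≋ (poch≋ 2 k)))))
    (Pₚ.*-congˡ {oneₚ +ₚ X^ 1} (Pₚ.sym (^3≋ (poch≋ 4 k))))
    (term-represents k)

  sumTerms-fraction : ∀ m → FracRepresents (sumTerms m) (FW.Σ< m 𝓜.T)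
  sumTerms-fraction m = ≡.subst (λ fs → FracRepresents (sumF fs) (FW.Σ< m 𝓜.T)) (≡.sym (Listₚ.map-upTo term m)) (go term 𝓜.T term-fraction m)
    where
    go : ∀ (f : ℕ → Frac) T → (∀ k → FracRepresents (f k) (T k)) → ∀ m → FracRepresents (sumF (applyUpTo f m)) (FW.Σ< m T)
    go f T f≃T zero    = Represents-0
    go f T f≃T (suc m) = Represents-respᶠ (F.sym (FW.Σ<-front m T)) (Represents-+ (f≃T 0) (go (f ∘ suc) (T ∘ suc) (f≃T ∘ suc) m))

  -- `rhs` with the half length as a parameter, so that (n² - 1)/2 can be exchanged for mn + m by an
  -- equation.
  rhsFrac : ℕ → ℕ → Frac
  rhsFrac N M = (qint2 N *ₚ poch 3 4 M) ÷ (poch 5 4 M *ₚ X^ M)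

  rhs-fraction : ∀ M → FracRepresents (rhsFrac (suc (2 ℕ.* M)) M) (𝓜.rhs M)
  rhs-fraction M = Represents-resp
    (Pₚ.*-cong (Pₚ.sym (sum-upTo (λ j → X^ (2 ℕ.* j)) (suc (2 ℕ.* M)))) (Pₚ.sym (poch≋ 3 M)))
    (Pₚ.*-congʳ {X^ M} (Pₚ.sym (poch≋ 5 M)))
    (rhs-represents M)

  CongruentFrac : Poly → Frac → Frac → Set
  CongruentFrac φ f g = Congruent φ (num f) (den f) (num g) (den g)

  -- All that the local arguments use of Φ_n, stated for an arbitrary φ so that its definition by
  -- long division stays out of them.
  record ActsAsΦ (n : ℕ) (φ : Poly) : Set where
    field
      φ∣         : φ ∣ X^ n -ₚ oneₚ
      X-coprime  : Coprime (X^ 1) φ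
      −1-coprime : ∀ {k} → ¬ n ℕ∣.∣ k → Coprime (X^ k -ₚ oneₚ) φ

  Φ-acts : ∀ {n} → 0 ℕ.< n → ActsAsΦ n (Φ n)
  Φ-acts {n} 0<n = record
    { φ∣ = Cyclotomic.Φ∣−1 (cyclotomic 0<n)
    ; X-coprime = coprime-X {Φ n} (Cyclotomic.Φ-unit (cyclotomic 0<n))
    ; −1-coprime = Φ-coprime-−1 0<n }

  sum≡rhs : ∀ {φ} k M → (∀ {a b c d} → Represents a b (FW.Σ< k 𝓜.T) → Represents c d (𝓜.rhs M) → Congruent φ a b c d) →
    CongruentFrac φ (sumTerms k) (rhsFrac (suc (2 ℕ.* M)) M)
  sum≡rhs k M C = C {num (sumTerms k)} {den (sumTerms k)} {num (rhsFrac N M)} {den (rhsFrac N M)} (sumTerms-fraction k) (rhs-fraction M)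
    where N = suc (2 ℕ.* M)

  module _ (m : ℕ) (0<m : 0 ℕ.< m) (φ : Poly) (acts : ActsAsΦ (suc (2 ℕ.* m)) φ) where
    open ActsAsΦ acts
    private
      n = suc (2 ℕ.* m)

    outer-halfᶠ : CongruentFrac φ (sumTerms (suc m)) (rhsFrac n m)
    outer-halfᶠ = sum≡rhs (suc m) m (λ {a} {b} {c} {d} → outer-half φ m φ∣ X-coprime −1-coprime 0<m {a} {b} {c} {d})

    outer-fullᶠ : CongruentFrac φ (sumTerms n) (rhsFrac n m)
    outer-fullᶠ = sum≡rhs n m (λ {a} {b} {c} {d} → outer-full φ m φ∣ X-coprime −1-coprime 0<m {a} {b} {c} {d})

    module _ (t : ℕ) (m≡ : m ≡ suc (2 ℕ.* t)) (M : ℕ) (M≡ : M ≡ m ℕ.* n ℕ.+ m) where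

      inner-halfᶠ : CongruentFrac φ (sumTerms (suc M)) (rhsFrac (suc (2 ℕ.* M)) M)
      inner-halfᶠ = sum≡rhs (suc M) M (λ {a} {b} {c} {d} → inner-half φ m φ∣ X-coprime −1-coprime 0<m t m≡ M M≡ {a} {b} {c} {d})

      inner-fullᶠ : CongruentFrac φ (sumTerms (suc (2 ℕ.* M))) (rhsFrac (suc (2 ℕ.* M)) M)
      inner-fullᶠ = sum≡rhs (suc (2 ℕ.* M)) M (λ {a} {b} {c} {d} → inner-full φ m φ∣ X-coprime −1-coprime 0<m t m≡ M M≡ {a} {b} {c} {d})

  toCongMod : ∀ φ₁ φ₂ f g → Coprime φ₁ φ₂ → CongruentFrac φ₁ f g → CongruentFrac φ₂ f g → CongMod (φ₁ ^ₚ 2 *ₚ φ₂ ^ₚ 2) f g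
  toCongMod φ₁ φ₂ f g C c₁ c₂ = convert (combine C c₁ c₂)
    where
    P = φ₁ ^ₚ 2 *ₚ φ₂ ^ₚ 2
    convert : (Σ Poly λ u → Σ Poly λ v → Coprime v P ×
      (num f *ₚ den g -ₚ num g *ₚ den f) *ₚ v ≋ P *ₚ u *ₚ (den f *ₚ den g)) → CongMod P f g
    convert (u , v , coprime a b e (c , c≢0 , e≋c) eq , eq′) = u , v , (a , b , c , c≢0 , at (Pₚ.trans eq e≋c)) , at eq′

  -- Modulo the square of `Φ n` both sides vanish, modulo that of `Φ N` the sum is evaluated
  -- exactly. The two moduli are joined by their coprimality, which rests on n ≠ N.
  congruences-of-M : ∀ {n m t M} → m ≡ suc (2 ℕ.* t) → n ≡ suc (2 ℕ.* m) → M ≡ m ℕ.* suc (2 ℕ.* m) ℕ.+ m → 0 ℕ.< m → 0 ℕ.< M → n ≢ suc (2 ℕ.* M) →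
    ∀ {N} → N ≡ suc (2 ℕ.* M) →
    CongMod (Φ n ^ₚ 2 *ₚ Φ N ^ₚ 2) (sumTerms (suc M)) (rhsFrac N M) × CongMod (Φ n ^ₚ 2 *ₚ Φ N ^ₚ 2) (sumTerms N) (rhsFrac N M)
  congruences-of-M {n} {m} {t} {M} m≡ n≡@≡.refl M≡ 0<m 0<M n≢N {N} ≡.refl =
      toCongMod (Φ n) (Φ N) (sumTerms (suc M)) (rhsFrac N M) C
        (inner-halfᶠ m 0<m (Φ n) acts₁ t m≡ M M≡) (outer-halfᶠ M 0<M (Φ N) acts₂)
    , toCongMod (Φ n) (Φ N) (sumTerms N) (rhsFrac N M) C
        (inner-fullᶠ m 0<m (Φ n) acts₁ t m≡ M M≡) (outer-fullᶠ M 0<M (Φ N) acts₂)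
    where
    C : Coprime (Φ n) (Φ N)
    C = Φ-coprime (s≤s z≤n) (s≤s z≤n) n≢N
    acts₁ : ActsAsΦ n (Φ n)
    acts₁ = Φ-acts (s≤s z≤n)
    acts₂ : ActsAsΦ N (Φ N)
    acts₂ = Φ-acts (s≤s z≤n)

  congruences-of-half : ∀ {n m t K} → n ≡ suc (2 ℕ.* m) → m ≡ suc (2 ℕ.* t) → K ≡ (n ℕ.* n ℕ.∸ 1) ℕ./ 2 →
    CongMod (modulus n) (sumTerms (K ℕ.+ 1)) (rhsFrac (n ℕ.* n) K) × CongMod (modulus n) (sumTerms (n ℕ.* n)) (rhsFrac (n ℕ.* n) K)
  congruences-of-half {n} {m} {t} {K} n≡ m≡ K≡ = ≡.subst
    (λ k → CongMod (modulus n) (sumTerms k) (rhsFrac (n ℕ.* n) K) × CongMod (modulus n) (sumTerms (n ℕ.* n)) (rhsFrac (n ℕ.* n) K))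
    (ℕₚ.+-comm 1 K)
    (≡.subst (λ M → CongMod (modulus n) (sumTerms (suc M)) (rhsFrac (n ℕ.* n) M) × CongMod (modulus n) (sumTerms (n ℕ.* n)) (rhsFrac (n ℕ.* n) M))
      (≡.sym K≡M) (congruences-of-M {n} {m} {t} {M} m≡ n≡ ≡.refl 0<m 0<M n≢ n²≡))
    where
    M = m ℕ.* suc (2 ℕ.* m) ℕ.+ m
    n²≡ : n ℕ.* n ≡ suc (2 ℕ.* M)
    n²≡ = ≡.trans (≡.cong₂ ℕ._*_ n≡ n≡) (shape m)
      where
      shape : ∀ m → suc (2 ℕ.* m) ℕ.* suc (2 ℕ.* m) ≡ suc (2 ℕ.* (m ℕ.* suc (2 ℕ.* m) ℕ.+ m))
      shape = solve-∀
    K≡M : K ≡ M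
    K≡M = ≡.trans K≡ (≡.trans (≡.cong (λ z → (z ℕ.∸ 1) ℕ./ 2) n²≡) (≡.trans (≡.cong (ℕ._/ 2) (ℕₚ.*-comm 2 M)) (DivMod.m*n/n≡m M 2)))
    0<m : 0 ℕ.< m
    0<m = ≡.subst (0 ℕ.<_) (≡.sym m≡) (s≤s z≤n)
    0<M : 0 ℕ.< M
    0<M = ℕₚ.<-≤-trans 0<m (ℕₚ.m≤n+m m (m ℕ.* suc (2 ℕ.* m)))
    n≢ : n ≢ suc (2 ℕ.* M)
    n≢ eq = ℕₚ.<⇒≢ (ℕₚ.m<n+m m (ℕₚ.<-≤-trans 0<m (ℕₚ.m≤m*n m (suc (2 ℕ.* m)))))
      (ℕₚ.*-cancelˡ-≡ m M 2 (ℕₚ.suc-injective (≡.trans (≡.sym n≡) eq)))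

open import Defs
open import Data.Nat using (ℕ; _<_; _*_; _∸_; _/_; _%_; _+_)
open import Data.Product using (_×_)
open import Relation.Binary.PropositionalEquality using (_≡_; refl; trans; cong)
open import Data.Nat using (suc)
open import Data.Nat.DivMod using (m≡m%n+[m/n]*n)
open import Data.Nat.Tactic.RingSolver using (solve-∀)

theorem1p2 : (n : ℕ) → 0 < n → n % 4 ≡ 3 →
    CongMod (modulus n) (sumTerms (((n * n ∸ 1) / 2) + 1)) (rhs n)
    × CongMod (modulus n) (sumTerms (n * n)) (rhs n)
theorem1p2 n _ n%4≡3 = Assembly.congruences-of-half {n} {suc (2 * (n / 4))} {n / 4} n≡ refl refl
  where
  shape : ∀ t → 3 + t * 4 ≡ suc (2 * suc (2 * t))
  shape = solve-∀
  n≡ : n ≡ suc (2 * suc (2 * (n / 4)))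
  n≡ = trans (m≡m%n+[m/n]*n n 4) (trans (cong (_+ (n / 4) * 4) n%4≡3) (shape (n / 4)))
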